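{- Let $k, n$ be integers with $2 \le k \le n$ and let $\xi$ be a transcendental real number. Then $$\lambda_n (\xi) \ge \frac{w_k^{\rm lead} (\xi) - n + k}{(k-1) w_k^{\rm lead} (\xi) + n}.$$ Furthermore, this inequality remains true with $w_k^{\rm lead}(\xi)$ replaced by $w_k(\xi)$ when $k=2$ or when $n = k+1$.
   Context: For an integer $n \ge 1$ and a real number $\xi$, $\lambda_n(\xi)$ denotes the supremum (possibly $+\infty$) of the real numbers $\lambda$ such that, for arbitrarily large real numbers $X$, the inequalities $0 < |x_0| \le X$, $\max_{1 \le m \le n} |x_0 \xi^m - x_m| \le X^{ -\lambda}$ have a solution in integers $x_0, \ldots, x_n$. For an integer $k\ge1$, $w_k(\xi)$ denotes the supremum of the real numbers $w$ such that, for arbitrarily large real numbers $X$, the inequalities $0 < |x_k \xi^k + \cdots + x_1\xi + x_0| \le X^{ -w}$, $\max_{0\le j\le k}|x_j| \le X$ have a solution in integers $x_0,\ldots,x_k$; $w_k^{\rm lead}(\xi)$ is defined in the same way but with the additional requirement that $|x_k| \ge |x_j|$ for all $0 \le j \le k-1$. When the relevant exponent $w$ is $+\infty$, the right-hand side $\frac{w-n+k}{(k-1)w+n}$ is interpreted as its limit $1/(k-1)$. -}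

module Defs where

open import Data.Empty using (⊥)
open import Data.Fin using (Fin; zero; suc; toℕ; fromℕ)
open import Data.Integer using (ℤ; 0ℤ; +_; -[1+_])
import Data.Integer as ℤ
open import Data.Nat using (ℕ; zero; suc)
import Data.Nat as ℕ
import Data.Nat.Properties as ℕP
open import Data.Product using (Σ; Σ-syntax; ∃; ∃-syntax; _×_; _,_; proj₁; proj₂)
open import Data.Rational using (ℚ; 0ℚ; 1ℚ; ½)
import Data.Rational as ℚ
import Data.Rational.Properties as ℚP
open import Data.Rational.Solver using (module +-*-Solver)
open import Data.Sum using (inj₁; inj₂)
open import Data.Unit using (⊤)
import Data.Vec.Functional as Vector
open import Relation.Binary.PropositionalEquality using (_≡_; _≢_; refl; sym; trans; cong; cong₂; subst; subst₂)
open import Relation.Nullary using (¬_)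

-- The reals are Cauchy sequences of rationals; their equality is _≃_, not _≡_.

IsCauchy : (ℕ → ℚ) → Set
IsCauchy s = ∀ ε → 0ℚ ℚ.< ε →
  ∃[ N ] (∀ m n → N ℕ.≤ m → N ℕ.≤ n → ℚ.∣ s m ℚ.- s n ∣ ℚ.≤ ε)

record ℝ : Set where
  constructor mkℝ
  field
    seq    : ℕ → ℚ
    cauchy : IsCauchy seq

open ℝ public

infix 4 _≃_ _≤_ _<_

_≃_ : ℝ → ℝ → Set
x ≃ y = ∀ ε → 0ℚ ℚ.< ε →
  ∃[ N ] (∀ n → N ℕ.≤ n → ℚ.∣ seq x n ℚ.- seq y n ∣ ℚ.≤ ε)

_≤_ : ℝ → ℝ → Set
x ≤ y = ∀ ε → 0ℚ ℚ.< ε →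
  ∃[ N ] (∀ n → N ℕ.≤ n → seq x n ℚ.≤ seq y n ℚ.+ ε)

_<_ : ℝ → ℝ → Set
x < y = ∃[ ε ] (0ℚ ℚ.< ε) ×
  (∃[ N ] (∀ n → N ℕ.≤ n → seq x n ℚ.+ ε ℚ.≤ seq y n))

open +-*-Solver

module ℚ-Lemmas where
  +-diff : ∀ a b a′ b′ → (a ℚ.- a′) ℚ.+ (b ℚ.- b′) ≡ (a ℚ.+ b) ℚ.- (a′ ℚ.+ b′)
  +-diff = solve 4 (λ a b a′ b′ → (a :- a′) :+ (b :- b′) := (a :+ b) :- (a′ :+ b′)) refl

  neg-diff : ∀ a b → b ℚ.- a ≡ (ℚ.- a) ℚ.- (ℚ.- b)
  neg-diff = solve 2 (λ a b → b :- a := (:- a) :- (:- b)) refl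

  cancel : ∀ p q → (p ℚ.- q) ℚ.+ q ≡ p
  cancel = solve 2 (λ p q → (p :- q) :+ q := p) refl

  cancel′ : ∀ p q → (p ℚ.+ q) ℚ.- q ≡ p
  cancel′ = solve 2 (λ p q → (p :+ q) :- q := p) refl

  neg-swap : ∀ p q → ℚ.- (p ℚ.- q) ≡ q ℚ.- p
  neg-swap = solve 2 (λ p q → :- (p :- q) := q :- p) refl

  half-pos : ∀ {ε} → 0ℚ ℚ.< ε → 0ℚ ℚ.< ½ ℚ.* ε
  half-pos {ε} ε>0 = ℚP.positive⁻¹ (½ ℚ.* ε) {{ℚP.pos*pos⇒pos ½ ε {{ℚ.positive ε>0}}}}

  halves : ∀ ε → ½ ℚ.* ε ℚ.+ ½ ℚ.* ε ≡ ε
  halves ε = trans (sym (ℚP.*-distribʳ-+ ε ½ ½)) (ℚP.*-identityˡ ε)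

  ≤⊔ˡ : ∀ {a b m} → a ℕ.⊔ b ℕ.≤ m → a ℕ.≤ m
  ≤⊔ˡ {a} {b} = ℕP.≤-trans (ℕP.m≤m⊔n a b)

  ≤⊔ʳ : ∀ {a b m} → a ℕ.⊔ b ℕ.≤ m → b ℕ.≤ m
  ≤⊔ʳ {a} {b} = ℕP.≤-trans (ℕP.m≤n⊔m a b)

  ∣-∣-swap : ∀ p q → ℚ.∣ p ℚ.- q ∣ ≡ ℚ.∣ q ℚ.- p ∣
  ∣-∣-swap p q = trans (sym (ℚP.∣-p∣≡∣p∣ (p ℚ.- q)))
    (cong ℚ.∣_∣ (neg-swap p q))

  ∣p∣-∣q∣≤ : ∀ p q → ℚ.∣ p ∣ ℚ.- ℚ.∣ q ∣ ℚ.≤ ℚ.∣ p ℚ.- q ∣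
  ∣p∣-∣q∣≤ p q = subst₂ ℚ._≤_ refl
    (cancel′ ℚ.∣ p ℚ.- q ∣ ℚ.∣ q ∣)
    (ℚP.+-monoˡ-≤ (ℚ.- ℚ.∣ q ∣)
      (subst (λ t → ℚ.∣ t ∣ ℚ.≤ ℚ.∣ p ℚ.- q ∣ ℚ.+ ℚ.∣ q ∣)
        (cancel p q)
        (ℚP.∣p+q∣≤∣p∣+∣q∣ (p ℚ.- q) q)))

  ∣∣p∣-∣q∣∣≤ : ∀ p q → ℚ.∣ ℚ.∣ p ∣ ℚ.- ℚ.∣ q ∣ ∣ ℚ.≤ ℚ.∣ p ℚ.- q ∣
  ∣∣p∣-∣q∣∣≤ p q with ℚP.∣p∣≡p∨∣p∣≡-p (ℚ.∣ p ∣ ℚ.- ℚ.∣ q ∣)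
  ... | inj₁ e = subst (ℚ._≤ ℚ.∣ p ℚ.- q ∣) (sym e) (∣p∣-∣q∣≤ p q)
  ... | inj₂ e = subst₂ ℚ._≤_
      (sym (trans e (neg-swap ℚ.∣ p ∣ ℚ.∣ q ∣)))
      (∣-∣-swap q p)
      (∣p∣-∣q∣≤ q p)

  *-mono-≤ : ∀ {p q r s} → 0ℚ ℚ.≤ p → 0ℚ ℚ.≤ s → p ℚ.≤ q → r ℚ.≤ s → p ℚ.* r ℚ.≤ q ℚ.* s
  *-mono-≤ {p} {q} {r} {s} 0≤p 0≤s p≤q r≤s = ℚP.≤-trans
    (ℚP.*-monoˡ-≤-nonNeg p {{ℚ.nonNegative 0≤p}} r≤s)
    (ℚP.*-monoʳ-≤-nonNeg s {{ℚ.nonNegative 0≤s}} p≤q)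

  eventually-bounded : ∀ s → IsCauchy s →
    ∃[ B ] (0ℚ ℚ.< B) × (∃[ N ] (∀ n → N ℕ.≤ n → ℚ.∣ s n ∣ ℚ.≤ B))
  eventually-bounded s c with c 1ℚ (ℚP.positive⁻¹ 1ℚ)
  ... | N , h = 1ℚ ℚ.+ ℚ.∣ s N ∣
    , ℚP.+-mono-<-≤ (ℚP.positive⁻¹ 1ℚ) (ℚP.0≤∣p∣ (s N))
    , N
    , λ n N≤n → ℚP.≤-trans
        (subst (λ t → ℚ.∣ t ∣ ℚ.≤ ℚ.∣ s n ℚ.- s N ∣ ℚ.+ ℚ.∣ s N ∣)
          (cancel (s n) (s N))
          (ℚP.∣p+q∣≤∣p∣+∣q∣ (s n ℚ.- s N) (s N)))
        (ℚP.+-monoˡ-≤ ℚ.∣ s N ∣ (h n N N≤n ℕP.≤-refl))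

  inv-pos : ∀ b → 0ℚ ℚ.< b → ℚ
  inv-pos b b>0 = ℚ.1/_ b {{ℚP.pos⇒nonZero b {{ℚ.positive b>0}}}}

  inv-pos>0 : ∀ b (b>0 : 0ℚ ℚ.< b) → 0ℚ ℚ.< inv-pos b b>0
  inv-pos>0 b b>0 = ℚP.positive⁻¹ (inv-pos b b>0) {{ℚP.1/pos⇒pos b {{ℚ.positive b>0}}}}

  inv-posʳ : ∀ b (b>0 : 0ℚ ℚ.< b) → b ℚ.* inv-pos b b>0 ≡ 1ℚ
  inv-posʳ b b>0 = ℚP.*-inverseʳ b {{ℚP.pos⇒nonZero b {{ℚ.positive b>0}}}}

  *-pos : ∀ {p q} → 0ℚ ℚ.< p → 0ℚ ℚ.< q → 0ℚ ℚ.< p ℚ.* q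
  *-pos {p} {q} p>0 q>0 = ℚP.positive⁻¹ (p ℚ.* q)
    {{ℚP.pos*pos⇒pos p {{ℚ.positive p>0}} q {{ℚ.positive q>0}}}}

  inv-pos-antitone : ∀ {a b} (a>0 : 0ℚ ℚ.< a) (b>0 : 0ℚ ℚ.< b) → a ℚ.≤ b →
    inv-pos b b>0 ℚ.≤ inv-pos a a>0
  inv-pos-antitone {a} {b} a>0 b>0 a≤b = subst₂ ℚ._≤_
    (trans (sym (ℚP.*-assoc a i j))
      (trans (cong (ℚ._* j) (inv-posʳ a a>0)) (ℚP.*-identityˡ j)))
    (trans (cong (b ℚ.*_) (ℚP.*-comm i j)) (trans (sym (ℚP.*-assoc b j i))
      (trans (cong (ℚ._* i) (inv-posʳ b b>0)) (ℚP.*-identityˡ i))))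
    (ℚP.*-monoʳ-≤-nonNeg (i ℚ.* j)
      {{ℚ.nonNegative (ℚP.<⇒≤ (*-pos (inv-pos>0 a a>0) (inv-pos>0 b b>0)))}} a≤b)
    where
    i = inv-pos a a>0
    j = inv-pos b b>0

  share : ∀ B C e i → B ℚ.* (e ℚ.* i) ℚ.+ C ℚ.* (e ℚ.* i) ≡ e ℚ.* ((B ℚ.+ C) ℚ.* i)
  share = solve 4 (λ B C e i → B :* (e :* i) :+ C :* (e :* i) := e :* ((B :+ C) :* i)) refl

  *-diff : ∀ a b a′ b′ →
    a ℚ.* (b ℚ.- b′) ℚ.+ b′ ℚ.* (a ℚ.- a′) ≡ a ℚ.* b ℚ.- a′ ℚ.* b′
  *-diff = solve 4 (λ a b a′ b′ →
    a :* (b :- b′) :+ b′ :* (a :- a′) := a :* b :- a′ :* b′) refl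

  ∣*∣≤ : ∀ p q {D δ} → ℚ.∣ p ∣ ℚ.≤ D → ℚ.∣ q ∣ ℚ.≤ δ → ℚ.∣ p ℚ.* q ∣ ℚ.≤ D ℚ.* δ
  ∣*∣≤ p q {D} {δ} p≤ q≤ = subst (ℚ._≤ D ℚ.* δ) (sym (ℚP.∣p*q∣≡∣p∣*∣q∣ p q))
    (*-mono-≤ (ℚP.0≤∣p∣ p) (ℚP.≤-trans (ℚP.0≤∣p∣ q) q≤) p≤ q≤)

  *-diff-≤ : ∀ a b a′ b′ {B C δ ε} → B ℚ.* δ ℚ.+ C ℚ.* δ ≡ ε →
    ℚ.∣ a ∣ ℚ.≤ B → ℚ.∣ b ℚ.- b′ ∣ ℚ.≤ δ → ℚ.∣ b′ ∣ ℚ.≤ C → ℚ.∣ a ℚ.- a′ ∣ ℚ.≤ δ →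
    ℚ.∣ a ℚ.* b ℚ.- a′ ℚ.* b′ ∣ ℚ.≤ ε
  *-diff-≤ a b a′ b′ e a≤ b-b′≤ b′≤ a-a′≤ = subst₂ ℚ._≤_
    (cong ℚ.∣_∣ (*-diff a b a′ b′)) e
    (ℚP.≤-trans (ℚP.∣p+q∣≤∣p∣+∣q∣ (a ℚ.* (b ℚ.- b′)) (b′ ℚ.* (a ℚ.- a′)))
      (ℚP.+-mono-≤ (∣*∣≤ a (b ℚ.- b′) a≤ b-b′≤) (∣*∣≤ b′ (a ℚ.- a′) b′≤ a-a′≤)))

  inv-diff : ∀ a b p q → a ℚ.* p ≡ 1ℚ → b ℚ.* q ≡ 1ℚ →
    p ℚ.- q ≡ (b ℚ.- a) ℚ.* (p ℚ.* q)
  inv-diff a b p q ap bq = sym (trans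
    (solve 4 (λ a b p q → (b :- a) :* (p :* q) := (b :* q) :* p :- (a :* p) :* q) refl a b p q)
    (cong₂ ℚ._-_ (trans (cong (ℚ._* p) bq) (ℚP.*-identityˡ p))
                 (trans (cong (ℚ._* q) ap) (ℚP.*-identityˡ q))))

  inv-diff-≤ : ∀ a b p q {η i ε} → a ℚ.* p ≡ 1ℚ → b ℚ.* q ≡ 1ℚ → η ℚ.* (i ℚ.* i) ≡ ε →
    ℚ.∣ a ℚ.- b ∣ ℚ.≤ η → ℚ.∣ p ∣ ℚ.≤ i → ℚ.∣ q ∣ ℚ.≤ i → ℚ.∣ p ℚ.- q ∣ ℚ.≤ ε
  inv-diff-≤ a b p q ap bq e a-b≤ p≤ q≤ = subst₂ ℚ._≤_
    (cong ℚ.∣_∣ (sym (inv-diff a b p q ap bq))) e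
    (∣*∣≤ (b ℚ.- a) (p ℚ.* q) (subst (ℚ._≤ _) (∣-∣-swap a b) a-b≤) (∣*∣≤ p q p≤ q≤))

  square-cancel : ∀ e d i → d ℚ.* i ≡ 1ℚ → e ℚ.* (d ℚ.* d) ℚ.* (i ℚ.* i) ≡ e
  square-cancel e d i di = trans
    (solve 3 (λ e d i → e :* (d :* d) :* (i :* i) := e :* ((d :* i) :* (d :* i))) refl e d i)
    (trans (cong (λ t → e ℚ.* (t ℚ.* t)) di) (ℚP.*-identityʳ e))

  -- Explicit rational parameters keep ℚ arithmetic from being unfolded.
  *-cauchy-aux : ∀ (s t : ℕ → ℚ) (B C δ ε : ℚ) (M₁ M₂ N₁ N₂ : ℕ) →
    B ℚ.* δ ℚ.+ C ℚ.* δ ≡ ε →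
    (∀ n → M₁ ℕ.≤ n → ℚ.∣ s n ∣ ℚ.≤ B) →
    (∀ n → M₂ ℕ.≤ n → ℚ.∣ t n ∣ ℚ.≤ C) →
    (∀ m n → N₁ ℕ.≤ m → N₁ ℕ.≤ n → ℚ.∣ s m ℚ.- s n ∣ ℚ.≤ δ) →
    (∀ m n → N₂ ℕ.≤ m → N₂ ℕ.≤ n → ℚ.∣ t m ℚ.- t n ∣ ℚ.≤ δ) →
    ∃[ N ] (∀ m n → N ℕ.≤ m → N ℕ.≤ n → ℚ.∣ s m ℚ.* t m ℚ.- s n ℚ.* t n ∣ ℚ.≤ ε)
  *-cauchy-aux s t B C δ ε M₁ M₂ N₁ N₂ e b₁ b₂ h₁ h₂ =
    (M₁ ℕ.⊔ M₂) ℕ.⊔ (N₁ ℕ.⊔ N₂) , λ m n m≥ n≥ →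
      let M≤ : ∀ {k} → (M₁ ℕ.⊔ M₂) ℕ.⊔ (N₁ ℕ.⊔ N₂) ℕ.≤ k → M₁ ℕ.⊔ M₂ ℕ.≤ k
          M≤ = ≤⊔ˡ {M₁ ℕ.⊔ M₂} {N₁ ℕ.⊔ N₂}
          N≤ : ∀ {k} → (M₁ ℕ.⊔ M₂) ℕ.⊔ (N₁ ℕ.⊔ N₂) ℕ.≤ k → N₁ ℕ.⊔ N₂ ℕ.≤ k
          N≤ = ≤⊔ʳ {M₁ ℕ.⊔ M₂} {N₁ ℕ.⊔ N₂}
      in *-diff-≤ (s m) (t m) (s n) (t n) {B} {C} {δ} {ε} e
        (b₁ m (≤⊔ˡ {M₁} {M₂} (M≤ m≥)))
        (h₂ m n (≤⊔ʳ {N₁} {N₂} (N≤ m≥)) (≤⊔ʳ {N₁} {N₂} (N≤ n≥)))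
        (b₂ n (≤⊔ʳ {M₁} {M₂} (M≤ n≥)))
        (h₁ m n (≤⊔ˡ {N₁} {N₂} (N≤ m≥)) (≤⊔ˡ {N₁} {N₂} (N≤ n≥)))

  share-inv : ∀ B C ε i → (B ℚ.+ C) ℚ.* i ≡ 1ℚ →
    B ℚ.* (ε ℚ.* i) ℚ.+ C ℚ.* (ε ℚ.* i) ≡ ε
  share-inv B C ε i e = trans (share B C ε i) (trans (cong (ε ℚ.*_) e) (ℚP.*-identityʳ ε))

open ℚ-Lemmas

fromℚ : ℚ → ℝ
fromℚ q = mkℝ (λ _ → q) λ ε ε>0 → 0 , λ _ _ _ _ →
  subst (ℚ._≤ ε) (sym (cong ℚ.∣_∣ (ℚP.+-inverseʳ q))) (ℚP.<⇒≤ ε>0)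

fromℤ : ℤ → ℝ
fromℤ i = fromℚ (i ℚ./ 1)

fromℕ′ : ℕ → ℝ
fromℕ′ n = fromℤ (+ n)

0ℝ 1ℝ : ℝ
0ℝ = fromℕ′ 0
1ℝ = fromℕ′ 1

infixl 6 _+_ _-_
infixl 7 _*_
infixr 8 _^_
infix  8 -_

_+_ : ℝ → ℝ → ℝ
mkℝ s c + mkℝ t d = mkℝ (λ n → s n ℚ.+ t n) +-cauchy
  where
  +-cauchy : IsCauchy (λ n → s n ℚ.+ t n)
  +-cauchy ε ε>0 with c (½ ℚ.* ε) (half-pos ε>0) | d (½ ℚ.* ε) (half-pos ε>0)
  ... | N₁ , h₁ | N₂ , h₂ = N₁ ℕ.⊔ N₂ , λ m n m≥ n≥ →
    subst₂ ℚ._≤_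
      (cong ℚ.∣_∣ (+-diff (s m) (t m) (s n) (t n)))
      (halves ε)
      (ℚP.≤-trans (ℚP.∣p+q∣≤∣p∣+∣q∣ (s m ℚ.- s n) (t m ℚ.- t n))
        (ℚP.+-mono-≤ (h₁ m n (≤⊔ˡ m≥) (≤⊔ˡ n≥))
                     (h₂ m n (≤⊔ʳ {N₁} m≥) (≤⊔ʳ {N₁} n≥))))

-_ : ℝ → ℝ
- mkℝ s c = mkℝ (λ n → ℚ.- s n) λ ε ε>0 → proj₁ (c ε ε>0) , λ m n m≥ n≥ →
  subst (ℚ._≤ ε)
    (trans (∣-∣-swap (s m) (s n))
      (cong ℚ.∣_∣ (neg-diff (s m) (s n))))
    (proj₂ (c ε ε>0) m n m≥ n≥)

_-_ : ℝ → ℝ → ℝ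
x - y = x + (- y)

_*_ : ℝ → ℝ → ℝ
mkℝ s c * mkℝ t d = mkℝ (λ n → s n ℚ.* t n) *-cauchy
  where
  *-cauchy : IsCauchy (λ n → s n ℚ.* t n)
  *-cauchy ε ε>0 =
    let B , B>0 , M₁ , b₁ = eventually-bounded s c
        C , C>0 , M₂ , b₂ = eventually-bounded t d
        B+C>0 = ℚP.+-mono-< B>0 C>0
        i     = inv-pos (B ℚ.+ C) B+C>0
        δ>0   = *-pos ε>0 (inv-pos>0 (B ℚ.+ C) B+C>0)
        N₁ , h₁ = c (ε ℚ.* i) δ>0
        N₂ , h₂ = d (ε ℚ.* i) δ>0
    in *-cauchy-aux s t B C (ε ℚ.* i) ε M₁ M₂ N₁ N₂
         (share-inv B C ε i (inv-posʳ (B ℚ.+ C) B+C>0)) b₁ b₂ h₁ h₂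

∣_∣ : ℝ → ℝ
∣ mkℝ s c ∣ = mkℝ (λ n → ℚ.∣ s n ∣) λ ε ε>0 → proj₁ (c ε ε>0) , λ m n m≥ n≥ →
  ℚP.≤-trans (∣∣p∣-∣q∣∣≤ (s m) (s n)) (proj₂ (c ε ε>0) m n m≥ n≥)

-- Reciprocal of a positive real. If the terms of x are ≥ δ > 0 from some index
-- on, then max (x n) δ = x n from that index on, so truncating the earlier
-- terms at δ makes every term invertible without changing the limit.
recip : (x : ℝ) → 0ℝ < x → ℝ
recip (mkℝ s c) (δ , δ>0 , N , δ≤s) = mkℝ r recip-cauchy
  where
  r>0 : ∀ n → 0ℚ ℚ.< s n ℚ.⊔ δ
  r>0 n = ℚP.<-≤-trans δ>0 (ℚP.p≤q⊔p (s n) δ)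
  r : ℕ → ℚ
  r n = inv-pos (s n ℚ.⊔ δ) (r>0 n)
  trunc : ∀ n → N ℕ.≤ n → s n ℚ.⊔ δ ≡ s n
  trunc n N≤n = ℚP.p≥q⇒p⊔q≡p (subst (ℚ._≤ s n) (ℚP.+-identityˡ δ) (δ≤s n N≤n))
  i : ℚ
  i = inv-pos δ δ>0
  i>0 : 0ℚ ℚ.< i
  i>0 = inv-pos>0 δ δ>0
  ∣r∣≤i : ∀ n → ℚ.∣ r n ∣ ℚ.≤ i
  ∣r∣≤i n = subst (ℚ._≤ i) (sym (ℚP.0≤p⇒∣p∣≡p (ℚP.<⇒≤ (inv-pos>0 _ (r>0 n)))))
    (inv-pos-antitone δ>0 (r>0 n) (ℚP.p≤q⊔p (s n) δ))
  recip-cauchy : IsCauchy r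
  recip-cauchy ε ε>0 = N ℕ.⊔ proj₁ cη , λ m n m≥ n≥ →
    inv-diff-≤ (s m ℚ.⊔ δ) (s n ℚ.⊔ δ) (r m) (r n) {η} {i} {ε}
      (inv-posʳ _ (r>0 m)) (inv-posʳ _ (r>0 n)) (square-cancel ε δ i (inv-posʳ δ δ>0))
      (subst₂ (λ a b → ℚ.∣ a ℚ.- b ∣ ℚ.≤ η)
        (sym (trunc m (≤⊔ˡ m≥))) (sym (trunc n (≤⊔ˡ n≥)))
        (proj₂ cη m n (≤⊔ʳ {N} m≥) (≤⊔ʳ {N} n≥)))
      (∣r∣≤i m) (∣r∣≤i n)
    where
    η : ℚ
    η = ε ℚ.* (δ ℚ.* δ)
    cη = c η (*-pos ε>0 (*-pos δ>0 δ>0))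

infixl 7 _/_⟨_⟩

_/_⟨_⟩ : (x y : ℝ) → 0ℝ < y → ℝ
x / y ⟨ y>0 ⟩ = x * recip y y>0

_^_ : ℝ → ℕ → ℝ
x ^ zero  = 1ℝ
x ^ suc n = x * x ^ n

zpow : (x : ℝ) → 0ℝ < x → ℤ → ℝ
zpow x x>0 (+ n)    = x ^ n
zpow x x>0 -[1+ n ] = recip x x>0 ^ suc n

1<⇒0< : ∀ {x} → 1ℝ < x → 0ℝ < x
1<⇒0< (ε , ε>0 , N , h) = ε , ε>0 , N , λ n N≤n →
  ℚP.≤-trans (ℚP.+-monoˡ-≤ ε (ℚP.<⇒≤ (ℚP.positive⁻¹ 1ℚ))) (h n N≤n)

-- y = x ^ a for a real exponent a and a base x > 1: y is the unique positive
-- real separating the x ^ (p / q) with p / q < a from those with a < p / q,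
-- where x ^ (p / q) ≤ y is expressed as x ^ p ≤ y ^ q.
record IsPower (x a y : ℝ) : Set where
  field
    base>1 : 1ℝ < x
    pos    : 0ℝ < y
    below  : ∀ r → fromℚ r < a → zpow x (1<⇒0< {x} base>1) (ℚ.↥ r) ≤ y ^ ℚ.↧ₙ r
    above  : ∀ r → a < fromℚ r → y ^ ℚ.↧ₙ r ≤ zpow x (1<⇒0< {x} base>1) (ℚ.↥ r)

data ℝ∞ : Set where
  fin : ℝ → ℝ∞
  +∞  : ℝ∞

infix 4 _≤∞_

_≤∞_ : ℝ∞ → ℝ∞ → Set
_     ≤∞ +∞    = ⊤
fin x ≤∞ fin y = x ≤ y
+∞    ≤∞ fin _ = ⊥

IsUpperBound : (ℝ → Set) → ℝ∞ → Set
IsUpperBound S u = ∀ a → S a → fin a ≤∞ u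

IsSup : (ℝ → Set) → ℝ∞ → Set
IsSup S s = IsUpperBound S s × (∀ u → IsUpperBound S u → s ≤∞ u)

-- c j is the coefficient of degree j.
eval : ∀ {d} → (Fin (suc d) → ℤ) → ℝ → ℝ
eval c ξ = Vector.foldr _+_ 0ℝ (λ j → fromℤ (c j) * ξ ^ toℕ j)

Transcendental : ℝ → Set
Transcendental ξ =
  ∀ d (c : Fin (suc d) → ℤ) → (∃[ j ] c j ≢ 0ℤ) → ¬ (eval c ξ ≃ 0ℝ)

ArbitrarilyLarge : (ℝ → Set) → Set
ArbitrarilyLarge P = ∀ Y → ∃[ X ] (Y < X × P X)

-- In the inequalities below B is the bound X ^ (- l), respectively X ^ (- w),
-- and a maximum is bounded by bounding every term.
λ-Admissible : ℕ → ℝ → ℝ → Set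
λ-Admissible n ξ l = ArbitrarilyLarge λ X →
  Σ[ B ∈ ℝ ] IsPower X (- l) B ×
  Σ[ x ∈ (Fin (suc n) → ℤ) ]
    (0 ℕ.< ℤ.∣ x zero ∣) ×
    (fromℕ′ ℤ.∣ x zero ∣ ≤ X) ×
    (∀ (m : Fin n) → ∣ fromℤ (x zero) * ξ ^ toℕ (suc m) - fromℤ (x (suc m)) ∣ ≤ B)

w-Solution : (k : ℕ) → ℝ → ℝ → ℝ → (Fin (suc k) → ℤ) → Set
w-Solution k ξ w X x = Σ[ B ∈ ℝ ] IsPower X (- w) B ×
  (0ℝ < ∣ eval x ξ ∣) ×
  (∣ eval x ξ ∣ ≤ B) ×
  (∀ j → fromℕ′ ℤ.∣ x j ∣ ≤ X)

w-Admissible : ℕ → ℝ → ℝ → Set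
w-Admissible k ξ w = ArbitrarilyLarge λ X → ∃[ x ] w-Solution k ξ w X x

wˡᵉᵃᵈ-Admissible : ℕ → ℝ → ℝ → Set
wˡᵉᵃᵈ-Admissible k ξ w = ArbitrarilyLarge λ X → ∃[ x ]
  (w-Solution k ξ w X x × (∀ j → ℤ.∣ x j ∣ ℕ.≤ ℤ.∣ x (fromℕ k) ∣))

-- λ[ n , ξ ]≡ l says that the extended real l is λₙ(ξ), the supremum of the
-- admissible values. It is a relation, not a function, because the supremum of
-- an arbitrary set of reals exists in ℝ ∪ {+∞} only by classical logic. None of
-- the three sets is empty, so no value −∞ is needed.
λ[_,_]≡_ w[_,_]≡_ wˡᵉᵃᵈ[_,_]≡_ : ℕ → ℝ → ℝ∞ → Set
λ[ n , ξ ]≡ l     = IsSup (λ-Admissible n ξ) l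
w[ k , ξ ]≡ w     = IsSup (w-Admissible k ξ) w
wˡᵉᵃᵈ[ k , ξ ]≡ w = IsSup (wˡᵉᵃᵈ-Admissible k ξ) w

Quotient≤ : ℝ → ℝ → ℝ∞ → Set
Quotient≤ a b u = Σ[ b>0 ∈ 0ℝ < b ] fin (a / b ⟨ b>0 ⟩) ≤∞ u

-- (w − n + k) / ((k − 1) w + n) ≤ l, with the limit 1 / (k − 1) at w = +∞.
LowerBound : (k n : ℕ) → (w l : ℝ∞) → Set
LowerBound k n (fin w) l =
  Quotient≤ (w - fromℕ′ n + fromℕ′ k) ((fromℕ′ k - 1ℝ) * w + fromℕ′ n) l
LowerBound k n +∞ l = Quotient≤ 1ℝ (fromℕ′ k - 1ℝ) l

{-# OPTIONS --safe #-}
module Submission where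

-- Let P be an integer polynomial of degree k and height about H with |P(ξ)| ≤ H^(−w).
-- Among k + 1 consecutive integers −e far from ξ there is one with |P(−e)| ≥ cH, so after
-- the substitution ξ ↦ 1/(ξ + e) the leading coefficient V of P dominates the others. The
-- integer sequences y₀, …, yₙ obeying the recurrence with characteristic polynomial P are determined by y₀, …, y_{k−1}, and a
-- box principle with T^(k−1) V^(n−k+1) boxes gives such a sequence with 0 < |y₀| ≤ T^(k−1) V^(n−k+1)
-- and |y₀ρᵐ − yₘ| ≤ 1/T for m < k, where ρ = 1/(ξ + e). The recurrence and the smallness of P(ξ)
-- propagate this to all m ≤ n, up to a constant, when T^k V^(n−k) |P(ξ)| ≤ 1; the choice
-- T = H^((w−n+k)/k) yields the exponent (w−n+k)/((k−1)w+n).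
--
-- Constructively, ξ is replaced by a sufficiently close rational, so that all comparisons
-- are decidable, and the inequality between the suprema is obtained by refuting its strict
-- converse, since ≤ on the reals is stable under double negation.

open import Defs using (ℝ; ℝ∞; fin; +∞; IsUpperBound; IsSup; LowerBound; _/_⟨_⟩; Transcendental; λ[_,_]≡_; wˡᵉᵃᵈ[_,_]≡_; w[_,_]≡_; seq; cauchy; fromℚ; fromℤ; fromℕ′; 0ℝ; 1ℝ; eval; IsPower; λ-Admissible; w-Admissible; wˡᵉᵃᵈ-Admissible; w-Solution; zpow; recip; 1<⇒0<; module ℚ-Lemmas)
import Defs as Re
open import Algebra.Bundles using (CommutativeRing)
import Algebra.Properties.CommutativeSemiring.Exp as Exp
open import Data.Empty using (⊥)
open import Data.Fin using (Fin; zero; suc; toℕ; fromℕ<; funToFin)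
import Data.Fin as Fin
import Data.Fin.Properties as FinP
open import Data.Integer using (ℤ; +_; -[1+_]; 0ℤ)
import Data.Integer as ℤ
import Data.Integer.DivMod as ℤD
import Data.Integer.Properties as ℤP
import Data.Integer.Solver as ℤS
open import Data.Nat using (ℕ; zero; suc) renaming (_≤_ to _≤ℕ_)
import Data.Nat as ℕ
open import Data.Nat.Coprimality using (Coprime; 1-coprimeTo) renaming (sym to coprime-sym)
import Data.Nat.Properties as ℕP
import Data.Nat.Solver as ℕS
open import Data.Product using (Σ-syntax; ∃-syntax; _×_; _,_; proj₁; proj₂)
open import Data.Rational
open import Data.Rational.Properties
open import Data.Rational.Solver using (module +-*-Solver)
import Data.Rational.Unnormalised as ℚᵘ
import Data.Rational.Unnormalised.Properties as ℚᵘP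
open import Data.Sum using (_⊎_; inj₁; inj₂)
open import Data.Unit using (tt)
import Data.Vec.Functional as Vector
open import Function using (_∘_)
open import Relation.Binary.PropositionalEquality using (_≡_; _≢_; refl; sym; trans; cong; cong₂; subst; subst₂; module ≡-Reasoning)
open import Relation.Nullary using (¬_; yes; no; contradiction)
open +-*-Solver using (solve; _:+_; _:*_; _:-_; :-_; _:=_; con)
open Exp (CommutativeRing.commutativeSemiring +-*-commutativeRing) using (_^_; ^-homo-*; ^-assocʳ; ^-distrib-*)
open ℚ-Lemmas using (*-mono-≤; *-pos; inv-pos; inv-pos>0; inv-posʳ; half-pos; halves; ≤⊔ˡ; ≤⊔ʳ; eventually-bounded)

-- Integers and powers in ℚ

-- The exponent comes from balancing sizes. With V of the order of H, the condition T^k V^(n-k)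
-- |P(ξ)| ≤ 1 fixes T, and the denominator T^(k-1) V^(n-k+1) then has size H^(((k-1)w+n)/k); the
-- ratio of the logarithms of T and of this denominator is the claimed quotient. The box principle
-- approximates powers of ρ, not of ξ. Reversing the indices repairs this: the term y at n - j is
-- close to y₀ρⁿ(ξ + e)ʲ, and differences turn powers of ξ + e into powers of ξ. The price is the
-- new denominator yₙ, which is nonzero because T exceeds a constant. Real powers are given only
-- through cuts at rational exponents, so no real root is ever taken: up to constants, H, T and X
-- become integral powers of one integer Z, all exponents become natural numbers, and each constant
-- is absorbed by a spare factor Z. The loss in the exponents is harmless, because refuting a strict
-- inequality leaves room for it.

abstract
  -- Built with denominator 1 instead of `z / 1`, which normalises by a gcd. It is abstract so that
  -- rational arithmetic on integers is never unfolded; only the homomorphism laws below are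
  -- visible.
  ι : ℤ → ℚ
  ι z = mkℚ z 0 (coprime-sym (1-coprimeTo ℤ.∣ z ∣))

  ι-/1 : ∀ z → ι z ≡ z / 1
  ι-/1 z = sym (↥p/↧p≡p (ι z))

  ι-0 : ι 0ℤ ≡ 0ℚ
  ι-0 = refl

  ι-1 : ι (+ 1) ≡ 1ℚ
  ι-1 = refl

  ι-+ : ∀ y z → ι (y ℤ.+ z) ≡ ι y + ι z
  ι-+ y z = toℚᵘ-injective (ℚᵘP.≃-trans
    (ℚᵘ.*≡* (cong₂ ℤ._*_ (sym (cong₂ ℤ._+_ (ℤP.*-identityʳ y) (ℤP.*-identityʳ z))) refl))
    (ℚᵘP.≃-sym (toℚᵘ-homo-+ (ι y) (ι z))))

  ι-* : ∀ y z → ι (y ℤ.* z) ≡ ι y * ι z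
  ι-* y z = toℚᵘ-injective (ℚᵘP.≃-sym (toℚᵘ-homo-* (ι y) (ι z)))

  ι-neg : ∀ z → ι (ℤ.- z) ≡ - ι z
  ι-neg z = toℚᵘ-injective (ℚᵘP.≃-sym (toℚᵘ-homo‿- (ι z)))

  ι-∣∣ : ∀ z → ∣ ι z ∣ ≡ ι (+ ℤ.∣ z ∣)
  ι-∣∣ z = refl

  ι-mono-≤ : ∀ {y z} → y ℤ.≤ z → ι y ≤ ι z
  ι-mono-≤ {y} {z} h = *≤* (subst₂ ℤ._≤_ (sym (ℤP.*-identityʳ y)) (sym (ℤP.*-identityʳ z)) h)

  ι-cancel-≤ : ∀ {y z} → ι y ≤ ι z → y ℤ.≤ z
  ι-cancel-≤ {y} {z} h = subst₂ ℤ._≤_ (ℤP.*-identityʳ y) (ℤP.*-identityʳ z) (drop-*≤* h)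

  *-↧ : ∀ r → r * ι (↧ r) ≡ ι (↥ r)
  *-↧ r@record{} = toℚᵘ-injective (ℚᵘP.≃-trans (toℚᵘ-homo-* r (ι (↧ r)))
    (ℚᵘ.*≡* (trans (ℤP.*-identityʳ (↥ r ℤ.* ↧ r))
      (cong (↥ r ℤ.*_) (cong +_ (sym (ℕP.*-identityʳ (↧ₙ r))))))))

ι-- : ∀ y z → ι (y ℤ.- z) ≡ ι y - ι z
ι-- y z = trans (ι-+ y (ℤ.- z)) (cong (_+_ (ι y)) (ι-neg z))

ι-cancel-< : ∀ {y z} → ι y < ι z → y ℤ.< z
ι-cancel-< h = ℤP.≰⇒> λ z≤y → <-irrefl refl (<-≤-trans h (ι-mono-≤ z≤y))

ν : ℕ → ℚ
ν n = ι (+ n)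

ν-mono : ∀ {m n} → m ℕ.≤ n → ν m ≤ ν n
ν-mono h = ι-mono-≤ (ℤ.+≤+ h)

ν-cancel : ∀ {m n} → ν m ≤ ν n → m ℕ.≤ n
ν-cancel h = ℤP.drop‿+≤+ (ι-cancel-≤ h)

ν-+ : ∀ m n → ν (m ℕ.+ n) ≡ ν m + ν n
ν-+ m n = trans (cong ι (ℤP.pos-+ m n)) (ι-+ (+ m) (+ n))

ν-* : ∀ m n → ν (m ℕ.* n) ≡ ν m * ν n
ν-* m n = trans (cong ι (ℤP.pos-* m n)) (ι-* (+ m) (+ n))

ν-^ : ∀ m n → ν (m ℕ.^ n) ≡ ν m ^ n
ν-^ m zero    = ι-1
ν-^ m (suc n) = trans (ν-* m (m ℕ.^ n)) (cong (ν m *_) (ν-^ m n))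

0≤ν : ∀ n → 0ℚ ≤ ν n
0≤ν n = subst (_≤ ν n) ι-0 (ν-mono ℕ.z≤n)

1≤ν : ∀ {n} → 1 ℕ.≤ n → 1ℚ ≤ ν n
1≤ν {n} h = subst (_≤ ν n) ι-1 (ν-mono h)

0<1 : 0ℚ < 1ℚ
0<1 = positive⁻¹ 1ℚ

0≤1 : 0ℚ ≤ 1ℚ
0≤1 = <⇒≤ 0<1

0<ν : ∀ {n} → 1 ℕ.≤ n → 0ℚ < ν n
0<ν h = <-≤-trans 0<1 (1≤ν h)

0≤⇒0≤- : ∀ {p q} → p ≤ q → 0ℚ ≤ q - p
0≤⇒0≤- {p} {q} h = subst (_≤ q - p) (+-inverseʳ p) (+-monoˡ-≤ (- p) h)

≤-by : ∀ {p q s} → p + s ≡ q → 0ℚ ≤ s → p ≤ q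
≤-by {p} {q} {s} e h = subst₂ _≤_ (+-identityʳ p) e (+-monoʳ-≤ p h)

*-nonNeg : ∀ {p q} → 0ℚ ≤ p → 0ℚ ≤ q → 0ℚ ≤ p * q
*-nonNeg {p} {q} hp hq = subst (_≤ p * q) (*-zeroʳ p) (*-monoˡ-≤-nonNeg p {{nonNegative hp}} hq)

+-nonNeg : ∀ {p q} → 0ℚ ≤ p → 0ℚ ≤ q → 0ℚ ≤ p + q
+-nonNeg {p} {q} hp hq = subst (_≤ p + q) (+-identityʳ 0ℚ) (+-mono-≤ hp hq)

*-monoˡ : ∀ r {p q} → 0ℚ ≤ r → p ≤ q → r * p ≤ r * q
*-monoˡ r h = *-monoˡ-≤-nonNeg r {{nonNegative h}}

*-monoʳ : ∀ r {p q} → 0ℚ ≤ r → p ≤ q → p * r ≤ q * r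
*-monoʳ r h = *-monoʳ-≤-nonNeg r {{nonNegative h}}

*-cancelˡ-≤ : ∀ r {p q} → 0ℚ < r → r * p ≤ r * q → p ≤ q
*-cancelˡ-≤ r h = *-cancelˡ-≤-pos r {{positive h}}

0≤^ : ∀ {x} n → 0ℚ ≤ x → 0ℚ ≤ x ^ n
0≤^ zero    h = 0≤1
0≤^ (suc n) h = *-nonNeg h (0≤^ n h)

0<^ : ∀ {x} n → 0ℚ < x → 0ℚ < x ^ n
0<^ zero    h = 0<1
0<^ (suc n) h = *-pos h (0<^ n h)

^-monoˡ-≤ : ∀ n {x y} → 0ℚ ≤ x → x ≤ y → x ^ n ≤ y ^ n
^-monoˡ-≤ zero    0≤x x≤y = ≤-refl
^-monoˡ-≤ (suc n) 0≤x x≤y =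
  *-mono-≤ 0≤x (0≤^ n (≤-trans 0≤x x≤y)) x≤y (^-monoˡ-≤ n 0≤x x≤y)

1^ : ∀ n → 1ℚ ^ n ≡ 1ℚ
1^ zero    = refl
1^ (suc n) = trans (*-identityˡ (1ℚ ^ n)) (1^ n)

1≤^ : ∀ {x} n → 1ℚ ≤ x → 1ℚ ≤ x ^ n
1≤^ {x} n h = subst (_≤ x ^ n) (1^ n) (^-monoˡ-≤ n 0≤1 h)

^≤1 : ∀ {x} n → 0ℚ ≤ x → x ≤ 1ℚ → x ^ n ≤ 1ℚ
^≤1 {x} n h h′ = subst (x ^ n ≤_) (1^ n) (^-monoˡ-≤ n h h′)

^-monoʳ-≤ : ∀ {x m n} → 1ℚ ≤ x → m ℕ.≤ n → x ^ m ≤ x ^ n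
^-monoʳ-≤ {x} {m} {n} 1≤x m≤n = subst₂ _≤_ (*-identityʳ (x ^ m))
  (trans (sym (^-homo-* x m (n ℕ.∸ m))) (cong (x ^_) (ℕP.m+[n∸m]≡n m≤n)))
  (*-monoˡ (x ^ m) (0≤^ m (≤-trans 0≤1 1≤x)) (1≤^ (n ℕ.∸ m) 1≤x))

^-monoˡ-< : ∀ n {x y} → 0ℚ ≤ x → x < y → x ^ suc n < y ^ suc n
^-monoˡ-< n {x} {y} 0≤x x<y = ≤-<-trans
  (*-monoˡ x 0≤x (^-monoˡ-≤ n 0≤x (<⇒≤ x<y)))
  (*-monoˡ-<-pos (y ^ n) {{positive (0<^ n (≤-<-trans 0≤x x<y))}} x<y)

^-cancel-≤ : ∀ n {x y} → 0ℚ ≤ y → x ^ suc n ≤ y ^ suc n → x ≤ y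
^-cancel-≤ n {x} {y} 0≤y h with x ≤? y
... | yes x≤y = x≤y
... | no  x≰y = contradiction (<-≤-trans (^-monoˡ-< n 0≤y (≰⇒> x≰y)) h) (<-irrefl refl)

∣^∣ : ∀ x n → ∣ x ^ n ∣ ≡ ∣ x ∣ ^ n
∣^∣ x zero    = refl
∣^∣ x (suc n) = trans (∣p*q∣≡∣p∣*∣q∣ x (x ^ n)) (cong (∣ x ∣ *_) (∣^∣ x n))

p≤∣p∣ : ∀ p → p ≤ ∣ p ∣
p≤∣p∣ p with ≤-total 0ℚ p
... | inj₁ 0≤p = ≤-reflexive (sym (0≤p⇒∣p∣≡p 0≤p))
... | inj₂ p≤0 = ≤-trans p≤0 (0≤∣p∣ p)

∣∣≤ : ∀ {p q} → p ≤ q → - p ≤ q → ∣ p ∣ ≤ q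
∣∣≤ {p} {q} h h′ with ∣p∣≡p∨∣p∣≡-p p
... | inj₁ e = subst (_≤ q) (sym e) h
... | inj₂ e = subst (_≤ q) (sym e) h′

∣∣-triangle : ∀ p q r → ∣ p - r ∣ ≤ ∣ p - q ∣ + ∣ q - r ∣
∣∣-triangle p q r = subst (λ s → ∣ s ∣ ≤ ∣ p - q ∣ + ∣ q - r ∣)
  (solve 3 (λ p q r → (p :- q) :+ (q :- r) := p :- r) refl p q r)
  (∣p+q∣≤∣p∣+∣q∣ (p - q) (q - r))

abstract
  floor-lower : ∀ p → ι (floor p) ≤ p
  floor-lower p@record{} = toℚᵘ-cancel-≤ (ℚᵘ.*≤*
    (subst (floor p ℤ.* ↧ p ℤ.≤_) (sym (ℤP.*-identityʳ (↥ p))) (ℤD.[n/d]*d≤n (↥ p) (↧ p))))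

  floor-upper : ∀ p → p ≤ ι (floor p) + 1ℚ
  floor-upper p@record{} = subst (p ≤_) (trans (ι-+ (floor p) (+ 1)) (cong (_+_ (ι (floor p))) ι-1))
    (toℚᵘ-cancel-≤ (ℚᵘ.*≤* (subst₂ ℤ._≤_ (sym (ℤP.*-identityʳ (↥ p)))
      (cong (ℤ._* ↧ p) (trans (ℤP.+-comm (+ 1) (↥ p ℤD./ℕ ↧ₙ p)) (cong (ℤ._+ + 1) (sym (ℤD.div-pos-is-/ℕ (↥ p) (↧ₙ p))))))
      (ℤP.<⇒≤ (ℤD.n<s[n/ℕd]*d (↥ p) (↧ₙ p))))))

-- Polynomials: synthetic division, interpolation and Taylor expansion

ι-injective : ∀ {y z} → ι y ≡ ι z → y ≡ z
ι-injective e = ℤP.≤-antisym (ι-cancel-≤ (≤-reflexive e)) (ι-cancel-≤ (≤-reflexive (sym e)))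

ev : ∀ {d} → (Fin d → ℤ) → ℚ → ℚ
ev {zero}  a x = 0ℚ
ev {suc d} a x = ι (a zero) + x * ev (a ∘ suc) x

evℤ : ∀ {d} → (Fin d → ℤ) → ℤ → ℤ
evℤ {zero}  a c = 0ℤ
evℤ {suc d} a c = a zero ℤ.+ c ℤ.* evℤ (a ∘ suc) c

ι-evℤ : ∀ {d} (a : Fin d → ℤ) c → ι (evℤ a c) ≡ ev a (ι c)
ι-evℤ {zero}  a c = ι-0
ι-evℤ {suc d} a c = trans (ι-+ (a zero) (c ℤ.* evℤ (a ∘ suc) c))
  (cong (_+_ (ι (a zero))) (trans (ι-* c (evℤ (a ∘ suc) c)) (cong (ι c *_) (ι-evℤ (a ∘ suc) c))))

-- Quotient of a(X) - a(c) by X - c; its coefficients are the partial values of Horner's scheme at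
-- c.
divide : ∀ {d} → (Fin (suc d) → ℤ) → ℤ → Fin d → ℤ
divide a c zero    = evℤ (a ∘ suc) c
divide a c (suc j) = divide (a ∘ suc) c j

ev-divide : ∀ {d} (a : Fin (suc d) → ℤ) c x →
  ev a x ≡ ι (evℤ a c) + (x - ι c) * ev (divide a c) x
ev-divide {zero} a c x = trans
  (cong (_+_ (ι (a zero))) (trans (*-zeroʳ x) (sym (*-zeroʳ (x - ι c)))))
  (cong (λ s → ι s + (x - ι c) * 0ℚ)
    (sym (trans (cong (ℤ._+_ (a zero)) (ℤP.*-zeroʳ c)) (ℤP.+-identityʳ (a zero)))))
ev-divide {suc d} a c x = begin
  ι (a zero) + x * ev a′ x
    ≡⟨ cong (λ s → ι (a zero) + x * s) (ev-divide a′ c x) ⟩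
  ι (a zero) + x * (ι v + (x - ι c) * s)
    ≡⟨ solve 5 (λ a₀ x c v s → a₀ :+ x :* (v :+ (x :- c) :* s)
          := (a₀ :+ c :* v) :+ (x :- c) :* (v :+ x :* s)) refl (ι (a zero)) x (ι c) (ι v) s ⟩
  (ι (a zero) + ι c * ι v) + (x - ι c) * (ι v + x * s)
    ≡⟨ cong (λ u → u + (x - ι c) * (ι v + x * s))
         (sym (trans (ι-+ (a zero) (c ℤ.* v)) (cong (_+_ (ι (a zero))) (ι-* c v)))) ⟩
  ι (a zero ℤ.+ c ℤ.* v) + (x - ι c) * (ι v + x * s) ∎
  where
  open ≡-Reasoning
  a′ = a ∘ suc
  v = evℤ a′ c
  s = ev (divide a′ c) x

evℤ-divide : ∀ {d} (a : Fin (suc d) → ℤ) c x →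
  evℤ a x ≡ evℤ a c ℤ.+ (x ℤ.- c) ℤ.* evℤ (divide a c) x
evℤ-divide a c x = ι-injective (begin
  ι (evℤ a x) ≡⟨ ι-evℤ a x ⟩
  ev a (ι x)  ≡⟨ ev-divide a c (ι x) ⟩
  ι (evℤ a c) + (ι x - ι c) * ev (divide a c) (ι x)
    ≡⟨ cong (_+_ (ι (evℤ a c))) (cong₂ _*_ (sym (ι-- x c)) (sym (ι-evℤ (divide a c) x))) ⟩
  ι (evℤ a c) + ι (x ℤ.- c) * ι (evℤ (divide a c) x)
    ≡⟨ cong (_+_ (ι (evℤ a c))) (sym (ι-* (x ℤ.- c) (evℤ (divide a c) x))) ⟩
  ι (evℤ a c) + ι ((x ℤ.- c) ℤ.* evℤ (divide a c) x)
    ≡⟨ sym (ι-+ (evℤ a c) ((x ℤ.- c) ℤ.* evℤ (divide a c) x)) ⟩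
  ι (evℤ a c ℤ.+ (x ℤ.- c) ℤ.* evℤ (divide a c) x) ∎)
  where open ≡-Reasoning

-- Coefficients of a(X + c), as the successive remainders of division by X - c.
taylor : ∀ {d} → (Fin d → ℤ) → ℤ → Fin d → ℤ
taylor {suc d} a c zero    = evℤ a c
taylor {suc d} a c (suc j) = taylor (divide a c) c j

ev-taylor : ∀ {d} (a : Fin d → ℤ) c x → ev a x ≡ ev (taylor a c) (x - ι c)
ev-taylor {zero}  a c x = refl
ev-taylor {suc d} a c x = trans (ev-divide a c x)
  (cong (λ s → ι (evℤ a c) + (x - ι c) * s) (ev-taylor (divide a c) c x))

∣i+j*k∣≤ : ∀ i j k {A B C} → ℤ.∣ i ∣ ℕ.≤ A → ℤ.∣ j ∣ ℕ.≤ B → ℤ.∣ k ∣ ℕ.≤ C →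
  ℤ.∣ i ℤ.+ j ℤ.* k ∣ ℕ.≤ A ℕ.+ B ℕ.* C
∣i+j*k∣≤ i j k hi hj hk = ℕP.≤-trans (ℤP.∣i+j∣≤∣i∣+∣j∣ i (j ℤ.* k))
  (ℕP.+-mono-≤ hi (ℕP.≤-trans (ℕP.≤-reflexive (ℤP.abs-* j k)) (ℕP.*-mono-≤ hj hk)))

module _ (c : ℤ) (E : ℕ) (∣c∣≤E : ℤ.∣ c ∣ ℕ.≤ E) where

  private
    G = suc E

    m≤m*G^ : ∀ m n → m ℕ.≤ m ℕ.* G ℕ.^ n
    m≤m*G^ m n = ℕP.m≤m*n m (G ℕ.^ n) {{ℕP.m^n≢0 G n}}

  -- A Horner step turns a bound B into A + E·B; with G = 1 + E this is one factor G, since A ≤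
  -- A·G^d.
  evℤ-bound : ∀ {d} (a : Fin d → ℤ) A → (∀ j → ℤ.∣ a j ∣ ℕ.≤ A) → ℤ.∣ evℤ a c ∣ ℕ.≤ A ℕ.* G ℕ.^ d
  evℤ-bound {zero}  a A h = ℕ.z≤n
  evℤ-bound {suc d} a A h = ℕP.≤-trans
    (∣i+j*k∣≤ (a zero) c (evℤ (a ∘ suc) c) (ℕP.≤-trans (h zero) (m≤m*G^ A d)) ∣c∣≤E
      (evℤ-bound (a ∘ suc) A (h ∘ suc)))
    (ℕP.≤-reflexive (ℕS.+-*-Solver.solve 3
      (λ A E g → A ⊗ g ⊕ E ⊗ (A ⊗ g) ≐ A ⊗ (g ⊕ E ⊗ g)) refl A E (G ℕ.^ d)))
    where open ℕS.+-*-Solver using () renaming (_:*_ to _⊗_; _:+_ to _⊕_; _:=_ to _≐_)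

  divide-bound : ∀ {d} (a : Fin (suc d) → ℤ) A → (∀ j → ℤ.∣ a j ∣ ℕ.≤ A) →
    ∀ j → ℤ.∣ divide a c j ∣ ℕ.≤ A ℕ.* G ℕ.^ d
  divide-bound {suc d} a A h zero    = evℤ-bound (a ∘ suc) A (h ∘ suc)
  divide-bound {suc d} a A h (suc j) = ℕP.≤-trans (divide-bound (a ∘ suc) A (h ∘ suc) j)
    (ℕP.*-monoʳ-≤ A (ℕP.^-monoʳ-≤ G (ℕP.n≤1+n d)))

  -- `D` stays fixed while d decreases, so that each of the d divisions costs the same factor G^D.
  taylor-bound : ∀ D {d} → d ℕ.≤ D → (a : Fin d → ℤ) → ∀ A → (∀ j → ℤ.∣ a j ∣ ℕ.≤ A) →
    ∀ j → ℤ.∣ taylor a c j ∣ ℕ.≤ A ℕ.* (G ℕ.^ D) ℕ.^ d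
  taylor-bound D {suc d} d≤D a A h zero = ℕP.≤-trans (evℤ-bound a A h)
    (ℕP.*-monoʳ-≤ A (ℕP.≤-trans (ℕP.^-monoʳ-≤ G d≤D)
      (ℕP.m≤m*n (G ℕ.^ D) ((G ℕ.^ D) ℕ.^ d) {{ℕP.m^n≢0 (G ℕ.^ D) d {{ℕP.m^n≢0 G D}}}})))
  taylor-bound D {suc d} d≤D a A h (suc j) = ℕP.≤-trans
    (taylor-bound D (ℕP.<⇒≤ d≤D) (divide a c) (A ℕ.* G ℕ.^ D)
      (λ i → ℕP.≤-trans (divide-bound a A h i) (ℕP.*-monoʳ-≤ A (ℕP.^-monoʳ-≤ G (ℕP.<⇒≤ d≤D)))) j)
    (ℕP.≤-reflexive (ℕP.*-assoc A (G ℕ.^ D) ((G ℕ.^ D) ℕ.^ d)))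

  i≡i+j*k-j*k : ∀ i j k → i ≡ (i ℤ.+ j ℤ.* k) ℤ.+ (ℤ.- j) ℤ.* k
  i≡i+j*k-j*k = S.solve 3 (λ i j k → i S.:= (i S.:+ j S.:* k) S.:+ (S.:- j) S.:* k) refl
    where module S = ℤS.+-*-Solver

  head-bound : ∀ i k {A B} → ℤ.∣ i ℤ.+ c ℤ.* k ∣ ℕ.≤ A → ℤ.∣ k ∣ ℕ.≤ B → ℤ.∣ i ∣ ℕ.≤ A ℕ.+ E ℕ.* B
  head-bound i k hA hB = subst (λ s → ℤ.∣ s ∣ ℕ.≤ _) (sym (i≡i+j*k-j*k i c k))
    (∣i+j*k∣≤ (i ℤ.+ c ℤ.* k) (ℤ.- c) k hA (subst (ℕ._≤ E) (sym (ℤP.∣-i∣≡∣i∣ c)) ∣c∣≤E) hB)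

  tail-bound : ∀ {d} (a : Fin (suc d) → ℤ) W → (∀ j → ℤ.∣ divide a c j ∣ ℕ.≤ W) →
    ℤ.∣ evℤ (a ∘ suc) c ∣ ℕ.≤ W
  tail-bound {zero}  a W h = ℕ.z≤n
  tail-bound {suc d} a W h = h zero

  -- Multiplying the quotient back by X - c: a coefficient of a is one coefficient of the quotient
  -- minus c times the next, whence the factor 1 + E.
  divide-coefficient-bound : ∀ {d} (a : Fin (suc d) → ℤ) W → (∀ j → ℤ.∣ divide a c j ∣ ℕ.≤ W) →
    ∀ j → ℤ.∣ a (suc j) ∣ ℕ.≤ G ℕ.* W
  divide-coefficient-bound {suc d} a W h zero =
    head-bound (a (suc zero)) (evℤ (λ i → a (suc (suc i))) c) (h zero) (tail-bound (a ∘ suc) W (h ∘ suc))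
  divide-coefficient-bound {suc d} a W h (suc j) = divide-coefficient-bound (a ∘ suc) W (h ∘ suc) j

-- The 1 pays for the value at -e, the 2 for the differences of two values that bound the quotient,
-- and 1 + e for multiplying the quotient back by X + e.
interpolation-constant : ℕ → ℕ → ℕ
interpolation-constant zero    e = 1
interpolation-constant (suc d) e = 1 ℕ.+ suc e ℕ.* (interpolation-constant d (suc e) ℕ.* 2)

-- Newton interpolation: dividing by X + e leaves a quotient of lower degree whose value at -(e + 1
-- + i) is a difference of two values of a divided by a nonzero integer, hence at most 2V.
interpolation : ∀ d e (a : Fin (suc d) → ℤ) V →
  (∀ i → i ℕ.≤ d → ℤ.∣ evℤ a (ℤ.- (+ (e ℕ.+ i))) ∣ ℕ.≤ V) →
  ∀ j → ℤ.∣ a j ∣ ℕ.≤ interpolation-constant d e ℕ.* V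
interpolation zero e a V h zero = subst (ℕ._≤ 1 ℕ.* V) (cong ℤ.∣_∣ e₀)
  (ℕP.≤-trans (h 0 ℕ.z≤n) (ℕP.≤-reflexive (sym (ℕP.*-identityˡ V))))
  where
  e₀ : evℤ a (ℤ.- (+ (e ℕ.+ 0))) ≡ a zero
  e₀ = trans (cong (ℤ._+_ (a zero)) (ℤP.*-zeroʳ (ℤ.- (+ (e ℕ.+ 0))))) (ℤP.+-identityʳ (a zero))
interpolation (suc d) e a V h = bound
  where
  c = ℤ.- (+ e)
  ∣c∣≤e : ℤ.∣ c ∣ ℕ.≤ e
  ∣c∣≤e = ℕP.≤-reflexive (ℤP.∣-i∣≡∣i∣ (+ e))
  C′ = interpolation-constant d (suc e)
  atc : ℤ.∣ evℤ a c ∣ ℕ.≤ V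
  atc = subst (λ s → ℤ.∣ evℤ a (ℤ.- (+ s)) ∣ ℕ.≤ V) (ℕP.+-identityʳ e) (h 0 ℕ.z≤n)
  quotient-values : ∀ i → i ℕ.≤ d → ℤ.∣ evℤ (divide a c) (ℤ.- (+ (suc e ℕ.+ i))) ∣ ℕ.≤ V ℕ.+ V
  quotient-values i i≤d = begin
    ℤ.∣ s ∣                               ≤⟨ ℕP.m≤n*m ℤ.∣ s ∣ (suc i) ⟩
    suc i ℕ.* ℤ.∣ s ∣                     ≡⟨ cong (ℕ._* ℤ.∣ s ∣) (sym x-c) ⟩
    ℤ.∣ x ℤ.- c ∣ ℕ.* ℤ.∣ s ∣             ≡⟨ sym (ℤP.abs-* (x ℤ.- c) s) ⟩
    ℤ.∣ (x ℤ.- c) ℤ.* s ∣                 ≡⟨ cong ℤ.∣_∣ (trans (S.solve 2 (λ v y → y S.:= v S.:+ y S.:- v) refl (evℤ a c) _)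
                                               (cong (ℤ._- evℤ a c) (sym (evℤ-divide a c x)))) ⟩
    ℤ.∣ evℤ a x ℤ.- evℤ a c ∣             ≤⟨ ℤP.∣i-j∣≤∣i∣+∣j∣ (evℤ a x) (evℤ a c) ⟩
    ℤ.∣ evℤ a x ∣ ℕ.+ ℤ.∣ evℤ a c ∣       ≤⟨ ℕP.+-mono-≤ (subst (λ m → ℤ.∣ evℤ a (ℤ.- (+ m)) ∣ ℕ.≤ V)
                                               (ℕP.+-suc e i) (h (suc i) (ℕ.s≤s i≤d))) atc ⟩
    V ℕ.+ V ∎
    where
    open ℕP.≤-Reasoning
    module S = ℤS.+-*-Solver
    x = ℤ.- (+ (suc e ℕ.+ i))
    s = evℤ (divide a c) x
    x-c : ℤ.∣ x ℤ.- c ∣ ≡ suc i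
    x-c = trans (cong ℤ.∣_∣ (trans (cong (λ m → ℤ.- m ℤ.- c) (trans (cong +_ (sym (ℕP.+-suc e i))) (ℤP.pos-+ e (suc i))))
      (S.solve 2 (λ e i → S.:- (e S.:+ i) S.:- (S.:- e) S.:= S.:- i) refl (+ e) (+ suc i)))) (ℤP.∣-i∣≡∣i∣ (+ suc i))
  coefficients : ∀ j → ℤ.∣ divide a c j ∣ ℕ.≤ C′ ℕ.* 2 ℕ.* V
  coefficients j = ℕP.≤-trans (interpolation d (suc e) (divide a c) (V ℕ.+ V) quotient-values j)
    (ℕP.≤-reflexive (trans (cong (λ m → C′ ℕ.* (V ℕ.+ m)) (sym (ℕP.+-identityʳ V))) (sym (ℕP.*-assoc C′ 2 V))))
  combine : ∀ W → (V ℕ.+ e ℕ.* (W ℕ.* V) ℕ.≤ (1 ℕ.+ suc e ℕ.* W) ℕ.* V) × (suc e ℕ.* (W ℕ.* V) ℕ.≤ (1 ℕ.+ suc e ℕ.* W) ℕ.* V)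
  combine W = ℕP.+-monoʳ-≤ V (ℕP.≤-trans (ℕP.m≤n+m (e ℕ.* (W ℕ.* V)) (W ℕ.* V)) (ℕP.≤-reflexive (sym (ℕP.*-assoc (suc e) W V))))
    , ℕP.≤-trans (ℕP.≤-reflexive (sym (ℕP.*-assoc (suc e) W V))) (ℕP.m≤n+m (suc e ℕ.* W ℕ.* V) V)
  bound : ∀ j → ℤ.∣ a j ∣ ℕ.≤ interpolation-constant (suc d) e ℕ.* V
  bound zero    = ℕP.≤-trans (head-bound c e ∣c∣≤e (a zero) (evℤ (a ∘ suc) c) atc (coefficients zero)) (proj₁ (combine (C′ ℕ.* 2)))
  bound (suc j) = ℕP.≤-trans (divide-coefficient-bound c e ∣c∣≤e a (C′ ℕ.* 2 ℕ.* V) coefficients j) (proj₂ (combine (C′ ℕ.* 2)))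

argmax : ∀ m (f : ℕ → ℕ) → ∃[ i ] (i ℕ.≤ m) × (∀ j → j ℕ.≤ m → f j ℕ.≤ f i)
argmax zero f = 0 , ℕ.z≤n , λ { zero ℕ.z≤n → ℕP.≤-refl }
argmax (suc m) f with argmax m f
... | i , i≤m , h with ℕP.≤-total (f i) (f (suc m))
... | inj₁ fi≤ = suc m , ℕP.≤-refl , λ j j≤ → last j j≤
  where
  last : ∀ j → j ℕ.≤ suc m → f j ℕ.≤ f (suc m)
  last j j≤ with ℕP.m≤n⇒m<n∨m≡n j≤
  ... | inj₁ j<  = ℕP.≤-trans (h j (ℕP.≤-pred j<)) fi≤
  ... | inj₂ refl = ℕP.≤-refl
... | inj₂ ≤fi = i , ℕP.m≤n⇒m≤1+n i≤m , λ j j≤ → last j j≤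
  where
  last : ∀ j → j ℕ.≤ suc m → f j ℕ.≤ f i
  last j j≤ with ℕP.m≤n⇒m<n∨m≡n j≤
  ... | inj₁ j<  = h j (ℕP.≤-pred j<)
  ... | inj₂ refl = ≤fi

-- `b` holds the coefficients of a(X - e), so b₀ = a(-e). This constant coefficient becomes the
-- leading one for the reciprocal 1/(ξ + e), and `b≤` says that it dominates; `a≤` will give b₀ ≠ 0,
-- and `b₀≤` compares it with the height.
record Shift {k} (e₀ C : ℕ) (a : Fin (suc k) → ℤ) : Set where
  field
    e     : ℕ
    e₀≤e  : e₀ ℕ.≤ e
    e≤    : e ℕ.≤ e₀ ℕ.+ k
    b     : Fin (suc k) → ℤ
    ev-b  : ∀ x → ev a x ≡ ev b (x + ν e)
    b≤    : ∀ j → ℤ.∣ b j ∣ ℕ.≤ C ℕ.* ℤ.∣ b zero ∣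
    a≤    : ∀ j → ℤ.∣ a j ∣ ℕ.≤ C ℕ.* ℤ.∣ b zero ∣
    b₀≤   : ∀ A → (∀ j → ℤ.∣ a j ∣ ℕ.≤ A) → ℤ.∣ b zero ∣ ℕ.≤ C ℕ.* A

-- The product bounds Taylor coefficients by the largest value, through interpolation; the second
-- summand bounds that value by the height.
shift-constant : ℕ → ℕ → ℕ
shift-constant k e₀ = interpolation-constant k e₀ ℕ.* (suc (e₀ ℕ.+ k) ℕ.^ suc k) ℕ.^ suc k ℕ.+ suc (e₀ ℕ.+ k) ℕ.^ suc k

-- The point where |a| is largest is chosen, so that |b₀| bounds all k + 1 values and
-- `interpolation` applies with V = |b₀|.
shift : ∀ k e₀ (a : Fin (suc k) → ℤ) → Shift e₀ (shift-constant k e₀) a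
shift k e₀ a with argmax k (λ i → ℤ.∣ evℤ a (ℤ.- (+ (e₀ ℕ.+ i))) ∣)
... | i , i≤k , h = record
  { e     = e₀ ℕ.+ i
  ; e₀≤e  = ℕP.m≤m+n e₀ i
  ; e≤    = ℕP.+-monoʳ-≤ e₀ i≤k
  ; b     = taylor a c
  ; ev-b  = λ x → trans (ev-taylor a c x) (cong (λ s → ev (taylor a c) s) (x-c x))
  ; b≤    = λ j → ℕP.≤-trans (taylor-bound c E ∣c∣≤E (suc k) ℕP.≤-refl a (I ℕ.* V) a≤IV j)
              (ℕP.≤-trans (ℕP.≤-reflexive swap) (ℕP.*-monoˡ-≤ V (ℕP.m≤m+n (I ℕ.* W) (suc E ℕ.^ suc k))))
  ; a≤    = λ j → ℕP.≤-trans (a≤IV j) (ℕP.*-monoˡ-≤ V (ℕP.≤-trans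
              (ℕP.m≤m*n I W {{ℕP.m^n≢0 (suc E ℕ.^ suc k) (suc k) {{ℕP.m^n≢0 (suc E) (suc k)}}}}) (ℕP.m≤m+n (I ℕ.* W) (suc E ℕ.^ suc k))))
  ; b₀≤   = λ A a≤A → ℕP.≤-trans (evℤ-bound c E ∣c∣≤E a A a≤A)
              (ℕP.≤-trans (ℕP.≤-reflexive (ℕP.*-comm A (suc E ℕ.^ suc k))) (ℕP.*-monoˡ-≤ A (ℕP.m≤n+m (suc E ℕ.^ suc k) (I ℕ.* W))))
  }
  where
  c = ℤ.- (+ (e₀ ℕ.+ i))
  E = e₀ ℕ.+ k
  ∣c∣≤E : ℤ.∣ c ∣ ℕ.≤ E
  ∣c∣≤E = ℕP.≤-trans (ℕP.≤-reflexive (ℤP.∣-i∣≡∣i∣ (+ (e₀ ℕ.+ i)))) (ℕP.+-monoʳ-≤ e₀ i≤k)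
  V = ℤ.∣ evℤ a c ∣
  I = interpolation-constant k e₀
  W = (suc E ℕ.^ suc k) ℕ.^ suc k
  a≤IV : ∀ j → ℤ.∣ a j ∣ ℕ.≤ I ℕ.* V
  a≤IV = interpolation k e₀ a V h
  swap : I ℕ.* V ℕ.* W ≡ I ℕ.* W ℕ.* V
  swap = trans (ℕP.*-assoc I V W) (trans (cong (I ℕ.*_) (ℕP.*-comm V W)) (sym (ℕP.*-assoc I W V)))
  x-c : ∀ x → x - ι c ≡ x + ν (e₀ ℕ.+ i)
  x-c x = trans (cong (λ s → x - s) (ι-neg (+ (e₀ ℕ.+ i)))) (solve 2 (λ x e → x :- (:- e) := x :+ e) refl x (ν (e₀ ℕ.+ i)))

-- The box principle

-- rev b f i = b₀ f(k+i) + b₁ f(k−1+i) + … + b_k f(i), for k + 1 coefficients.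
rev : ∀ {d} → (Fin d → ℤ) → (ℕ → ℚ) → ℕ → ℚ
rev {zero}  b f i = 0ℚ
rev {suc d} b f i = ι (b zero) * f (d ℕ.+ i) + rev (b ∘ suc) f i

revℤ : ∀ {d} → (Fin d → ℤ) → (ℕ → ℤ) → ℕ → ℤ
revℤ {zero}  b f i = 0ℤ
revℤ {suc d} b f i = b zero ℤ.* f (d ℕ.+ i) ℤ.+ revℤ (b ∘ suc) f i

ι-revℤ : ∀ {d} (b : Fin d → ℤ) f i → ι (revℤ b f i) ≡ rev b (ι ∘ f) i
ι-revℤ {zero}  b f i = ι-0
ι-revℤ {suc d} b f i = trans (ι-+ (b zero ℤ.* f (d ℕ.+ i)) (revℤ (b ∘ suc) f i))
  (cong₂ _+_ (ι-* (b zero) (f (d ℕ.+ i))) (ι-revℤ (b ∘ suc) f i))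

revℤ-cong : ∀ {d} (b : Fin d → ℤ) {f g} i → (∀ m → m ℕ.< d ℕ.+ i → f m ≡ g m) →
  revℤ b f i ≡ revℤ b g i
revℤ-cong {zero}  b i h = refl
revℤ-cong {suc d} b i h = cong₂ (λ s t → b zero ℤ.* s ℤ.+ t) (h (d ℕ.+ i) ℕP.≤-refl)
  (revℤ-cong (b ∘ suc) i λ m m< → h m (ℕP.m≤n⇒m≤1+n m<))

revℤ-minus : ∀ {d} (b : Fin d → ℤ) f g i →
  revℤ b (λ m → f m ℤ.- g m) i ≡ revℤ b f i ℤ.- revℤ b g i
revℤ-minus {zero}  b f g i = refl
revℤ-minus {suc d} b f g i = trans (cong (ℤ._+_ (b zero ℤ.* (f (d ℕ.+ i) ℤ.- g (d ℕ.+ i)))) (revℤ-minus (b ∘ suc) f g i))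
  (S.solve 5 (λ b f g r s → b S.:* (f S.:- g) S.:+ (r S.:- s) S.:= (b S.:* f S.:+ r) S.:- (b S.:* g S.:+ s)) refl
    (b zero) (f (d ℕ.+ i)) (g (d ℕ.+ i)) (revℤ (b ∘ suc) f i) (revℤ (b ∘ suc) g i))
  where module S = ℤS.+-*-Solver

rev-error : ∀ {d} (b : Fin d → ℤ) (f g : ℕ → ℚ) s t i →
  rev b (λ m → t * (s * f m - g m)) i ≡ t * (s * rev b f i - rev b g i)
rev-error {zero}  b f g s t i = solve 2 (λ s t → con 0ℚ := t :* (s :* con 0ℚ :- con 0ℚ)) refl s t
rev-error {suc d} b f g s t i = trans (cong (_+_ (ι (b zero) * (t * (s * f (d ℕ.+ i) - g (d ℕ.+ i))))) (rev-error (b ∘ suc) f g s t i))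
  (solve 7 (λ b s t f g u v → b :* (t :* (s :* f :- g)) :+ t :* (s :* u :- v)
      := t :* (s :* (b :* f :+ u) :- (b :* g :+ v))) refl
    (ι (b zero)) s t (f (d ℕ.+ i)) (g (d ℕ.+ i)) (rev (b ∘ suc) f i) (rev (b ∘ suc) g i))

-- Applied to the powers of ρ, the recurrence gives the reversed polynomial, that is, a power of ρ
-- times b(1/ρ). The factor ρ on the left avoids the exponent d - 1.
rev-powers : ∀ {d} (b : Fin d → ℤ) {ρ θ} → ρ * θ ≡ 1ℚ → ∀ i →
  ρ * rev b (ρ ^_) i ≡ ρ ^ (d ℕ.+ i) * ev b θ
rev-powers {zero}  b {ρ} {θ} e i = trans (*-zeroʳ ρ) (sym (*-zeroʳ (ρ ^ i)))
rev-powers {suc d} b {ρ} {θ} e i = begin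
  ρ * (ι (b zero) * p + r)          ≡⟨ solve 4 (λ ρ b p r → ρ :* (b :* p :+ r) := b :* (ρ :* p) :+ ρ :* r) refl ρ (ι (b zero)) p r ⟩
  ι (b zero) * (ρ * p) + ρ * r      ≡⟨ cong (_+_ (ι (b zero) * (ρ * p))) (rev-powers (b ∘ suc) {ρ} {θ} e i) ⟩
  ι (b zero) * (ρ * p) + p * v      ≡⟨ cong (_+_ (ι (b zero) * (ρ * p))) (trans (sym (*-identityˡ (p * v))) (cong (_* (p * v)) (sym e))) ⟩
  ι (b zero) * (ρ * p) + (ρ * θ) * (p * v) ≡⟨ solve 5 (λ ρ θ b p v → b :* (ρ :* p) :+ (ρ :* θ) :* (p :* v) := (ρ :* p) :* (b :+ θ :* v)) refl ρ θ (ι (b zero)) p v ⟩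
  (ρ * p) * (ι (b zero) + θ * v) ∎
  where
  open ≡-Reasoning
  p = ρ ^ (d ℕ.+ i)
  r = rev (b ∘ suc) (ρ ^_) i
  v = ev (b ∘ suc) θ

rev-bound : ∀ {d} (b : Fin d → ℤ) f i {A M} → 0ℚ ≤ A → (∀ j → ∣ ι (b j) ∣ ≤ A) →
  (∀ m → m ℕ.< d ℕ.+ i → ∣ f m ∣ ≤ M) → ∣ rev b f i ∣ ≤ ν d * (A * M)
rev-bound {zero}  b f i {A} {M} 0≤A hb hf = ≤-reflexive (sym (trans (cong (_* (A * M)) ι-0) (*-zeroˡ (A * M))))
rev-bound {suc d} b f i {A} {M} 0≤A hb hf = ≤-trans
  (∣p+q∣≤∣p∣+∣q∣ (ι (b zero) * f (d ℕ.+ i)) (rev (b ∘ suc) f i))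
  (≤-trans (+-mono-≤
      (subst (_≤ A * M) (sym (∣p*q∣≡∣p∣*∣q∣ (ι (b zero)) (f (d ℕ.+ i))))
        (*-mono-≤ (0≤∣p∣ (ι (b zero))) 0≤M (hb zero) hf₀))
      (rev-bound (b ∘ suc) f i 0≤A (hb ∘ suc) λ m m< → hf m (ℕP.m≤n⇒m≤1+n m<)))
    (≤-reflexive (trans (solve 2 (λ d s → s :+ d :* s := (con 1ℚ :+ d) :* s) refl (ν d) (A * M))
      (cong (_* (A * M)) (sym (trans (ν-+ 1 d) (cong (_+ ν d) ι-1)))))))
  where
  hf₀ = hf (d ℕ.+ i) ℕP.≤-refl
  0≤M = ≤-trans (0≤∣p∣ (f (d ℕ.+ i))) hf₀

update : (ℕ → ℤ) → ℕ → ℤ → ℕ → ℤ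
update f p q m with m ℕ.≟ p
... | yes _ = q
... | no  _ = f m

update-≡ : ∀ f p q → update f p q p ≡ q
update-≡ f p q with p ℕ.≟ p
... | yes _ = refl
... | no ≢p = contradiction refl ≢p

update-< : ∀ f p q {m} → m ℕ.< p → update f p q m ≡ f m
update-< f p q {m} m<p with m ℕ.≟ p
... | yes refl = contradiction m<p (ℕP.<-irrefl refl)
... | no _ = refl

-- Solving the recurrence for its newest term requires division by b₀, which leaves a remainder
-- below |b₀|. The remainders are kept as `digits`: sequences with equal digits have a difference
-- that obeys the recurrence exactly. The D divisions thus cost |b₀|^D boxes.
record Extension {I : Set} {k} (b : Fin (suc k) → ℤ) (u : I → ℕ → ℤ) (D : ℕ) : Set where
  field
    extended : I → ℕ → ℤ
    digits   : I → Fin D → Fin ℤ.∣ b zero ∣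
    agrees   : ∀ t m → m ℕ.< k → extended t m ≡ u t m
    relation : ∀ s t → (∀ i → digits s i ≡ digits t i) →
      ∀ i → i ℕ.< D → revℤ b (extended s) i ≡ revℤ b (extended t) i

extend : ∀ {I : Set} {k} (b : Fin (suc k) → ℤ) .{{_ : ℤ.NonZero (b zero)}} (u : I → ℕ → ℤ) D →
  Extension b u D
extend b u zero = record
  { extended = u ; digits = λ _ () ; agrees = λ _ _ _ → refl ; relation = λ _ _ _ _ () }
extend {I} {k} b u (suc D) = record
  { extended = w ; digits = digits′ ; agrees = agrees′ ; relation = relation′ }
  where
  open Extension (extend b u D)
  v : I → ℤ
  v t = revℤ (b ∘ suc) (extended t) D
  w : I → ℕ → ℤ
  -- If v is the contribution of the older terms and q its quotient by b₀, the new term -q makes the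
  -- recurrence take the value v - q·b₀, which is the remainder.
  w t = update (extended t) (k ℕ.+ D) (ℤ.- (v t ℤD./ b zero))
  digits′ : I → Fin (suc D) → Fin ℤ.∣ b zero ∣
  digits′ t zero    = fromℕ< (ℤD.n%d<d (v t) (b zero))
  digits′ t (suc i) = digits t i
  agrees′ : ∀ t m → m ℕ.< k → w t m ≡ u t m
  agrees′ t m m<k = trans (update-< (extended t) (k ℕ.+ D) _ (ℕP.<-≤-trans m<k (ℕP.m≤m+n k D))) (agrees t m m<k)
  remainder : ∀ t → revℤ b (w t) D ≡ + toℕ (digits′ t zero)
  remainder t = begin
    b zero ℤ.* w t (k ℕ.+ D) ℤ.+ revℤ (b ∘ suc) (w t) D
      ≡⟨ cong₂ (λ x y → b zero ℤ.* x ℤ.+ y) (update-≡ (extended t) (k ℕ.+ D) _)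
           (trans (revℤ-cong (b ∘ suc) D λ m m< → update-< (extended t) (k ℕ.+ D) _ m<)
             (ℤD.a≡a%n+[a/n]*n (v t) (b zero))) ⟩
    b zero ℤ.* (ℤ.- q) ℤ.+ (r ℤ.+ q ℤ.* b zero)
      ≡⟨ S.solve 3 (λ b q r → b S.:* (S.:- q) S.:+ (r S.:+ q S.:* b) S.:= r) refl (b zero) q r ⟩
    r ≡⟨ cong +_ (sym (FinP.toℕ-fromℕ< (ℤD.n%d<d (v t) (b zero)))) ⟩
    + toℕ (digits′ t zero) ∎
    where
    open ≡-Reasoning
    module S = ℤS.+-*-Solver
    q = v t ℤD./ b zero
    r = + (v t ℤD.% b zero)
  old : ∀ t i → i ℕ.< D → revℤ b (w t) i ≡ revℤ b (extended t) i
  old t i i<D = revℤ-cong b i λ m m< → update-< (extended t) (k ℕ.+ D) _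
    (ℕP.<-≤-trans m< (subst (ℕ._≤ k ℕ.+ D) (ℕP.+-suc k i) (ℕP.+-monoʳ-≤ k i<D)))
  relation′ : ∀ s t → (∀ i → digits′ s i ≡ digits′ t i) →
      ∀ i → i ℕ.< suc D → revℤ b (w s) i ≡ revℤ b (w t) i
  relation′ s t h i i<sD with ℕP.m≤n⇒m<n∨m≡n (ℕP.≤-pred i<sD)
  ... | inj₁ i<D  = trans (old s i i<D) (trans (relation s t (h ∘ suc) i i<D) (sym (old t i i<D)))
  ... | inj₂ refl = trans (remainder s) (trans (cong (+_ ∘ toℕ) (h zero)) (sym (remainder t)))

funToFin-injective : ∀ {m n} (f g : Fin m → Fin n) → funToFin f ≡ funToFin g → ∀ i → f i ≡ g i
funToFin-injective f g e zero    = FinP.combine-injectiveˡ (f zero) _ (g zero) _ e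
funToFin-injective f g e (suc i) = funToFin-injective (f ∘ suc) (g ∘ suc)
  (FinP.combine-injectiveʳ (f zero) _ (g zero) _ e) i

record Point {k} (b : Fin (suc k) → ℤ) (D T : ℕ) (Q : ℕ) (ρ : ℚ) : Set where
  field
    y        : ℕ → ℤ
    y₀≢0     : y 0 ≢ 0ℤ
    y₀≤      : ℤ.∣ y 0 ∣ ℕ.≤ Q
    close    : ∀ m → m ℕ.< k → ∣ ν T * (ι (y 0) * ρ ^ m - ι (y m)) ∣ ≤ 1ℚ
    relation : ∀ i → i ℕ.< D → revℤ b y i ≡ 0ℤ

∣-∣≤1 : ∀ {p q} → 0ℚ ≤ p → p ≤ 1ℚ → 0ℚ ≤ q → q ≤ 1ℚ → ∣ p - q ∣ ≤ 1ℚ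
∣-∣≤1 {p} {q} 0≤p p≤1 0≤q q≤1 = ∣∣≤
  (≤-trans (+-monoʳ-≤ p (neg-antimono-≤ 0≤q)) (≤-trans (≤-reflexive (+-identityʳ p)) p≤1))
  (subst (_≤ 1ℚ) (solve 2 (λ p q → q :- p := :- (p :- q)) refl p q)
    (≤-trans (+-monoʳ-≤ q (neg-antimono-≤ 0≤p)) (≤-trans (≤-reflexive (+-identityʳ q)) q≤1)))

-- Dirichlet's box principle applied to y₀ = 0, …, Q: the boxes record the
-- fractional parts of y₀ρᵐ (m < k) to precision 1/T and the remainders
-- met when the recurrence is solved for the later terms.
dirichlet : ∀ {k′} (b : Fin (suc (suc k′)) → ℤ) .{{_ : ℤ.NonZero (b zero)}} D T .{{_ : ℕ.NonZero T}} ρ →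
  Point b D T (T ℕ.^ k′ ℕ.* ℤ.∣ b zero ∣ ℕ.^ D) ρ
dirichlet {k′} b D T ρ = result (FinP.pigeonhole (ℕP.n<1+n Q) signature)
  where
  Q = T ℕ.^ k′ ℕ.* ℤ.∣ b zero ∣ ℕ.^ D
  I = Fin (suc Q)
  A : I → ℕ → ℚ
  A t m = ν T * (ν (toℕ t) * ρ ^ m)
  F : I → ℕ → ℤ
  F t m = floor (A t m)
  u : I → ℕ → ℤ
  u t zero    = + toℕ t
  -- `F` is the integer part of T·t·ρᵐ: its quotient by T is the integer part of t·ρᵐ, and its
  -- remainder numbers the box of the fractional part.
  u t (suc m) = F t (suc m) ℤD./ℕ T
  boxes : I → Fin k′ → Fin T
  boxes t j = fromℕ< (ℤD.n%ℕd<d (F t (suc (toℕ j))) T)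
  open Extension (extend b u D) renaming (relation to relation′)
  signature : I → Fin Q
  signature t = Fin.combine (funToFin (boxes t)) (funToFin (digits t))
  frac : I → ℕ → ℚ
  frac t m = A t m - ι (F t m)
  0≤frac : ∀ t m → 0ℚ ≤ frac t m
  0≤frac t m = 0≤⇒0≤- (floor-lower (A t m))
  frac≤1 : ∀ t m → frac t m ≤ 1ℚ
  frac≤1 t m = subst (frac t m ≤_) (solve 1 (λ f → f :+ con 1ℚ :- f := con 1ℚ) refl (ι (F t m)))
    (+-monoˡ-≤ (- ι (F t m)) (floor-upper (A t m)))
  result : ∃[ s ] ∃[ t ] s Fin.< t × signature s ≡ signature t → Point b D T Q ρ
  result (s , t , s<t , e) = record { y = y ; y₀≢0 = y₀≢0 ; y₀≤ = y₀≤ ; close = close ; relation = relation″ }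
    where
    boxes≡ : ∀ j → boxes t j ≡ boxes s j
    boxes≡ = funToFin-injective (boxes t) (boxes s) (sym (FinP.combine-injectiveˡ (funToFin (boxes s)) (funToFin (digits s)) (funToFin (boxes t)) (funToFin (digits t)) e))
    digits≡ : ∀ j → digits t j ≡ digits s j
    digits≡ = funToFin-injective (digits t) (digits s) (sym (FinP.combine-injectiveʳ (funToFin (boxes s)) (funToFin (digits s)) (funToFin (boxes t)) (funToFin (digits t)) e))
    y : ℕ → ℤ
    y m = extended t m ℤ.- extended s m
    y≡ : ∀ m → m ℕ.< suc k′ → y m ≡ u t m ℤ.- u s m
    y≡ m m<k = cong₂ ℤ._-_ (agrees t m m<k) (agrees s m m<k)
    y₀≡ : y 0 ≡ + (toℕ t ℕ.∸ toℕ s)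
    y₀≡ = trans (y≡ 0 (ℕ.s≤s ℕ.z≤n)) (trans (ℤP.m-n≡m⊖n (toℕ t) (toℕ s)) (ℤP.⊖-≥ (ℕP.<⇒≤ s<t)))
    y₀≢0 : y 0 ≢ 0ℤ
    y₀≢0 y₀≡0 = ℕP.<⇒≱ s<t (ℕP.m∸n≡0⇒m≤n (ℤP.+-injective (trans (sym y₀≡) y₀≡0)))
    y₀≤ : ℤ.∣ y 0 ∣ ℕ.≤ Q
    y₀≤ = subst (λ z → ℤ.∣ z ∣ ℕ.≤ Q) (sym y₀≡) (ℕP.≤-trans (ℕP.m∸n≤m (toℕ t) (toℕ s)) (ℕP.≤-pred (FinP.toℕ<n t)))
    ιy₀ : ι (y 0) ≡ ν (toℕ t) - ν (toℕ s)
    ιy₀ = trans (cong ι (y≡ 0 (ℕ.s≤s ℕ.z≤n))) (ι-- (+ toℕ t) (+ toℕ s))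
    -- Equal boxes mean equal remainders modulo T, so T times the difference of the quotients is the
    -- difference of the dividends.
    T*y : ∀ m → suc m ℕ.< suc k′ → ν T * ι (y (suc m)) ≡ ι (F t (suc m)) - ι (F s (suc m))
    T*y m m<k = begin
      ν T * ι (y (suc m))                       ≡⟨ sym (ι-* (+ T) (y (suc m))) ⟩
      ι (+ T ℤ.* y (suc m))                     ≡⟨ cong (λ z → ι (+ T ℤ.* z)) (y≡ (suc m) m<k) ⟩
      ι (+ T ℤ.* (q t ℤ.- q s))                 ≡⟨ cong ι (S.solve 4 (λ T q q′ r → T S.:* (q S.:- q′) S.:= (r S.:+ q S.:* T) S.:- (r S.:+ q′ S.:* T)) refl (+ T) (q t) (q s) (r t)) ⟩
      ι ((r t ℤ.+ q t ℤ.* + T) ℤ.- (r t ℤ.+ q s ℤ.* + T)) ≡⟨ cong (λ z → ι ((r t ℤ.+ q t ℤ.* + T) ℤ.- (z ℤ.+ q s ℤ.* + T))) r≡ ⟩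
      ι ((r t ℤ.+ q t ℤ.* + T) ℤ.- (r s ℤ.+ q s ℤ.* + T)) ≡⟨ cong₂ (λ z z′ → ι (z ℤ.- z′)) (sym (ℤD.a≡a%ℕn+[a/ℕn]*n (F t (suc m)) T)) (sym (ℤD.a≡a%ℕn+[a/ℕn]*n (F s (suc m)) T)) ⟩
      ι (F t (suc m) ℤ.- F s (suc m))           ≡⟨ ι-- (F t (suc m)) (F s (suc m)) ⟩
      ι (F t (suc m)) - ι (F s (suc m)) ∎
      where
      open ≡-Reasoning
      module S = ℤS.+-*-Solver
      q : I → ℤ
      q i = F i (suc m) ℤD./ℕ T
      r : I → ℤ
      r i = + (F i (suc m) ℤD.%ℕ T)
      j = fromℕ< (ℕP.≤-pred m<k)
      r≡box : ∀ i → + toℕ (boxes i j) ≡ r i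
      r≡box i = trans (cong +_ (FinP.toℕ-fromℕ< (ℤD.n%ℕd<d (F i (suc (toℕ j))) T)))
        (cong (λ m → + (F i (suc m) ℤD.%ℕ T)) (FinP.toℕ-fromℕ< (ℕP.≤-pred m<k)))
      r≡ : r t ≡ r s
      r≡ = trans (sym (r≡box t)) (trans (cong (+_ ∘ toℕ) (boxes≡ j)) (r≡box s))
    close : ∀ m → m ℕ.< suc k′ → ∣ ν T * (ι (y 0) * ρ ^ m - ι (y m)) ∣ ≤ 1ℚ
    close zero    m<k = subst (λ z → ∣ z ∣ ≤ 1ℚ)
      (solve 2 (λ T y → con 0ℚ := T :* (y :* con 1ℚ :- y)) refl (ν T) (ι (y 0))) 0≤1
    close (suc m) m<k = subst (λ z → ∣ z ∣ ≤ 1ℚ) (sym e′)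
      (∣-∣≤1 (0≤frac t (suc m)) (frac≤1 t (suc m)) (0≤frac s (suc m)) (frac≤1 s (suc m)))
      where
      open ≡-Reasoning
      P = ρ ^ suc m
      e′ : ν T * (ι (y 0) * P - ι (y (suc m))) ≡ frac t (suc m) - frac s (suc m)
      e′ = begin
        ν T * (ι (y 0) * P - ι (y (suc m)))
          ≡⟨ cong (λ z → ν T * (z * P - ι (y (suc m)))) ιy₀ ⟩
        ν T * ((ν (toℕ t) - ν (toℕ s)) * P - ι (y (suc m)))
          ≡⟨ solve 5 (λ T t s P y → T :* ((t :- s) :* P :- y) := T :* (t :* P) :- T :* (s :* P) :- T :* y) refl
               (ν T) (ν (toℕ t)) (ν (toℕ s)) P (ι (y (suc m))) ⟩
        A t (suc m) - A s (suc m) - ν T * ι (y (suc m))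
          ≡⟨ cong (λ z → A t (suc m) - A s (suc m) - z) (T*y m m<k) ⟩
        A t (suc m) - A s (suc m) - (ι (F t (suc m)) - ι (F s (suc m)))
          ≡⟨ solve 4 (λ a a′ f f′ → a :- a′ :- (f :- f′) := (a :- f) :- (a′ :- f′)) refl
               (A t (suc m)) (A s (suc m)) (ι (F t (suc m))) (ι (F s (suc m))) ⟩
        frac t (suc m) - frac s (suc m) ∎
    relation″ : ∀ i → i ℕ.< D → revℤ b y i ≡ 0ℤ
    relation″ i i<D = trans (revℤ-minus b (extended t) (extended s) i)
      (trans (cong (ℤ._- revℤ b (extended s) i) (relation′ t s digits≡ i i<D)) (ℤP.+-inverseʳ (revℤ b (extended s) i)))

-- Propagation of the approximation errors along the recurrence.

module Errors {k′} (b : Fin (suc (suc k′)) → ℤ) (D T Q C : ℕ) (ρ θ : ℚ) (ρθ : ρ * θ ≡ 1ℚ)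
  (0≤ρ : 0ℚ ≤ ρ) (ρ≤1 : ρ ≤ 1ℚ) (0<b₀ : 1 ℕ.≤ ℤ.∣ b zero ∣)
  (b≤ : ∀ j → ℤ.∣ b j ∣ ℕ.≤ C ℕ.* ℤ.∣ b zero ∣)
  (small : ν T * (ν Q * ∣ ev b θ ∣) ≤ ν ℤ.∣ b zero ∣)
  (P : Point b D T Q ρ) where

  open Point P

  k = suc k′
  K = 1 ℕ.+ k ℕ.* C
  V = ν ℤ.∣ b zero ∣

  ε : ℕ → ℚ
  ε m = ν T * (ι (y 0) * ρ ^ m - ι (y m))

  -- The recurrence annihilates y, so only the powers of ρ contribute. The factor 1 = ρθ is inserted
  -- to supply the ρ that `rev-powers` asks for.
  rev-ε : ∀ i → i ℕ.< D → rev b ε i ≡ ν T * (ι (y 0) * (ρ ^ (k ℕ.+ i) * ev b θ))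
  rev-ε i i<D = begin
    rev b ε i
      ≡⟨ rev-error b (ρ ^_) (ι ∘ y) (ι (y 0)) (ν T) i ⟩
    ν T * (ι (y 0) * rev b (ρ ^_) i - rev b (ι ∘ y) i)
      ≡⟨ cong (λ s → ν T * (ι (y 0) * rev b (ρ ^_) i - s)) (trans (sym (ι-revℤ b y i)) (trans (cong ι (relation i i<D)) ι-0)) ⟩
    ν T * (ι (y 0) * rev b (ρ ^_) i - 0ℚ)
      ≡⟨ solve 3 (λ t y r → t :* (y :* r :- con 0ℚ) := t :* (y :* (con 1ℚ :* r))) refl (ν T) (ι (y 0)) (rev b (ρ ^_) i) ⟩
    ν T * (ι (y 0) * (1ℚ * rev b (ρ ^_) i))
      ≡⟨ cong (λ s → ν T * (ι (y 0) * (s * rev b (ρ ^_) i))) (sym ρθ) ⟩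
    ν T * (ι (y 0) * (ρ * θ * rev b (ρ ^_) i))
      ≡⟨ solve 5 (λ t y ρ θ r → t :* (y :* (ρ :* θ :* r)) := t :* (y :* (θ :* (ρ :* r)))) refl (ν T) (ι (y 0)) ρ θ (rev b (ρ ^_) i) ⟩
    ν T * (ι (y 0) * (θ * (ρ * rev b (ρ ^_) i)))
      ≡⟨ cong (λ s → ν T * (ι (y 0) * (θ * s))) (rev-powers b {ρ} {θ} ρθ i) ⟩
    ν T * (ι (y 0) * (θ * (ρ * p * ev b θ)))
      ≡⟨ solve 6 (λ t y ρ θ p v → t :* (y :* (θ :* (ρ :* p :* v))) := t :* (y :* ((ρ :* θ) :* p :* v))) refl (ν T) (ι (y 0)) ρ θ p (ev b θ) ⟩
    ν T * (ι (y 0) * (ρ * θ * p * ev b θ))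
      ≡⟨ cong (λ s → ν T * (ι (y 0) * (s * ev b θ))) (trans (cong (_* p) ρθ) (*-identityˡ p)) ⟩
    ν T * (ι (y 0) * (p * ev b θ)) ∎
    where
    open ≡-Reasoning
    p = ρ ^ (k ℕ.+ i)

  rev-ε≤V : ∀ i → i ℕ.< D → ∣ rev b ε i ∣ ≤ V
  rev-ε≤V i i<D = begin
    ∣ rev b ε i ∣                                ≡⟨ cong ∣_∣ (rev-ε i i<D) ⟩
    ∣ ν T * (ι (y 0) * (p * ev b θ)) ∣           ≡⟨ ∣p*q∣≡∣p∣*∣q∣ (ν T) (ι (y 0) * (p * ev b θ)) ⟩
    ∣ ν T ∣ * ∣ ι (y 0) * (p * ev b θ) ∣         ≡⟨ cong₂ _*_ (0≤p⇒∣p∣≡p (0≤ν T)) (∣p*q∣≡∣p∣*∣q∣ (ι (y 0)) (p * ev b θ)) ⟩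
    ν T * (∣ ι (y 0) ∣ * ∣ p * ev b θ ∣)         ≤⟨ *-monoˡ (ν T) (0≤ν T) (*-mono-≤ (0≤∣p∣ (ι (y 0))) (0≤∣p∣ (ev b θ)) y≤ p≤) ⟩
    ν T * (ν Q * ∣ ev b θ ∣)                     ≤⟨ small ⟩
    V ∎
    where
    open ≤-Reasoning
    p = ρ ^ (k ℕ.+ i)
    y≤ : ∣ ι (y 0) ∣ ≤ ν Q
    y≤ = subst (_≤ ν Q) (sym (ι-∣∣ (y 0))) (ν-mono y₀≤)
    p≤ : ∣ p * ev b θ ∣ ≤ ∣ ev b θ ∣
    p≤ = subst₂ _≤_ (sym (trans (∣p*q∣≡∣p∣*∣q∣ p (ev b θ)) (cong (_* ∣ ev b θ ∣) (0≤p⇒∣p∣≡p (0≤^ (k ℕ.+ i) 0≤ρ)))))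
      (*-identityˡ ∣ ev b θ ∣) (*-monoʳ ∣ ev b θ ∣ (0≤∣p∣ (ev b θ)) (^≤1 (k ℕ.+ i) 0≤ρ ρ≤1))

  1≤K : 1ℚ ≤ ν K
  1≤K = 1≤ν (ℕ.s≤s ℕ.z≤n)

  -- The errors satisfy the recurrence up to a defect of at most V. Solving for the newest one gives
  -- V·|ε| ≤ V + k·(C·V)·M, where M ≥ 1 bounds the older errors; after division by V this costs one
  -- factor K = 1 + kC.
  step : ∀ i → i ℕ.< D → (∀ m → m ℕ.< k ℕ.+ i → ∣ ε m ∣ ≤ ν K ^ m) → ∣ ε (k ℕ.+ i) ∣ ≤ ν K ^ (k ℕ.+ i)
  step i i<D h = *-cancelˡ-≤ V (0<ν 0<b₀) (begin
    V * ∣ ε (k ℕ.+ i) ∣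
      ≡⟨ cong (_* ∣ ε (k ℕ.+ i) ∣) (sym (ι-∣∣ (b zero))) ⟩
    ∣ ι (b zero) ∣ * ∣ ε (k ℕ.+ i) ∣
      ≡⟨ sym (∣p*q∣≡∣p∣*∣q∣ (ι (b zero)) (ε (k ℕ.+ i))) ⟩
    ∣ ι (b zero) * ε (k ℕ.+ i) ∣
      ≡⟨ cong ∣_∣ (solve 2 (λ x r → x := (x :+ r) :- r) refl (ι (b zero) * ε (k ℕ.+ i)) r) ⟩
    ∣ rev b ε i - r ∣
      ≤⟨ ∣p-q∣≤∣p∣+∣q∣ (rev b ε i) r ⟩
    ∣ rev b ε i ∣ + ∣ r ∣
      ≤⟨ +-mono-≤ (rev-ε≤V i i<D) (rev-bound (b ∘ suc) ε i (*-nonNeg (0≤ν C) (0≤ν ℤ.∣ b zero ∣)) b≤′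
           λ m m< → ≤-trans (h m m<) (^-monoʳ-≤ 1≤K (ℕP.≤-pred m<))) ⟩
    V + ν k * (ν C * V * M)
      ≤⟨ +-monoˡ-≤ (ν k * (ν C * V * M)) (subst (_≤ V * M) (*-identityʳ V) (*-monoˡ V (0≤ν ℤ.∣ b zero ∣) (1≤^ (k′ ℕ.+ i) 1≤K))) ⟩
    V * M + ν k * (ν C * V * M)
      ≡⟨ solve 4 (λ V M k C → V :* M :+ k :* (C :* V :* M) := V :* ((con 1ℚ :+ k :* C) :* M)) refl V M (ν k) (ν C) ⟩
    V * ((1ℚ + ν k * ν C) * M)
      ≡⟨ cong (λ s → V * (s * M)) (sym (trans (ν-+ 1 (k ℕ.* C)) (cong₂ _+_ ι-1 (ν-* k C)))) ⟩
    V * (ν K * M) ∎)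
    where
    open ≤-Reasoning
    M = ν K ^ (k′ ℕ.+ i)
    r = rev (b ∘ suc) ε i
    b≤′ : ∀ j → ∣ ι (b (suc j)) ∣ ≤ ν C * V
    b≤′ j = subst₂ _≤_ (sym (ι-∣∣ (b (suc j)))) (ν-* C ℤ.∣ b zero ∣) (ν-mono (b≤ (suc j)))

  errors : ∀ i → i ℕ.≤ D → ∀ m → m ℕ.< k ℕ.+ i → ∣ ε m ∣ ≤ ν K ^ m
  errors zero i≤D m m< = ≤-trans (close m (subst (m ℕ.<_) (ℕP.+-identityʳ k) m<)) (1≤^ m 1≤K)
  errors (suc i) i<D m m< with ℕP.m≤n⇒m<n∨m≡n (ℕP.≤-pred (subst (m ℕ.<_) (ℕP.+-suc k i) m<))
  ... | inj₁ m<′ = errors i (ℕP.<⇒≤ i<D) m m<′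
  ... | inj₂ refl = step i i<D (errors i (ℕP.<⇒≤ i<D))

-- Simultaneous approximation of the powers of a rational number

module Back (n e T M : ℕ) (y : ℕ → ℤ) (ρ θ : ℚ) (ρθ : ρ * θ ≡ 1ℚ)
  (y-close : ∀ m → m ℕ.≤ n → ∣ ν T * (ι (y 0) * ρ ^ m - ι (y m)) ∣ ≤ ν M) where

  -- If L is the linear form with L((X + e)ʲ) = y (n − j), then
  -- shifted m j = L(Xᵐ(X + e)ʲ).
  shifted : ℕ → ℕ → ℤ
  shifted zero    j = y (n ℕ.∸ j)
  shifted (suc m) j = shifted m (suc j) ℤ.- + e ℤ.* shifted m j

  ξ h : ℚ
  ξ = θ - ν e
  h = ι (y 0) * ρ ^ n

  δ : ℕ → ℕ → ℚ
  δ m j = ν T * (ι (shifted m j) - h * (ξ ^ m * θ ^ j))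

  ρ^θ^ : ∀ j → ρ ^ j * θ ^ j ≡ 1ℚ
  ρ^θ^ j = trans (sym (^-distrib-* ρ θ j)) (trans (cong (_^ j) ρθ) (1^ j))

  -- Reversal of the indices: y₀ρ^(n-j) = h·θʲ, because ρθ = 1.
  δ-zero : ∀ j → j ℕ.≤ n → ∣ δ 0 j ∣ ≤ ν M
  δ-zero j j≤n = subst (_≤ ν M) e′ (y-close (n ℕ.∸ j) (ℕP.m∸n≤m n j))
    where
    open ≡-Reasoning
    i = n ℕ.∸ j
    h≡ : ι (y 0) * ρ ^ i ≡ h * (1ℚ * θ ^ j)
    h≡ = sym (begin
      ι (y 0) * ρ ^ n * (1ℚ * θ ^ j)
        ≡⟨ cong (λ s → ι (y 0) * s * (1ℚ * θ ^ j)) (trans (cong (ρ ^_) (sym (ℕP.m∸n+n≡m j≤n))) (^-homo-* ρ i j)) ⟩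
      ι (y 0) * (ρ ^ i * ρ ^ j) * (1ℚ * θ ^ j)
        ≡⟨ solve 4 (λ y p q r → y :* (p :* q) :* (con 1ℚ :* r) := y :* p :* (q :* r)) refl (ι (y 0)) (ρ ^ i) (ρ ^ j) (θ ^ j) ⟩
      ι (y 0) * ρ ^ i * (ρ ^ j * θ ^ j)
        ≡⟨ trans (cong (ι (y 0) * ρ ^ i *_) (ρ^θ^ j)) (*-identityʳ _) ⟩
      ι (y 0) * ρ ^ i ∎)
    e′ : ∣ ν T * (ι (y 0) * ρ ^ i - ι (y i)) ∣ ≡ ∣ δ 0 j ∣
    e′ = begin
      ∣ ν T * (ι (y 0) * ρ ^ i - ι (y i)) ∣
        ≡⟨ cong (λ s → ∣ ν T * (s - ι (y i)) ∣) h≡ ⟩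
      ∣ ν T * (h * (1ℚ * θ ^ j) - ι (y i)) ∣
        ≡⟨ sym (∣-p∣≡∣p∣ (ν T * (h * (1ℚ * θ ^ j) - ι (y i)))) ⟩
      ∣ - (ν T * (h * (1ℚ * θ ^ j) - ι (y i))) ∣
        ≡⟨ cong ∣_∣ (solve 3 (λ t a b → :- (t :* (a :- b)) := t :* (b :- a)) refl (ν T) (h * (1ℚ * θ ^ j)) (ι (y i))) ⟩
      ∣ δ 0 j ∣ ∎

  δ-suc : ∀ m j → δ (suc m) j ≡ δ m (suc j) - ν e * δ m j
  δ-suc m j = trans
    (cong (λ s → ν T * (s - h * (ξ ^ suc m * θ ^ j)))
      (trans (ι-- (shifted m (suc j)) (+ e ℤ.* shifted m j)) (cong (λ s → ι (shifted m (suc j)) - s) (ι-* (+ e) (shifted m j)))))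
    (solve 8 (λ t a b e h p θ q → t :* ((a :- e :* b) :- h :* (((θ :- e) :* p) :* q))
        := t :* (a :- h :* (p :* (θ :* q))) :- e :* (t :* (b :- h :* (p :* q)))) refl
      (ν T) (ι (shifted m (suc j))) (ι (shifted m j)) (ν e) h (ξ ^ m) θ (θ ^ j))

  -- Passing from m to m + 1 multiplies by ξ = θ - e and costs a factor 1 + e. The condition m + j ≤
  -- n keeps the construction within the first n + 1 terms of y.
  δ-bound : ∀ m j → m ℕ.+ j ℕ.≤ n → ∣ δ m j ∣ ≤ ν (suc e ℕ.^ m ℕ.* M)
  δ-bound zero j j≤n = subst (λ s → ∣ δ 0 j ∣ ≤ ν s) (sym (ℕP.*-identityˡ M)) (δ-zero j j≤n)
  δ-bound (suc m) j mj≤n = begin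
    ∣ δ (suc m) j ∣                    ≡⟨ cong ∣_∣ (δ-suc m j) ⟩
    ∣ δ m (suc j) - ν e * δ m j ∣      ≤⟨ ∣p-q∣≤∣p∣+∣q∣ (δ m (suc j)) (ν e * δ m j) ⟩
    ∣ δ m (suc j) ∣ + ∣ ν e * δ m j ∣  ≡⟨ cong (_+_ ∣ δ m (suc j) ∣) (trans (∣p*q∣≡∣p∣*∣q∣ (ν e) (δ m j)) (cong (_* ∣ δ m j ∣) (0≤p⇒∣p∣≡p (0≤ν e)))) ⟩
    ∣ δ m (suc j) ∣ + ν e * ∣ δ m j ∣  ≤⟨ +-mono-≤ (δ-bound m (suc j) (subst (ℕ._≤ n) (sym (ℕP.+-suc m j)) mj≤n))
                                            (*-monoˡ (ν e) (0≤ν e) (δ-bound m j (ℕP.<⇒≤ mj≤n))) ⟩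
    ν N + ν e * ν N                    ≡⟨ trans (cong (_+_ (ν N)) (sym (ν-* e N))) (sym (ν-+ N (e ℕ.* N))) ⟩
    ν (suc e ℕ.* N)                    ≡⟨ cong ν (sym (ℕP.*-assoc (suc e) (suc e ℕ.^ m) M)) ⟩
    ν (suc e ℕ.^ suc m ℕ.* M) ∎
    where
    open ≤-Reasoning
    N = suc e ℕ.^ m ℕ.* M

  x : ℕ → ℤ
  x m = shifted m 0

  module _ (R : ℕ) (1≤R : 1 ℕ.≤ R) (ξ≤ : ∣ ξ ∣ ≤ ν R) where

    N = suc e ℕ.^ n ℕ.* M

    δ₀-bound : ∀ m → m ℕ.≤ n → ∣ δ m 0 ∣ ≤ ν N
    δ₀-bound m m≤n = ≤-trans (δ-bound m 0 (subst (ℕ._≤ n) (sym (ℕP.+-identityʳ m)) m≤n))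
      (ν-mono (ℕP.*-monoˡ-≤ M (ℕP.^-monoʳ-≤ (suc e) m≤n)))

    -- All x m approximate multiples of the same h, which is eliminated: x₀ξᵐ - xₘ = ξᵐ(x₀ - h) -
    -- (xₘ - hξᵐ).
    x-close : ∀ m → m ℕ.≤ n → ν T * ∣ ι (x 0) * ξ ^ m - ι (x m) ∣ ≤ ν (R ℕ.^ n ℕ.* N ℕ.+ N)
    x-close m m≤n = begin
      ν T * ∣ ι (x 0) * ξ ^ m - ι (x m) ∣  ≡⟨ cong (_* ∣ ι (x 0) * ξ ^ m - ι (x m) ∣) (sym (0≤p⇒∣p∣≡p (0≤ν T))) ⟩
      ∣ ν T ∣ * ∣ ι (x 0) * ξ ^ m - ι (x m) ∣  ≡⟨ sym (∣p*q∣≡∣p∣*∣q∣ (ν T) (ι (x 0) * ξ ^ m - ι (x m))) ⟩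
      ∣ ν T * (ι (x 0) * ξ ^ m - ι (x m)) ∣
        ≡⟨ cong ∣_∣ (solve 5 (λ t a b p h → t :* (a :* p :- b) := p :* (t :* (a :- h :* (con 1ℚ :* con 1ℚ))) :- t :* (b :- h :* (p :* con 1ℚ))) refl
             (ν T) (ι (x 0)) (ι (x m)) (ξ ^ m) h) ⟩
      ∣ ξ ^ m * δ 0 0 - δ m 0 ∣            ≤⟨ ∣p-q∣≤∣p∣+∣q∣ (ξ ^ m * δ 0 0) (δ m 0) ⟩
      ∣ ξ ^ m * δ 0 0 ∣ + ∣ δ m 0 ∣        ≡⟨ cong (_+ ∣ δ m 0 ∣) (∣p*q∣≡∣p∣*∣q∣ (ξ ^ m) (δ 0 0)) ⟩
      ∣ ξ ^ m ∣ * ∣ δ 0 0 ∣ + ∣ δ m 0 ∣    ≤⟨ +-mono-≤ (*-mono-≤ (0≤∣p∣ (ξ ^ m)) (0≤ν N) ξ^≤ (δ₀-bound 0 ℕ.z≤n)) (δ₀-bound m m≤n) ⟩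
      ν (R ℕ.^ n) * ν N + ν N              ≡⟨ trans (cong (_+ ν N) (sym (ν-* (R ℕ.^ n) N))) (sym (ν-+ (R ℕ.^ n ℕ.* N) N)) ⟩
      ν (R ℕ.^ n ℕ.* N ℕ.+ N) ∎
      where
      open ≤-Reasoning
      ξ^≤ : ∣ ξ ^ m ∣ ≤ ν (R ℕ.^ n)
      ξ^≤ = subst₂ _≤_ (sym (∣^∣ ξ m)) (sym (ν-^ R n))
        (≤-trans (^-monoˡ-≤ m (0≤∣p∣ ξ) ξ≤) (^-monoʳ-≤ (1≤ν 1≤R) m≤n))

  module _ (0≤ρ : 0ℚ ≤ ρ) where

    ∣h∣ : ∣ h ∣ ≡ ν ℤ.∣ y 0 ∣ * ρ ^ n
    ∣h∣ = trans (∣p*q∣≡∣p∣*∣q∣ (ι (y 0)) (ρ ^ n)) (cong₂ _*_ (ι-∣∣ (y 0)) (0≤p⇒∣p∣≡p (0≤^ n 0≤ρ)))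

    x₀-h : ν T * ∣ ι (x 0) - h ∣ ≤ ν M
    x₀-h = subst (_≤ ν M) (trans (cong (λ s → ∣ ν T * (ι (x 0) - s) ∣) (trans (cong (h *_) (*-identityˡ 1ℚ)) (*-identityʳ h)))
      (trans (∣p*q∣≡∣p∣*∣q∣ (ν T) (ι (x 0) - h)) (cong (_* ∣ ι (x 0) - h ∣) (0≤p⇒∣p∣≡p (0≤ν T)))))
      (δ-zero 0 ℕ.z≤n)

    x₀-bound : ∀ Q → 1 ℕ.≤ T → ρ ≤ 1ℚ → ℤ.∣ y 0 ∣ ℕ.≤ Q → ℤ.∣ x 0 ∣ ℕ.≤ Q ℕ.+ M
    x₀-bound Q 1≤T ρ≤1 y₀≤Q = ν-cancel (begin
      ν ℤ.∣ x 0 ∣                ≡⟨ sym (ι-∣∣ (x 0)) ⟩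
      ∣ ι (x 0) ∣                ≡⟨ cong ∣_∣ (solve 2 (λ x h → x := h :+ (x :- h)) refl (ι (x 0)) h) ⟩
      ∣ h + (ι (x 0) - h) ∣      ≤⟨ ∣p+q∣≤∣p∣+∣q∣ h (ι (x 0) - h) ⟩
      ∣ h ∣ + ∣ ι (x 0) - h ∣    ≤⟨ +-mono-≤ h≤ d≤ ⟩
      ν Q + ν M                  ≡⟨ sym (ν-+ Q M) ⟩
      ν (Q ℕ.+ M) ∎)
      where
      open ≤-Reasoning
      h≤ : ∣ h ∣ ≤ ν Q
      h≤ = subst₂ _≤_ (sym ∣h∣) (*-identityʳ (ν Q)) (*-mono-≤ (0≤ν ℤ.∣ y 0 ∣) 0≤1 (ν-mono y₀≤Q) (^≤1 n 0≤ρ ρ≤1))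
      d≤ : ∣ ι (x 0) - h ∣ ≤ ν M
      d≤ = ≤-trans (subst (_≤ ν T * ∣ ι (x 0) - h ∣) (*-identityˡ ∣ ι (x 0) - h ∣) (*-monoʳ ∣ ι (x 0) - h ∣ (0≤∣p∣ (ι (x 0) - h)) (1≤ν 1≤T))) x₀-h

    -- If x₀ = 0, then T·|h| ≤ M; but |h| = |y₀|ρⁿ ≥ ρⁿ, and multiplying by θⁿ ≤ Θⁿ gives T ≤ MΘⁿ.
    x₀≢0 : ∀ Θ → 0ℚ ≤ θ → θ ≤ ν Θ → y 0 ≢ 0ℤ → M ℕ.* Θ ℕ.^ n ℕ.< T → x 0 ≢ 0ℤ
    x₀≢0 Θ 0≤θ θ≤Θ y₀≢0 MΘ<T x₀≡0 = ℕP.<⇒≱ MΘ<T (ν-cancel (begin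
      ν T                            ≡⟨ solve 1 (λ t → t := t :* con 1ℚ) refl (ν T) ⟩
      ν T * 1ℚ                       ≡⟨ cong (ν T *_) (sym (ρ^θ^ n)) ⟩
      ν T * (ρ ^ n * θ ^ n)          ≡⟨ sym (*-assoc (ν T) (ρ ^ n) (θ ^ n)) ⟩
      ν T * ρ ^ n * θ ^ n            ≤⟨ *-mono-≤ (*-nonNeg (0≤ν T) (0≤^ n 0≤ρ)) (0≤^ n (≤-trans 0≤θ θ≤Θ)) Tρ≤ (^-monoˡ-≤ n 0≤θ θ≤Θ) ⟩
      ν M * ν Θ ^ n                  ≡⟨ trans (cong (ν M *_) (sym (ν-^ Θ n))) (sym (ν-* M (Θ ℕ.^ n))) ⟩
      ν (M ℕ.* Θ ℕ.^ n) ∎))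
      where
      open ≤-Reasoning
      1≤y₀ : 1 ℕ.≤ ℤ.∣ y 0 ∣
      1≤y₀ = ℕP.n≢0⇒n>0 (λ z → y₀≢0 (ℤP.∣i∣≡0⇒i≡0 z))
      Tρ≤ : ν T * ρ ^ n ≤ ν M
      Tρ≤ = begin
        ν T * ρ ^ n                    ≡⟨ cong (ν T *_) (sym (*-identityˡ (ρ ^ n))) ⟩
        ν T * (1ℚ * ρ ^ n)             ≤⟨ *-monoˡ (ν T) (0≤ν T) (*-monoʳ (ρ ^ n) (0≤^ n 0≤ρ) (1≤ν 1≤y₀)) ⟩
        ν T * (ν ℤ.∣ y 0 ∣ * ρ ^ n)    ≡⟨ cong (ν T *_) (trans (sym ∣h∣) (sym (∣-p∣≡∣p∣ h))) ⟩
        ν T * ∣ - h ∣                  ≡⟨ cong (λ s → ν T * ∣ s ∣) (trans (sym (+-identityˡ (- h))) (cong (_- h) (sym (trans (cong ι x₀≡0) ι-0)))) ⟩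
        ν T * ∣ ι (x 0) - h ∣          ≤⟨ x₀-h ⟩
        ν M ∎

-- Approximations obtained from one polynomial.

private
  -- With |ξ| ≤ R the shifts start at e = R + 1, so that θ = ξ + e ≥ 1. Then E bounds e, Θ bounds θ,
  -- M bounds the errors for the powers of ρ and N those left after the shift is undone.
  module Constants (k′ d R : ℕ) where
    k = suc k′
    n = k ℕ.+ d
    C = shift-constant k (suc R)
    E = suc R ℕ.+ k
    Θ = R ℕ.+ E
    M = (1 ℕ.+ k ℕ.* C) ℕ.^ n
    N = suc E ℕ.^ n ℕ.* M

-- One summand for each use: C gives V ≤ c·A, the middle term is the final error of `x-close`, and
-- the last makes c < T imply x₀ ≠ 0.
approximation-constant : ℕ → ℕ → ℕ → ℕ
approximation-constant k′ d R = C ℕ.+ ((R ℕ.^ n ℕ.* N ℕ.+ N) ℕ.+ M ℕ.* Θ ℕ.^ n)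
  where open Constants k′ d R

approximation : ∀ k′ d R → 1 ℕ.≤ R → (a : Fin (suc (suc k′)) → ℤ) → (∃[ j ] a j ≢ 0ℤ) →
  ∀ ξ → ∣ ξ ∣ ≤ ν R → ∀ A T → (∀ j → ℤ.∣ a j ∣ ℕ.≤ A) →
  let c = approximation-constant k′ d R in c ℕ.< T →
  ν T ^ suc k′ * (ν (c ℕ.* A) ^ d * ∣ ev a ξ ∣) ≤ 1ℚ →
  Σ[ x ∈ (ℕ → ℤ) ] (x 0 ≢ 0ℤ) × (ℤ.∣ x 0 ∣ ℕ.≤ T ℕ.^ k′ ℕ.* (c ℕ.* A) ℕ.^ suc d ℕ.+ c) ×
    (∀ m → m ℕ.≤ suc k′ ℕ.+ d → ν T * ∣ ι (x 0) * ξ ^ m - ι (x m) ∣ ≤ ν c)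
approximation k′ d R 1≤R a (j₀ , aj₀≢0) ξ ξ≤R A T a≤A c<T small =
    B.x
  , B.x₀≢0 0≤ρ Θ (<⇒≤ 0<θ) θ≤Θ y₀≢0 (ℕP.≤-<-trans (ℕP.≤-trans (ℕP.m≤n+m (M ℕ.* Θ ℕ.^ n) (R ℕ.^ n ℕ.* N ℕ.+ N)) (ℕP.m≤n+m _ C)) c<T)
  , ℕP.≤-trans (B.x₀-bound 0≤ρ Q 1≤T ρ≤1 y₀≤)
      (ℕP.+-mono-≤ (ℕP.*-monoʳ-≤ (T ℕ.^ k′) (ℕP.^-monoˡ-≤ (suc d) V≤cA)) M≤c)
  , λ m m≤n → ≤-trans (subst (λ z → ν T * ∣ ι (B.x 0) * z ^ m - ι (B.x m) ∣ ≤ ν N′) θ-e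
        (B.x-close R 1≤R (subst (λ z → ∣ z ∣ ≤ ν R) (sym θ-e) ξ≤R) m m≤n)) (ν-mono N≤c)
  where
  open Constants k′ d R
  c = approximation-constant k′ d R
  open Shift (shift k (suc R) a)
  V = ℤ.∣ b zero ∣
  1≤V : 1 ℕ.≤ V
  1≤V = ℕP.n≢0⇒n>0 λ V≡0 → aj₀≢0 (ℤP.∣i∣≡0⇒i≡0 (ℕP.n≤0⇒n≡0
    (subst (ℤ.∣ a j₀ ∣ ℕ.≤_) (trans (cong (C ℕ.*_) V≡0) (ℕP.*-zeroʳ C)) (a≤ j₀))))
  C≤c : C ℕ.≤ c
  C≤c = ℕP.m≤m+n C _
  V≤cA : V ℕ.≤ c ℕ.* A
  V≤cA = ℕP.≤-trans (b₀≤ A a≤A) (ℕP.*-monoˡ-≤ A C≤c)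
  1≤T : 1 ℕ.≤ T
  1≤T = ℕP.≤-trans (ℕ.s≤s ℕ.z≤n) c<T
  Q = T ℕ.^ k′ ℕ.* V ℕ.^ suc d
  θ = ξ + ν e
  θ-e : θ - ν e ≡ ξ
  θ-e = solve 2 (λ x e → x :+ e :- e := x) refl ξ (ν e)
  1≤θ : 1ℚ ≤ θ
  1≤θ = begin
    1ℚ                   ≡⟨ solve 1 (λ r → con 1ℚ := :- r :+ (con 1ℚ :+ r)) refl (ν R) ⟩
    - ν R + (1ℚ + ν R)   ≡⟨ cong (_+_ (- ν R)) (sym (trans (ν-+ 1 R) (cong (_+ ν R) ι-1))) ⟩
    - ν R + ν (suc R)    ≤⟨ +-mono-≤ -R≤ξ (ν-mono e₀≤e) ⟩
    θ ∎
    where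
    open ≤-Reasoning
    -R≤ξ : - ν R ≤ ξ
    -R≤ξ = subst (- ν R ≤_) (solve 1 (λ x → :- (:- x) := x) refl ξ)
      (neg-antimono-≤ (≤-trans (p≤∣p∣ (- ξ)) (subst (_≤ ν R) (sym (∣-p∣≡∣p∣ ξ)) ξ≤R)))
  0<θ : 0ℚ < θ
  0<θ = <-≤-trans 0<1 1≤θ
  θ≤Θ : θ ≤ ν Θ
  θ≤Θ = subst (θ ≤_) (sym (ν-+ R E)) (+-mono-≤ (≤-trans (p≤∣p∣ ξ) ξ≤R) (ν-mono e≤))
  ρ = inv-pos θ 0<θ
  ρθ : ρ * θ ≡ 1ℚ
  ρθ = trans (*-comm ρ θ) (inv-posʳ θ 0<θ)
  0≤ρ : 0ℚ ≤ ρ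
  0≤ρ = <⇒≤ (inv-pos>0 θ 0<θ)
  ρ≤1 : ρ ≤ 1ℚ
  ρ≤1 = subst₂ _≤_ (*-identityʳ ρ) ρθ (*-monoˡ ρ 0≤ρ 1≤θ)
  -- The recurrence is imposed at i = 0, ..., d, so that it reaches the index k + d = n.
  P : Point b (suc d) T Q ρ
  P = dirichlet b {{ℕ.>-nonZero 1≤V}} (suc d) T {{ℕ.>-nonZero 1≤T}} ρ
  open Point P using (y; y₀≢0; y₀≤)
  -- One of the d + 1 factors V of Q is matched by the V on the right; the other d are at most c·A.
  small′ : ν T * (ν Q * ∣ ev b θ ∣) ≤ ν V
  small′ = begin
    ν T * (ν Q * ∣ ev b θ ∣)
      ≡⟨ cong₂ (λ q v → ν T * (q * ∣ v ∣)) (trans (ν-* (T ℕ.^ k′) (V ℕ.^ suc d)) (cong₂ _*_ (ν-^ T k′) (ν-^ V (suc d)))) (sym (ev-b ξ)) ⟩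
    ν T * (ν T ^ k′ * (ν V * ν V ^ d) * ∣ ev a ξ ∣)
      ≡⟨ solve 5 (λ t p v q x → t :* (p :* (v :* q) :* x) := v :* (t :* p :* (q :* x))) refl (ν T) (ν T ^ k′) (ν V) (ν V ^ d) ∣ ev a ξ ∣ ⟩
    ν V * (ν T ^ k * (ν V ^ d * ∣ ev a ξ ∣))
      ≤⟨ *-monoˡ (ν V) (0≤ν V) (*-monoˡ (ν T ^ k) (0≤^ k (0≤ν T)) (*-monoʳ ∣ ev a ξ ∣ (0≤∣p∣ (ev a ξ)) (^-monoˡ-≤ d (0≤ν V) (ν-mono V≤cA)))) ⟩
    ν V * (ν T ^ k * (ν (c ℕ.* A) ^ d * ∣ ev a ξ ∣))
      ≤⟨ *-monoˡ (ν V) (0≤ν V) small ⟩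
    ν V * 1ℚ  ≡⟨ *-identityʳ (ν V) ⟩
    ν V ∎
    where open ≤-Reasoning
  y-close : ∀ m → m ℕ.≤ n → ∣ ν T * (ι (y 0) * ρ ^ m - ι (y m)) ∣ ≤ ν M
  y-close m m≤n = ≤-trans
    (Errors.errors b (suc d) T Q C ρ θ ρθ 0≤ρ ρ≤1 1≤V b≤ small′ P (suc d) ℕP.≤-refl m
      (subst (m ℕ.<_) (sym (ℕP.+-suc k d)) (ℕ.s≤s m≤n)))
    (≤-trans (^-monoʳ-≤ (1≤ν (ℕ.s≤s ℕ.z≤n)) m≤n) (≤-reflexive (sym (ν-^ (1 ℕ.+ k ℕ.* C) n))))
  module B = Back n e T M y ρ θ ρθ y-close
  M≤c : M ℕ.≤ c
  M≤c = ℕP.≤-trans (ℕP.m≤m*n M (Θ ℕ.^ n) {{ℕP.m^n≢0 Θ n {{ℕ.>-nonZero (ℕP.≤-trans 1≤R (ℕP.m≤m+n R E))}}}})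
    (ℕP.≤-trans (ℕP.m≤n+m (M ℕ.* Θ ℕ.^ n) (R ℕ.^ n ℕ.* N ℕ.+ N)) (ℕP.m≤n+m _ C))
  N′ = R ℕ.^ n ℕ.* (suc e ℕ.^ n ℕ.* M) ℕ.+ suc e ℕ.^ n ℕ.* M
  N≤c : N′ ℕ.≤ c
  N≤c = ℕP.≤-trans (ℕP.+-mono-≤ (ℕP.*-monoʳ-≤ (R ℕ.^ n) e≤N) e≤N) (ℕP.≤-trans (ℕP.m≤m+n _ (M ℕ.* Θ ℕ.^ n)) (ℕP.m≤n+m _ C))
    where
    e≤N : suc e ℕ.^ n ℕ.* M ℕ.≤ N
    e≤N = ℕP.*-monoˡ-≤ M (ℕP.^-monoˡ-≤ n (ℕ.s≤s e≤))

^-distribʳ : ∀ m n o → (m ℕ.* n) ℕ.^ o ≡ m ℕ.^ o ℕ.* n ℕ.^ o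
^-distribʳ m n zero    = refl
^-distribʳ m n (suc o) = trans (cong (m ℕ.* n ℕ.*_) (^-distribʳ m n o)) (ℕP.[m*n]*[o*p]≡[m*o]*[n*p] m n (m ℕ.^ o) (n ℕ.^ o))

^-split : ∀ Z w q d → (w ℕ.* Z ℕ.^ q) ℕ.^ d ≡ w ℕ.^ d ℕ.* Z ℕ.^ (q ℕ.* d)
^-split Z w q d = trans (^-distribʳ w (Z ℕ.^ q) d) (cong (w ℕ.^ d ℕ.*_) (ℕP.^-*-assoc Z q d))

-- With height c₁Z^q and T = Z^(v+1), one spare factor Z absorbs the constants in the smallness
-- condition, in the denominator and in the error. The 3 is the constant that `value-bound`
-- delivers; the 2 in the conclusion keeps half of the error for moving from a rational to ξ.
large-approximation : ∀ k′ d R c₁ v q → 1 ℕ.≤ R → ∃[ Z₀ ] (∀ Z → Z₀ ℕ.≤ Z →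
  (a : Fin (suc (suc k′)) → ℤ) → (∃[ j ] a j ≢ 0ℤ) → (∀ j → ℤ.∣ a j ∣ ℕ.≤ c₁ ℕ.* Z ℕ.^ q) →
  ∀ ξ → ∣ ξ ∣ ≤ ν R → ν Z ^ suc (suc v ℕ.* suc k′ ℕ.+ q ℕ.* d) * ∣ ev a ξ ∣ ≤ ν 3 →
  Σ[ x ∈ (ℕ → ℤ) ] (x 0 ≢ 0ℤ) × (ℤ.∣ x 0 ∣ ℕ.≤ Z ℕ.^ suc (suc v ℕ.* k′ ℕ.+ q ℕ.* suc d)) ×
    (∀ m → m ℕ.≤ suc k′ ℕ.+ d → ν 2 * (ν Z ^ v * ∣ ι (x 0) * ξ ^ m - ι (x m) ∣) ≤ 1ℚ))
large-approximation k′ d R c₁ v q 1≤R = Z₀ , λ Z Z₀≤Z a a≢0 a≤ ξ ξ≤R small →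
  let open Proof Z Z₀≤Z
      x , x₀≢0 , x₀≤ , close = approximation k′ d R 1≤R a a≢0 ξ ξ≤R (c₁ ℕ.* Z ℕ.^ q) (Z ℕ.^ t) a≤ c<T (small′ ∣ ev a ξ ∣ small)
  in x , x₀≢0 , ℕP.≤-trans x₀≤ Q≤ , λ m m≤n → close′ ∣ ι (x 0) * ξ ^ m - ι (x m) ∣ (close m m≤n)
  where
  k = suc k′
  t = suc v
  c = approximation-constant k′ d R
  w = c ℕ.* c₁
  -- One summand for each threshold: c < Z, 2c ≤ Z, 3w^d ≤ Z and w^(d+1) + c ≤ Z.
  Z₀ = (suc c ℕ.+ 2 ℕ.* c) ℕ.+ (3 ℕ.* w ℕ.^ d ℕ.+ (w ℕ.^ suc d ℕ.+ c))
  module Proof (Z : ℕ) (Z₀≤Z : Z₀ ℕ.≤ Z) where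
    c<Z : c ℕ.< Z
    c<Z = ℕP.≤-trans (ℕP.≤-trans (ℕP.m≤m+n (suc c) (2 ℕ.* c)) (ℕP.m≤m+n (suc c ℕ.+ 2 ℕ.* c) _)) Z₀≤Z
    2c≤Z : 2 ℕ.* c ℕ.≤ Z
    2c≤Z = ℕP.≤-trans (ℕP.≤-trans (ℕP.m≤n+m (2 ℕ.* c) (suc c)) (ℕP.m≤m+n (suc c ℕ.+ 2 ℕ.* c) _)) Z₀≤Z
    3w≤Z : 3 ℕ.* w ℕ.^ d ℕ.≤ Z
    3w≤Z = ℕP.≤-trans (ℕP.≤-trans (ℕP.m≤m+n (3 ℕ.* w ℕ.^ d) _) (ℕP.m≤n+m _ (suc c ℕ.+ 2 ℕ.* c))) Z₀≤Z
    wc≤Z : w ℕ.^ suc d ℕ.+ c ℕ.≤ Z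
    wc≤Z = ℕP.≤-trans (ℕP.≤-trans (ℕP.m≤n+m _ (3 ℕ.* w ℕ.^ d)) (ℕP.m≤n+m _ (suc c ℕ.+ 2 ℕ.* c))) Z₀≤Z
    1≤Z : 1 ℕ.≤ Z
    1≤Z = ℕP.≤-trans (ℕ.s≤s ℕ.z≤n) c<Z
    0<νZ : 0ℚ < ν Z
    0<νZ = 0<ν 1≤Z
    1≤Z^ : ∀ m → 1 ℕ.≤ Z ℕ.^ m
    1≤Z^ m = ℕP.m^n>0 Z {{ℕ.>-nonZero 1≤Z}} m
    c<T : c ℕ.< Z ℕ.^ t
    c<T = ℕP.<-≤-trans c<Z (ℕP.m≤m*n Z (Z ℕ.^ v) {{ℕ.>-nonZero (1≤Z^ v)}})
    cA : c ℕ.* (c₁ ℕ.* Z ℕ.^ q) ≡ w ℕ.* Z ℕ.^ q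
    cA = sym (ℕP.*-assoc c c₁ (Z ℕ.^ q))
    small′ : ∀ η → ν Z ^ suc (t ℕ.* k ℕ.+ q ℕ.* d) * η ≤ ν 3 →
      ν (Z ℕ.^ t) ^ k * (ν (c ℕ.* (c₁ ℕ.* Z ℕ.^ q)) ^ d * η) ≤ 1ℚ
    small′ η h = *-cancelˡ-≤ (ν Z) 0<νZ (begin
      ν Z * (ν (Z ℕ.^ t) ^ k * (ν (c ℕ.* (c₁ ℕ.* Z ℕ.^ q)) ^ d * η))
        ≡⟨ cong₂ (λ p r → ν Z * (p * (r * η))) e₁ e₂ ⟩
      ν Z * (ν Z ^ (t ℕ.* k) * (ν (w ℕ.^ d) * ν Z ^ (q ℕ.* d) * η))
        ≡⟨ solve 5 (λ z p w r x → z :* (p :* (w :* r :* x)) := w :* (z :* (p :* r) :* x)) refl (ν Z) (ν Z ^ (t ℕ.* k)) (ν (w ℕ.^ d)) (ν Z ^ (q ℕ.* d)) η ⟩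
      ν (w ℕ.^ d) * (ν Z * (ν Z ^ (t ℕ.* k) * ν Z ^ (q ℕ.* d)) * η)
        ≡⟨ cong (λ s → ν (w ℕ.^ d) * (ν Z * s * η)) (sym (^-homo-* (ν Z) (t ℕ.* k) (q ℕ.* d))) ⟩
      ν (w ℕ.^ d) * (ν Z ^ suc (t ℕ.* k ℕ.+ q ℕ.* d) * η)
        ≤⟨ *-monoˡ (ν (w ℕ.^ d)) (0≤ν (w ℕ.^ d)) h ⟩
      ν (w ℕ.^ d) * ν 3
        ≡⟨ trans (*-comm (ν (w ℕ.^ d)) (ν 3)) (sym (ν-* 3 (w ℕ.^ d))) ⟩
      ν (3 ℕ.* w ℕ.^ d)  ≤⟨ ν-mono 3w≤Z ⟩
      ν Z                ≡⟨ sym (*-identityʳ (ν Z)) ⟩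
      ν Z * 1ℚ ∎)
      where
      open ≤-Reasoning
      e₁ : ν (Z ℕ.^ t) ^ k ≡ ν Z ^ (t ℕ.* k)
      e₁ = trans (cong (_^ k) (ν-^ Z t)) (^-assocʳ (ν Z) t k)
      e₂ : ν (c ℕ.* (c₁ ℕ.* Z ℕ.^ q)) ^ d ≡ ν (w ℕ.^ d) * ν Z ^ (q ℕ.* d)
      e₂ = trans (sym (ν-^ (c ℕ.* (c₁ ℕ.* Z ℕ.^ q)) d)) (trans (cong (λ s → ν (s ℕ.^ d)) cA)
        (trans (cong ν (^-split Z w q d)) (trans (ν-* (w ℕ.^ d) (Z ℕ.^ (q ℕ.* d))) (cong (ν (w ℕ.^ d) *_) (ν-^ Z (q ℕ.* d))))))
    Q≤ : (Z ℕ.^ t) ℕ.^ k′ ℕ.* (c ℕ.* (c₁ ℕ.* Z ℕ.^ q)) ℕ.^ suc d ℕ.+ c ℕ.≤ Z ℕ.^ suc (t ℕ.* k′ ℕ.+ q ℕ.* suc d)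
    Q≤ = begin
      (Z ℕ.^ t) ℕ.^ k′ ℕ.* (c ℕ.* (c₁ ℕ.* Z ℕ.^ q)) ℕ.^ suc d ℕ.+ c
        ≡⟨ cong₂ (λ r s → r ℕ.* s ℕ.+ c) (ℕP.^-*-assoc Z t k′) (trans (cong (ℕ._^ suc d) cA) (^-split Z w q (suc d))) ⟩
      Z ℕ.^ (t ℕ.* k′) ℕ.* (W ℕ.* Z ℕ.^ (q ℕ.* suc d)) ℕ.+ c
        ≡⟨ cong (ℕ._+ c) (trans (sym (ℕP.*-assoc (Z ℕ.^ (t ℕ.* k′)) W _)) (trans (cong (ℕ._* Z ℕ.^ (q ℕ.* suc d)) (ℕP.*-comm (Z ℕ.^ (t ℕ.* k′)) W))
             (trans (ℕP.*-assoc W (Z ℕ.^ (t ℕ.* k′)) _) (cong (W ℕ.*_) (sym (ℕP.^-distribˡ-+-* Z (t ℕ.* k′) (q ℕ.* suc d))))))) ⟩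
      W ℕ.* Y ℕ.+ c           ≤⟨ ℕP.+-monoʳ-≤ (W ℕ.* Y) (ℕP.m≤m*n c Y {{ℕ.>-nonZero (1≤Z^ (t ℕ.* k′ ℕ.+ q ℕ.* suc d))}}) ⟩
      W ℕ.* Y ℕ.+ c ℕ.* Y     ≡⟨ sym (ℕP.*-distribʳ-+ Y W c) ⟩
      (W ℕ.+ c) ℕ.* Y         ≤⟨ ℕP.*-monoˡ-≤ Y wc≤Z ⟩
      Z ℕ.* Y ∎
      where
      open ℕP.≤-Reasoning
      W = w ℕ.^ suc d
      Y = Z ℕ.^ (t ℕ.* k′ ℕ.+ q ℕ.* suc d)
    close′ : ∀ η → ν (Z ℕ.^ t) * η ≤ ν c → ν 2 * (ν Z ^ v * η) ≤ 1ℚ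
    close′ η h = *-cancelˡ-≤ (ν Z) 0<νZ (begin
      ν Z * (ν 2 * (ν Z ^ v * η))
        ≡⟨ solve 4 (λ z s p x → z :* (s :* (p :* x)) := s :* ((z :* p) :* x)) refl (ν Z) (ν 2) (ν Z ^ v) η ⟩
      ν 2 * (ν Z ^ t * η)      ≡⟨ cong (λ s → ν 2 * (s * η)) (sym (ν-^ Z t)) ⟩
      ν 2 * (ν (Z ℕ.^ t) * η)  ≤⟨ *-monoˡ (ν 2) (0≤ν 2) h ⟩
      ν 2 * ν c                ≡⟨ sym (ν-* 2 c) ⟩
      ν (2 ℕ.* c)              ≤⟨ ν-mono 2c≤Z ⟩
      ν Z                      ≡⟨ sym (*-identityʳ (ν Z)) ⟩
      ν Z * 1ℚ ∎)
      where open ≤-Reasoning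

-- Sequence-wise description of the real operations

seq-^ : ∀ x n i → seq (x Re.^ n) i ≡ seq x i ^ n
seq-^ x zero    i = refl
seq-^ x (suc n) i = cong (seq x i *_) (seq-^ x n i)

-- The scalar s makes the induction work: the tail of a sum of monomials carries a common factor x,
-- which Horner's form has already extracted.
seq-sum : ∀ {d} (g : Fin d → ℝ) (c : Fin d → ℤ) (s x : ℚ) i →
  (∀ j → seq (g j) i ≡ s * (ι (c j) * x ^ toℕ j)) → seq (Vector.foldr Re._+_ 0ℝ g) i ≡ s * ev c x
seq-sum {zero}  g c s x i h = sym (*-zeroʳ s)
seq-sum {suc d} g c s x i h = trans
  (cong₂ _+_ (h zero) (seq-sum (g ∘ suc) (c ∘ suc) (s * x) x i λ j → trans (h (suc j))
    (solve 4 (λ s x c p → s :* (c :* (x :* p)) := s :* x :* (c :* p)) refl s x (ι (c (suc j))) (x ^ toℕ j))))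
  (solve 4 (λ s x c e → s :* (c :* con 1ℚ) :+ s :* x :* e := s :* (c :+ x :* e)) refl s x (ι (c zero)) (ev (c ∘ suc) x))

seq-eval : ∀ {d} (c : Fin (suc d) → ℤ) ξ i → seq (eval c ξ) i ≡ ev c (seq ξ i)
seq-eval c ξ i = trans
  (seq-sum (λ j → fromℤ (c j) Re.* ξ Re.^ toℕ j) c 1ℚ (seq ξ i) i
    λ j → trans (cong₂ _*_ (sym (ι-/1 (c j))) (seq-^ ξ (toℕ j) i)) (sym (*-identityˡ _)))
  (*-identityˡ (ev c (seq ξ i)))

near⇒≤ : ∀ a b {η} → ∣ a - b ∣ ≤ η → a ≤ b + η
near⇒≤ a b {η} h = subst (_≤ b + η) (solve 2 (λ a b → b :+ (a :- b) := a) refl a b)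
  (+-monoʳ-≤ b (≤-trans (p≤∣p∣ (a - b)) h))

-- The rational terms at one late index N are compared with margin 2h, where ε = 4h and both
-- sequences oscillate by at most η = h/2 from N on. If the comparison fails, at least h of the
-- margin survives at all later indices, which proves y < x.
≮⇒≥ᵣ : ∀ {x y} → ¬ (y Re.< x) → x Re.≤ y
≮⇒≥ᵣ {x} {y} y≮x ε ε>0 = N , λ n N≤n → conclude n N≤n (seq x N ≤? seq y N + (h + h))
  where
  h = ½ * (½ * ε)
  η = ½ * h
  h>0 : 0ℚ < h
  h>0 = half-pos (half-pos ε>0)
  η>0 : 0ℚ < η
  η>0 = half-pos h>0
  cx = cauchy x η η>0
  cy = cauchy y η η>0
  N = proj₁ cx ℕ.⊔ proj₁ cy
  N₁≤ : ∀ {n} → N ℕ.≤ n → proj₁ cx ℕ.≤ n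
  N₁≤ = ≤⊔ˡ {proj₁ cx} {proj₁ cy}
  N₂≤ : ∀ {n} → N ℕ.≤ n → proj₁ cy ℕ.≤ n
  N₂≤ = ≤⊔ʳ {proj₁ cx} {proj₁ cy}
  open ≤-Reasoning
  conclude : ∀ n → N ℕ.≤ n → _ → seq x n ≤ seq y n + ε
  conclude n N≤n (yes le) = begin
    seq x n                        ≤⟨ near⇒≤ (seq x n) (seq x N) (proj₂ cx n N (N₁≤ N≤n) (N₁≤ ℕP.≤-refl)) ⟩
    seq x N + η                    ≤⟨ +-monoˡ-≤ η le ⟩
    seq y N + (h + h) + η          ≤⟨ +-monoˡ-≤ η (+-monoˡ-≤ (h + h) (near⇒≤ (seq y N) (seq y n) (proj₂ cy N n (N₂≤ ℕP.≤-refl) (N₂≤ N≤n)))) ⟩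
    seq y n + η + (h + h) + η      ≡⟨ solve 3 (λ y e h → y :+ e :+ (h :+ h) :+ e := y :+ ((e :+ e) :+ (h :+ h))) refl (seq y n) η h ⟩
    seq y n + ((η + η) + (h + h))  ≡⟨ cong (λ s → seq y n + (s + (h + h))) (halves h) ⟩
    seq y n + (h + (h + h))        ≤⟨ +-monoʳ-≤ (seq y n) (+-monoˡ-≤ (h + h) (subst (_≤ h + h) (+-identityˡ h) (+-monoˡ-≤ h (<⇒≤ h>0)))) ⟩
    seq y n + ((h + h) + (h + h))  ≡⟨ cong (_+_ (seq y n)) (trans (cong₂ _+_ (halves (½ * ε)) (halves (½ * ε))) (halves ε)) ⟩
    seq y n + ε ∎
  conclude n N≤n (no nle) = contradiction (h , h>0 , N , λ m N≤m → +-cancelʳ-η m N≤m) y≮x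
    where
    +-cancelʳ-η : ∀ m → N ℕ.≤ m → seq y m + h ≤ seq x m
    +-cancelʳ-η m N≤m = begin
      seq y m + h                ≤⟨ +-monoˡ-≤ h (near⇒≤ (seq y m) (seq y N) (proj₂ cy m N (N₂≤ N≤m) (N₂≤ ℕP.≤-refl))) ⟩
      seq y N + η + h            ≡⟨ cong (λ s → seq y N + η + s) (sym (halves h)) ⟩
      seq y N + η + (η + η)      ≡⟨ solve 2 (λ y e → y :+ e :+ (e :+ e) := y :+ ((e :+ e) :+ (e :+ e)) :- e) refl (seq y N) η ⟩
      seq y N + ((η + η) + (η + η)) - η  ≡⟨ cong (λ s → seq y N + (s + s) - η) (halves h) ⟩
      seq y N + (h + h) - η      ≤⟨ +-monoˡ-≤ (- η) (<⇒≤ (≰⇒> nle)) ⟩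
      seq x N - η                ≤⟨ +-monoˡ-≤ (- η) (near⇒≤ (seq x N) (seq x m) (proj₂ cx N m (N₁≤ ℕP.≤-refl) (N₁≤ N≤m))) ⟩
      seq x m + η - η            ≡⟨ solve 2 (λ x e → x :+ e :- e := x) refl (seq x m) η ⟩
      seq x m ∎

≤-ε : ∀ {p q ε} → 0ℚ < ε → p ≤ q → p ≤ q + ε
≤-ε {p} {q} {ε} ε>0 h = ≤-trans h (subst (_≤ q + ε) (+-identityʳ q) (+-monoʳ-≤ q (<⇒≤ ε>0)))

ι+1≤ν : ∀ z → ι z + 1ℚ ≤ ν (suc ℤ.∣ z ∣)
ι+1≤ν z = begin
  ι z + 1ℚ            ≤⟨ +-monoˡ-≤ 1ℚ (p≤∣p∣ (ι z)) ⟩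
  ∣ ι z ∣ + 1ℚ        ≡⟨ cong (_+ 1ℚ) (ι-∣∣ z) ⟩
  ν ℤ.∣ z ∣ + 1ℚ      ≡⟨ +-comm (ν ℤ.∣ z ∣) 1ℚ ⟩
  1ℚ + ν ℤ.∣ z ∣      ≡⟨ cong (_+ ν ℤ.∣ z ∣) (sym ι-1) ⟩
  ν 1 + ν ℤ.∣ z ∣     ≡⟨ sym (ν-+ 1 ℤ.∣ z ∣) ⟩
  ν (suc ℤ.∣ z ∣) ∎
  where open ≤-Reasoning

archimedean : ∀ q → ∃[ n ] q ≤ ν n
archimedean q = suc ℤ.∣ floor q ∣ , ≤-trans (floor-upper q) (ι+1≤ν (floor q))

bounded : ∀ x → ∃[ B ] (1 ℕ.≤ B) × ∃[ N ] (∀ n → N ℕ.≤ n → ∣ seq x n ∣ ≤ ν B)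
bounded x = round-up (eventually-bounded (seq x) (cauchy x))
  where
  round-up : ∃[ B ] (0ℚ < B) × ∃[ N ] (∀ n → N ℕ.≤ n → ∣ seq x n ∣ ≤ B) →
    ∃[ B ] (1 ℕ.≤ B) × ∃[ N ] (∀ n → N ℕ.≤ n → ∣ seq x n ∣ ≤ ν B)
  round-up (B , _ , N , h) = suc (proj₁ (archimedean B)) , ℕ.s≤s ℕ.z≤n , N , λ n N≤n →
    ≤-trans (h n N≤n) (≤-trans (proj₂ (archimedean B)) (ν-mono (ℕP.n≤1+n _)))

-- Integral powers of an integer base as real powers.

module ZPow (Z : ℕ) (2≤Z : 2 ℕ.≤ Z) where

  0<Z : 0ℚ < ν Z
  0<Z = 0<ν (ℕP.<⇒≤ 2≤Z)

  1≤Z : 1ℚ ≤ ν Z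
  1≤Z = 1≤ν (ℕP.<⇒≤ 2≤Z)

  j : ℚ
  j = inv-pos (ν Z) 0<Z

  0<j : 0ℚ < j
  0<j = inv-pos>0 (ν Z) 0<Z

  Zj : ν Z * j ≡ 1ℚ
  Zj = inv-posʳ (ν Z) 0<Z

  Z^j^ : ∀ m → ν Z ^ m * j ^ m ≡ 1ℚ
  Z^j^ m = trans (sym (^-distrib-* (ν Z) j m)) (trans (cong (_^ m) Zj) (1^ m))

  j≤1 : j ≤ 1ℚ
  j≤1 = subst₂ _≤_ (*-identityˡ j) Zj (*-monoʳ j (<⇒≤ 0<j) 1≤Z)

  j^-anti : ∀ {m n} → m ℕ.≤ n → j ^ n ≤ j ^ m
  j^-anti {m} {n} m≤n = subst₂ _≤_
    (trans (sym (^-homo-* j m (n ℕ.∸ m))) (cong (j ^_) (ℕP.m+[n∸m]≡n m≤n))) (*-identityʳ (j ^ m))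
    (*-monoˡ (j ^ m) (0≤^ m (<⇒≤ 0<j)) (^≤1 (n ℕ.∸ m) (<⇒≤ 0<j) j≤1))

  zp : ℤ → ℚ
  zp (+ n)    = ν Z ^ n
  zp -[1+ n ] = j ^ suc n

  0<zp : ∀ e → 0ℚ < zp e
  0<zp (+ n)    = 0<^ n 0<Z
  0<zp -[1+ n ] = 0<^ (suc n) 0<j

  zp-neg : ∀ v → zp (ℤ.- (+ v)) ≡ j ^ v
  zp-neg zero    = refl
  zp-neg (suc v) = refl

  zp-mono : ∀ {e f} → e ℤ.≤ f → zp e ≤ zp f
  zp-mono (ℤ.-≤- n≤m)     = j^-anti (ℕ.s≤s n≤m)
  zp-mono (ℤ.-≤+ {m} {n}) = ≤-trans (^≤1 (suc m) (<⇒≤ 0<j) j≤1) (1≤^ n 1≤Z)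
  zp-mono (ℤ.+≤+ m≤n)     = ^-monoʳ-≤ 1≤Z m≤n

  zp-^ : ∀ e m → zp e ^ m ≡ zp (e ℤ.* + m)
  zp-^ (+ n)    m       = trans (^-assocʳ (ν Z) n m) (cong zp (ℤP.pos-* n m))
  zp-^ -[1+ n ] zero    = cong zp (sym (ℤP.*-zeroʳ -[1+ n ]))
  zp-^ -[1+ n ] (suc m) = ^-assocʳ j (suc n) (suc m)

  module _ (u : ℕ) (1≤u : 1 ℕ.≤ u) (X : ℝ) (seq-X : ∀ i → seq X i ≡ ν (Z ℕ.^ u)) where

    Z≤Z^u : Z ℕ.≤ Z ℕ.^ u
    Z≤Z^u = subst (ℕ._≤ Z ℕ.^ u) (ℕP.*-identityʳ Z) (ℕP.^-monoʳ-≤ Z {{ℕ.>-nonZero (ℕP.<⇒≤ 2≤Z)}} {1} {u} 1≤u)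

    X>1 : 1ℝ Re.< X
    X>1 = 1ℚ , 0<1 , 0 , λ i _ → subst (1ℚ + 1ℚ ≤_) (sym (seq-X i))
      (subst (_≤ ν (Z ℕ.^ u)) (trans (ν-+ 1 1) (cong₂ _+_ ι-1 ι-1)) (ν-mono (ℕP.≤-trans 2≤Z Z≤Z^u)))

    X>0 : 0ℝ Re.< X
    X>0 = 1<⇒0< {X} X>1

    inverse-unique : ∀ {a r s} → a * r ≡ 1ℚ → a * s ≡ 1ℚ → r ≡ s
    inverse-unique {a} {r} {s} ar as = begin
      r            ≡⟨ sym (*-identityʳ r) ⟩
      r * 1ℚ       ≡⟨ cong (r *_) (sym as) ⟩
      r * (a * s)  ≡⟨ solve 3 (λ r a s → r :* (a :* s) := a :* r :* s) refl r a s ⟩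
      a * r * s    ≡⟨ trans (cong (_* s) ar) (*-identityˡ s) ⟩
      s ∎
      where open ≡-Reasoning

    seq-recip : ∀ i → seq (recip X X>0) i ≡ j ^ u
    seq-recip i = inverse-unique {ν (Z ℕ.^ u)}
      (trans (cong (_* seq (recip X X>0) i) (sym (trans (p≥q⇒p⊔q≡p 1≤X) (seq-X i))))
        (inv-posʳ (seq X i ⊔ 1ℚ) (<-≤-trans 0<1 (p≤q⊔p (seq X i) 1ℚ))))
      (trans (cong (_* j ^ u) (ν-^ Z u)) (Z^j^ u))
      where
      1≤X : 1ℚ ≤ seq X i
      1≤X = subst (1ℚ ≤_) (sym (seq-X i)) (1≤ν (ℕP.≤-trans (ℕP.<⇒≤ 2≤Z) Z≤Z^u))

    seq-zpow : ∀ e i → seq (zpow X X>0 e) i ≡ zp (e ℤ.* + u)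
    seq-zpow (+ n) i = begin
      seq (X Re.^ n) i      ≡⟨ seq-^ X n i ⟩
      seq X i ^ n           ≡⟨ cong (_^ n) (trans (seq-X i) (ν-^ Z u)) ⟩
      (ν Z ^ u) ^ n         ≡⟨ trans (^-assocʳ (ν Z) u n) (cong (ν Z ^_) (ℕP.*-comm u n)) ⟩
      ν Z ^ (n ℕ.* u)       ≡⟨ cong zp (ℤP.pos-* n u) ⟩
      zp (+ n ℤ.* + u) ∎
      where open ≡-Reasoning
    seq-zpow -[1+ n ] i = begin
      seq (recip X X>0 Re.^ suc n) i  ≡⟨ seq-^ (recip X X>0) (suc n) i ⟩
      seq (recip X X>0) i ^ suc n     ≡⟨ cong (_^ suc n) (seq-recip i) ⟩
      (j ^ u) ^ suc n                 ≡⟨ trans (^-assocʳ j u (suc n)) (trans (cong (j ^_) (ℕP.*-comm u (suc n))) (sym (^-assocʳ j (suc n) u))) ⟩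
      (j ^ suc n) ^ u                 ≡⟨ zp-^ -[1+ n ] u ⟩
      zp (-[1+ n ] ℤ.* + u) ∎
      where open ≡-Reasoning

    -- Since X = Z^u, the power X^(w/u) is Z^w. Multiplied by u and the denominator of r, a
    -- comparison of r with w/u becomes one of integer exponents of Z.
    isPower : ∀ w (a : ℝ) α → (∀ i → seq a i ≡ α) → α * ν u ≡ ι w → IsPower X a (fromℚ (zp w))
    isPower w a α a≡α αu = record
      { base>1 = X>1
      ; pos    = zp w , 0<zp w , 0 , λ _ _ → ≤-reflexive (+-identityˡ (zp w))
      ; below  = λ { r (ε , ε>0 , N , h) η η>0 → 0 , λ i _ → ≤-ε η>0
          (subst₂ _≤_ (sym (seq-zpow (↥ r) i)) (sym (seq-B r i)) (zp-mono (ι-cancel-≤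
            (subst₂ _≤_ (scale-r r) (scale-α r) (*-monoʳ (ι (↧ r) * ν u) (*-nonNeg (0≤ν (↧ₙ r)) (0≤ν u))
              (subst (r ≤_) (a≡α N) (≤-trans (≤-ε ε>0 ≤-refl) (h N ℕP.≤-refl)))))))) }
      ; above  = λ { r (ε , ε>0 , N , h) η η>0 → 0 , λ i _ → ≤-ε η>0
          (subst₂ _≤_ (sym (seq-B r i)) (sym (seq-zpow (↥ r) i)) (zp-mono (ι-cancel-≤
            (subst₂ _≤_ (scale-α r) (scale-r r) (*-monoʳ (ι (↧ r) * ν u) (*-nonNeg (0≤ν (↧ₙ r)) (0≤ν u))
              (subst (_≤ r) (a≡α N) (≤-trans (≤-ε ε>0 ≤-refl) (h N ℕP.≤-refl)))))))) }
      }
      where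
      seq-B : ∀ r i → seq (fromℚ (zp w) Re.^ ↧ₙ r) i ≡ zp (w ℤ.* ↧ r)
      seq-B r i = trans (seq-^ (fromℚ (zp w)) (↧ₙ r) i) (zp-^ w (↧ₙ r))
      scale-r : ∀ r → r * (ι (↧ r) * ν u) ≡ ι (↥ r ℤ.* + u)
      scale-r r = trans (sym (*-assoc r (ι (↧ r)) (ν u))) (trans (cong (_* ν u) (*-↧ r)) (sym (ι-* (↥ r) (+ u))))
      scale-α : ∀ r → α * (ι (↧ r) * ν u) ≡ ι (w ℤ.* ↧ r)
      scale-α r = trans (solve 3 (λ a d u → a :* (d :* u) := a :* u :* d) refl α (ι (↧ r)) (ν u))
        (trans (cong (_* ι (↧ r)) αu) (sym (ι-* w (↧ r))))

-- Admissible exponents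

seq-fromℕ : ∀ n i → seq (fromℕ′ n) i ≡ ν n
seq-fromℕ n i = sym (ι-/1 (+ n))

-- A solution for the exponent v/u in integral form: with X = Z^u the bound X^(-v/u) is Z^(-v), here
-- multiplied out.
IntegerSolution : ℕ → ℝ → ℕ → ℕ → ℕ → Set
IntegerSolution n ξ u v Z = Σ[ x ∈ (ℕ → ℤ) ] (x 0 ≢ 0ℤ) × (ℤ.∣ x 0 ∣ ℕ.≤ Z ℕ.^ u) ×
  ∃[ N ] (∀ m → m ℕ.≤ n → ∀ i → N ℕ.≤ i → ν Z ^ v * ∣ ι (x 0) * seq ξ i ^ m - ι (x m) ∣ ≤ 1ℚ)

λ-admissible : ∀ n ξ u v → 1 ℕ.≤ u → ∀ l → l * ν u ≡ ν v →
  (∀ Z₀ → ∃[ Z ] (Z₀ ℕ.≤ Z) × IntegerSolution n ξ u v Z) →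
  λ-Admissible n ξ (fromℚ l)
λ-admissible n ξ u v 1≤u l lu≡v solutions Y =
  let B , _ , N , Y≤B = bounded Y
      Z , 2+B≤Z , s = solutions (2 ℕ.+ B)
  in construct B N Y≤B Z 2+B≤Z s
  where
  construct : ∀ B N → (∀ n → N ℕ.≤ n → ∣ seq Y n ∣ ≤ ν B) → ∀ Z → 2 ℕ.+ B ℕ.≤ Z → IntegerSolution n ξ u v Z →
    ∃[ X ] (Y Re.< X × Σ[ B ∈ ℝ ] IsPower X (Re.- fromℚ l) B × Σ[ x ∈ (Fin (suc n) → ℤ) ] (0 ℕ.< ℤ.∣ x zero ∣) ×
      (fromℕ′ ℤ.∣ x zero ∣ Re.≤ X) ×
      (∀ (m : Fin n) → Re.∣ fromℤ (x zero) Re.* ξ Re.^ toℕ (suc m) Re.- fromℤ (x (suc m)) ∣ Re.≤ B))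
  construct B N Y≤B Z 2+B≤Z (x , x₀≢0 , x₀≤ , M , close) =
      X , (1ℚ , 0<1 , N , Y<X)
    , fromℚ (zp (ℤ.- (+ v))) , isPower u 1≤u X seq-X (ℤ.- (+ v)) (Re.- fromℚ l) (- l) (λ _ → refl) exponent
    , x ∘ toℕ , ℕP.n≢0⇒n>0 (λ z → x₀≢0 (ℤP.∣i∣≡0⇒i≡0 z))
    , (λ ε ε>0 → 0 , λ i _ → ≤-ε ε>0 (subst₂ _≤_ (sym (seq-fromℕ ℤ.∣ x 0 ∣ i)) (sym (seq-X i)) (ν-mono x₀≤)))
    , λ m ε ε>0 → M , λ i M≤i → ≤-ε ε>0 (subst₂ _≤_ (sym (seq-error m i)) (sym (zp-neg v))
        (≤j^ (∣ ι (x 0) * seq ξ i ^ toℕ (suc m) - ι (x (toℕ (suc m))) ∣)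
          (close (toℕ (suc m)) (FinP.toℕ<n m) i M≤i)))
    where
    open ZPow Z (ℕP.≤-trans (ℕP.m≤m+n 2 B) 2+B≤Z)
    X : ℝ
    X = fromℕ′ (Z ℕ.^ u)
    seq-X : ∀ i → seq X i ≡ ν (Z ℕ.^ u)
    seq-X = seq-fromℕ (Z ℕ.^ u)
    Y<X : ∀ i → N ℕ.≤ i → seq Y i + 1ℚ ≤ seq X i
    Y<X i N≤i = begin
      seq Y i + 1ℚ    ≤⟨ +-monoˡ-≤ 1ℚ (≤-trans (p≤∣p∣ (seq Y i)) (Y≤B i N≤i)) ⟩
      ν B + 1ℚ        ≤⟨ ι+1≤ν (+ B) ⟩
      ν (suc B)       ≤⟨ ν-mono (ℕP.≤-trans (ℕP.n≤1+n (suc B)) (ℕP.≤-trans 2+B≤Z (Z≤Z^u u 1≤u X seq-X))) ⟩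
      ν (Z ℕ.^ u)     ≡⟨ sym (seq-X i) ⟩
      seq X i ∎
      where open ≤-Reasoning
    exponent : - l * ν u ≡ ι (ℤ.- (+ v))
    exponent = trans (sym (neg-distribˡ-* l (ν u))) (trans (cong -_ lu≡v) (sym (ι-neg (+ v))))
    seq-error : ∀ m i → seq (Re.∣ fromℤ (x 0) Re.* ξ Re.^ toℕ (suc m) Re.- fromℤ (x (toℕ (suc m))) ∣) i
      ≡ ∣ ι (x 0) * seq ξ i ^ toℕ (suc {n} m) - ι (x (toℕ (suc m))) ∣
    seq-error m i = cong₂ (λ s t → ∣ s - t ∣) (cong₂ _*_ (sym (ι-/1 (x 0))) (seq-^ ξ (toℕ (suc m)) i)) (sym (ι-/1 (x (toℕ (suc m)))))
    ≤j^ : ∀ η → ν Z ^ v * η ≤ 1ℚ → η ≤ j ^ v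
    ≤j^ η h = subst₂ _≤_
      (trans (sym (*-assoc (j ^ v) (ν Z ^ v) η)) (trans (cong (_* η) (trans (*-comm (j ^ v) (ν Z ^ v)) (Z^j^ v))) (*-identityˡ η)))
      (*-identityʳ (j ^ v)) (*-monoˡ (j ^ v) (0≤^ v (<⇒≤ 0<j)) h)

common-modulus : ∀ ξ n δ → 0ℚ < δ →
  ∃[ N ] (∀ m → m ℕ.≤ n → ∀ i j → N ℕ.≤ i → N ℕ.≤ j → ∣ seq ξ i ^ m - seq ξ j ^ m ∣ ≤ δ)
common-modulus ξ zero δ δ>0 = 0 , λ { zero ℕ.z≤n i j _ _ → <⇒≤ δ>0 }
common-modulus ξ (suc n) δ δ>0 = combine (common-modulus ξ n δ δ>0) (cauchy (ξ Re.^ suc n) δ δ>0)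
  where
  combine : ∃[ N ] (∀ m → m ℕ.≤ n → ∀ i j → N ℕ.≤ i → N ℕ.≤ j → ∣ seq ξ i ^ m - seq ξ j ^ m ∣ ≤ δ) →
    ∃[ N ] (∀ i j → N ℕ.≤ i → N ℕ.≤ j → ∣ seq (ξ Re.^ suc n) i - seq (ξ Re.^ suc n) j ∣ ≤ δ) →
    ∃[ N ] (∀ m → m ℕ.≤ suc n → ∀ i j → N ℕ.≤ i → N ℕ.≤ j → ∣ seq ξ i ^ m - seq ξ j ^ m ∣ ≤ δ)
  combine (N₁ , h₁) (N₂ , h₂) = N₁ ℕ.⊔ N₂ , λ m m≤ i j i≥ j≥ → split m i j i≥ j≥ (ℕP.m≤n⇒m<n∨m≡n m≤)
    where
    split : ∀ m i j → N₁ ℕ.⊔ N₂ ℕ.≤ i → N₁ ℕ.⊔ N₂ ℕ.≤ j → m ℕ.< suc n ⊎ m ≡ suc n → ∣ seq ξ i ^ m - seq ξ j ^ m ∣ ≤ δ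
    split m i j i≥ j≥ (inj₁ m<) = h₁ m (ℕP.≤-pred m<) i j (≤⊔ˡ {N₁} {N₂} i≥) (≤⊔ˡ {N₁} {N₂} j≥)
    split m i j i≥ j≥ (inj₂ refl) = subst₂ (λ s t → ∣ s - t ∣ ≤ δ) (seq-^ ξ (suc n) i) (seq-^ ξ (suc n) j)
      (h₂ i j (≤⊔ʳ {N₁} {N₂} i≥) (≤⊔ʳ {N₁} {N₂} j≥))

-- The powers of ξ are rounded with x₀ = 1. This makes every upper bound of the admissible exponents
-- nonnegative, as the later work with natural numerators requires.
0-λ-admissible : ∀ n ξ → λ-Admissible n ξ (fromℚ 0ℚ)
0-λ-admissible n ξ = λ-admissible n ξ 1 0 ℕP.≤-refl 0ℚ (trans (*-zeroˡ (ν 1)) (sym ι-0)) solution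
  where
  -- The admissible error X⁰ = 1 is split: ½ for rounding the term at N and ½ for the later
  -- variation of the sequence.
  modulus = common-modulus ξ n ½ (positive⁻¹ ½)
  N = proj₁ modulus
  x : ℕ → ℤ
  x zero    = + 1
  x (suc m) = floor (seq ξ N ^ suc m + ½)
  rounding : ∀ p z → ι z ≤ p + ½ → p + ½ ≤ ι z + 1ℚ → ∣ p - ι z ∣ ≤ ½
  rounding p z lower upper = ∣∣≤
    (subst₂ _≤_ (solve 3 (λ p h z → p :+ h :- h :- z := p :- z) refl p ½ (ι z))
      (solve 1 (λ z → z :+ con 1ℚ :- con ½ :- z := con ½) refl (ι z)) (+-monoˡ-≤ (- ι z) (+-monoˡ-≤ (- ½) upper)))
    (subst₂ _≤_ (solve 2 (λ p z → z :- p := :- (p :- z)) refl p (ι z))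
      (solve 2 (λ p h → p :+ h :- p := h) refl p ½) (+-monoˡ-≤ (- p) lower))
  close : ∀ m → m ℕ.≤ n → ∀ i → N ℕ.≤ i → ∣ seq ξ i ^ m - ι (x m) ∣ ≤ 1ℚ
  close zero    m≤ i N≤i = subst (λ s → ∣ 1ℚ - s ∣ ≤ 1ℚ) (sym ι-1) 0≤1
  close (suc m) m≤ i N≤i = ≤-trans (∣∣-triangle (seq ξ i ^ suc m) (seq ξ N ^ suc m) (ι (x (suc m))))
    (+-mono-≤ (proj₂ modulus (suc m) m≤ i N N≤i ℕP.≤-refl)
      (rounding (seq ξ N ^ suc m) (x (suc m)) (floor-lower (seq ξ N ^ suc m + ½)) (floor-upper (seq ξ N ^ suc m + ½))))
  solution : ∀ Z₀ → ∃[ Z ] (Z₀ ℕ.≤ Z) × IntegerSolution n ξ 1 0 Z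
  solution Z₀ = suc Z₀ , ℕP.n≤1+n Z₀ , x , (λ ()) , ℕ.s≤s ℕ.z≤n , N , λ m m≤ i N≤i →
    subst (_≤ 1ℚ) (sym (trans (*-identityˡ _) (cong (λ s → ∣ s - ι (x m) ∣) (trans (cong (_* seq ξ i ^ m) ι-1) (*-identityˡ (seq ξ i ^ m))))))
      (close m m≤ i N≤i)

monomial : ∀ {k} → Fin (suc k) → ℤ
monomial {zero}  zero    = + 1
monomial {suc k} zero    = 0ℤ
monomial {suc k} (suc j) = monomial j

ev-monomial : ∀ k x → ev (monomial {k}) x ≡ x ^ k
ev-monomial zero    x = trans (cong₂ _+_ ι-1 (*-zeroʳ x)) (+-identityʳ 1ℚ)
ev-monomial (suc k) x = trans (cong₂ _+_ ι-0 (cong (x *_) (ev-monomial k x))) (+-identityˡ (x * x ^ k))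

∣monomial∣≤1 : ∀ {k} (j : Fin (suc k)) → ℤ.∣ monomial j ∣ ℕ.≤ 1
∣monomial∣≤1 {zero}  zero    = ℕP.≤-refl
∣monomial∣≤1 {suc k} zero    = ℕ.z≤n
∣monomial∣≤1 {suc k} (suc j) = ∣monomial∣≤1 j

monomial-top : ∀ k → ℤ.∣ monomial (Fin.fromℕ k) ∣ ≡ 1
monomial-top zero    = refl
monomial-top (suc k) = monomial-top k

-- The polynomial Xᵏ ± 1, with the sign chosen so that its value at ξ stays away from 0.
-1-wˡᵉᵃᵈ-admissible : ∀ k′ ξ → wˡᵉᵃᵈ-Admissible (suc k′) ξ (fromℚ (- 1ℚ))
-1-wˡᵉᵃᵈ-admissible k′ ξ Y = construct (choose (≤-total 0ℚ (seq (ξ Re.^ k) N)))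
  where
  k = suc k′
  modulus = cauchy (ξ Re.^ k) ½ (positive⁻¹ ½)
  N = proj₁ modulus
  Goal = ∃[ X ] (Y Re.< X × ∃[ x ] (w-Solution k ξ (fromℚ (- 1ℚ)) X x × (∀ j → ℤ.∣ x j ∣ ℕ.≤ ℤ.∣ x (Fin.fromℕ k) ∣)))
  poly : ℤ → Fin (suc k) → ℤ
  poly σ zero    = σ
  poly σ (suc j) = monomial j
  ev-poly : ∀ σ i → ev (poly σ) (seq ξ i) ≡ ι σ + seq (ξ Re.^ k) i
  ev-poly σ i = cong (_+_ (ι σ)) (trans (cong (seq ξ i *_) (ev-monomial k′ (seq ξ i))) (sym (seq-^ ξ k i)))
  Choice = ∃[ σ ] (ℤ.∣ σ ∣ ≡ 1) × (∀ i → N ℕ.≤ i → ½ ≤ ∣ ι σ + seq (ξ Re.^ k) i ∣)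
  choose : 0ℚ ≤ seq (ξ Re.^ k) N ⊎ seq (ξ Re.^ k) N ≤ 0ℚ → Choice
  choose (inj₁ 0≤s) = + 1 , refl , λ i N≤i → positive-case (seq (ξ Re.^ k) N) (seq (ξ Re.^ k) i) 0≤s (proj₂ modulus N i ℕP.≤-refl N≤i)
    where
    positive-case : ∀ s t → 0ℚ ≤ s → ∣ s - t ∣ ≤ ½ → ½ ≤ ∣ ν 1 + t ∣
    positive-case s t 0≤s near = ≤-trans
      (subst₂ _≤_ (solve 0 (con 0ℚ :+ con ½ := con ½) refl)
        (trans (solve 1 (λ t → t :+ con ½ :+ con ½ := con 1ℚ :+ t) refl t) (cong (_+ t) (sym ι-1)))
        (+-monoˡ-≤ ½ (≤-trans 0≤s (near⇒≤ s t near))))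
      (p≤∣p∣ (ν 1 + t))
  choose (inj₂ s≤0) = ℤ.- (+ 1) , refl , λ i N≤i → negative-case (seq (ξ Re.^ k) N) (seq (ξ Re.^ k) i) s≤0 (proj₂ modulus i N N≤i ℕP.≤-refl)
    where
    negative-case : ∀ s t → s ≤ 0ℚ → ∣ t - s ∣ ≤ ½ → ½ ≤ ∣ ι (ℤ.- (+ 1)) + t ∣
    negative-case s t s≤0 near = ≤-trans
      (subst₂ _≤_ (solve 1 (λ t → con ½ :+ (t :- t) := con ½) refl t)
        (trans (solve 1 (λ t → con ½ :+ ((con 0ℚ :+ con ½) :- t) := :- (:- con 1ℚ :+ t)) refl t)
          (cong (λ u → - (u + t)) (sym (trans (ι-neg (+ 1)) (cong -_ ι-1)))))
        (+-monoʳ-≤ ½ (+-monoˡ-≤ (- t) (≤-trans (near⇒≤ t s near) (+-monoˡ-≤ ½ s≤0)))))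
      (≤-trans (p≤∣p∣ (- (ι (ℤ.- (+ 1)) + t))) (≤-reflexive (∣-p∣≡∣p∣ (ι (ℤ.- (+ 1)) + t))))
  construct : Choice → Goal
  construct (σ , ∣σ∣≡1 , away) = finish (bounded Y) (bounded (eval (poly σ) ξ))
    where
    ∣poly∣≤1 : ∀ j → ℤ.∣ poly σ j ∣ ℕ.≤ 1
    ∣poly∣≤1 zero    = ℕP.≤-reflexive ∣σ∣≡1
    ∣poly∣≤1 (suc j) = ∣monomial∣≤1 j
    finish : ∃[ B ] (1 ℕ.≤ B) × ∃[ M ] (∀ n → M ℕ.≤ n → ∣ seq Y n ∣ ≤ ν B) →
      ∃[ B ] (1 ℕ.≤ B) × ∃[ M ] (∀ n → M ℕ.≤ n → ∣ seq (eval (poly σ) ξ) n ∣ ≤ ν B) → Goal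
    finish (B , _ , M , Y≤B) (B′ , _ , M′ , e≤B′) =
        X , (1ℚ , 0<1 , M , Y<X) , poly σ
      , (fromℚ (zp (+ 1)) , isPower 1 ℕP.≤-refl X seq-X (+ 1) (Re.- fromℚ (- 1ℚ)) 1ℚ (λ _ → refl) (*-identityˡ (ν 1))
        , (½ , positive⁻¹ ½ , N , λ i N≤i → subst₂ _≤_ (sym (+-identityˡ ½))
            (cong ∣_∣ (sym (trans (seq-eval (poly σ) ξ i) (ev-poly σ i)))) (away i N≤i))
        , (λ ε ε>0 → M′ , λ i M′≤i → ≤-ε ε>0 (≤-trans (e≤B′ i M′≤i)
            (≤-trans (ν-mono (ℕP.≤-trans (ℕP.m≤n+m B′ B) (ℕP.m≤n+m (B ℕ.+ B′) 2))) (≤-reflexive (sym (*-identityʳ (ν Z)))))))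
        , λ j ε ε>0 → 0 , λ i _ → ≤-ε ε>0 (subst₂ _≤_ (sym (seq-fromℕ ℤ.∣ poly σ j ∣ i)) (sym (seq-X i))
            (ν-mono (ℕP.≤-trans (∣poly∣≤1 j) (ℕ.s≤s ℕ.z≤n)))))
      , λ j → subst (ℤ.∣ poly σ j ∣ ℕ.≤_) (sym (monomial-top k′)) (∣poly∣≤1 j)
      where
      -- At w = -1 the bound X^(-w) is X itself, so a single Z can serve for Y and for the value of
      -- the polynomial.
      Z = 2 ℕ.+ (B ℕ.+ B′)
      open ZPow Z (ℕP.m≤m+n 2 (B ℕ.+ B′))
      X : ℝ
      X = fromℕ′ (Z ℕ.^ 1)
      seq-X : ∀ i → seq X i ≡ ν (Z ℕ.^ 1)
      seq-X = seq-fromℕ (Z ℕ.^ 1)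
      Y<X : ∀ i → M ℕ.≤ i → seq Y i + 1ℚ ≤ seq X i
      Y<X i M≤i = begin
        seq Y i + 1ℚ    ≤⟨ +-monoˡ-≤ 1ℚ (≤-trans (p≤∣p∣ (seq Y i)) (Y≤B i M≤i)) ⟩
        ν B + 1ℚ        ≤⟨ ι+1≤ν (+ B) ⟩
        ν (suc B)       ≤⟨ ν-mono (ℕP.≤-trans (ℕ.s≤s (ℕP.≤-trans (ℕP.m≤m+n B B′) (ℕP.n≤1+n _))) (Z≤Z^u 1 ℕP.≤-refl X seq-X)) ⟩
        ν (Z ℕ.^ 1)     ≡⟨ sym (seq-X i) ⟩
        seq X i ∎
        where open ≤-Reasoning

-- From real solutions to integer polynomials measured by powers of Z.

recip-bound : ∀ X (X>0 : 0ℝ Re.< X) i {c} → c ≤ seq X i → c * seq (recip X X>0) i ≤ 1ℚ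
recip-bound X (δ , δ>0 , _) i {c} c≤X = ≤-trans
  (*-monoʳ (inv-pos (seq X i ⊔ δ) r>0) (<⇒≤ (inv-pos>0 (seq X i ⊔ δ) r>0)) (≤-trans c≤X (p≤p⊔q (seq X i) δ)))
  (≤-reflexive (inv-posʳ (seq X i ⊔ δ) r>0))
  where
  r>0 : 0ℚ < seq X i ⊔ δ
  r>0 = <-≤-trans δ>0 (p≤q⊔p (seq X i) δ)

0≤recip : ∀ X (X>0 : 0ℝ Re.< X) i → 0ℚ ≤ seq (recip X X>0) i
0≤recip X (δ , δ>0 , _) i = <⇒≤ (inv-pos>0 (seq X i ⊔ δ) (<-≤-trans δ>0 (p≤q⊔p (seq X i) δ)))

-- Z is the integer part of the q-th root of p, found by descending from a bound; this is where the
-- real X gives way to an integral power.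
integer-root : ∀ q p → 1 ℕ.≤ q → 0ℚ ≤ p → ∃[ Z ] (ν (Z ℕ.^ q) ≤ p) × (p < ν (suc Z ℕ.^ q))
integer-root q p 1≤q 0≤p = search M (≤-<-trans (proj₂ (archimedean p)) (<-≤-trans M<M+1 (ν-mono M+1≤)))
  where
  M = proj₁ (archimedean p)
  M<M+1 : ν M < ν (suc M)
  M<M+1 = ≰⇒> λ h → ℕP.1+n≰n (ν-cancel h)
  M+1≤ : suc M ℕ.≤ suc M ℕ.^ q
  M+1≤ = subst (ℕ._≤ suc M ℕ.^ q) (ℕP.*-identityʳ (suc M)) (ℕP.^-monoʳ-≤ (suc M) 1≤q)
  search : ∀ M → p < ν (suc M ℕ.^ q) → ∃[ Z ] (ν (Z ℕ.^ q) ≤ p) × (p < ν (suc Z ℕ.^ q))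
  search zero h = 0 , subst (λ s → ν s ≤ p) (sym (0^q 1≤q)) (subst (_≤ p) (sym ι-0) 0≤p) , h
    where
    0^q : ∀ {q} → 1 ℕ.≤ q → 0 ℕ.^ q ≡ 0
    0^q (ℕ.s≤s _) = refl
  search (suc M) h with ν (suc M ℕ.^ q) ≤? p
  ... | yes le = suc M , le , h
  ... | no nle = search M (≰⇒> nle)

module _ (Z : ℕ) (2≤Z : 2 ℕ.≤ Z) where
  open ZPow Z 2≤Z

  -- Here y stands for 1/X with Z^(bs) ≤ X. The cut B^b ≤ X^(-a) yields (Z^(as)·B)^b ≤ 1 + 1 ≤ 2^b,
  -- and the b-th root is removed by monotonicity. The power of j is the tolerance of the real
  -- inequality, taken as small as the main term and contributing the second 1.
  power-bound : ∀ a b′ s y B → 0ℚ ≤ y → ν Z ^ (suc b′ ℕ.* s) * y ≤ 1ℚ →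
    B ^ suc b′ ≤ y ^ a + j ^ (a ℕ.* s ℕ.* suc b′) → ν Z ^ (a ℕ.* s) * B ≤ ν 2
  power-bound a b′ s y B 0≤y Zy≤1 h = ^-cancel-≤ b′ (0≤ν 2) (begin
    (ν Z ^ (a ℕ.* s) * B) ^ b
      ≡⟨ trans (^-distrib-* (ν Z ^ (a ℕ.* s)) B b) (cong (_* B ^ b) (^-assocʳ (ν Z) (a ℕ.* s) b)) ⟩
    ν Z ^ e * B ^ b
      ≤⟨ *-monoˡ (ν Z ^ e) (0≤^ e (<⇒≤ 0<Z)) h ⟩
    ν Z ^ e * (y ^ a + j ^ e)
      ≡⟨ *-distribˡ-+ (ν Z ^ e) (y ^ a) (j ^ e) ⟩
    ν Z ^ e * y ^ a + ν Z ^ e * j ^ e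
      ≡⟨ cong₂ _+_ (trans (cong (λ m → ν Z ^ m * y ^ a) exponents)
           (trans (cong (_* y ^ a) (sym (^-assocʳ (ν Z) (b ℕ.* s) a))) (sym (^-distrib-* (ν Z ^ (b ℕ.* s)) y a)))) (Z^j^ e) ⟩
    (ν Z ^ (b ℕ.* s) * y) ^ a + 1ℚ
      ≤⟨ +-monoˡ-≤ 1ℚ (^≤1 a (*-nonNeg (0≤^ (b ℕ.* s) (<⇒≤ 0<Z)) 0≤y) Zy≤1) ⟩
    1ℚ + 1ℚ          ≡⟨ sym (trans (ν-+ 1 1) (cong₂ _+_ ι-1 ι-1)) ⟩
    ν 2              ≡⟨ sym (*-identityʳ (ν 2)) ⟩
    ν 2 ^ 1          ≤⟨ ^-monoʳ-≤ {ν 2} {1} {b} (1≤ν (ℕ.s≤s ℕ.z≤n)) (ℕ.s≤s ℕ.z≤n) ⟩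
    ν 2 ^ b ∎)
    where
    open ≤-Reasoning
    b = suc b′
    e = a ℕ.* s ℕ.* b
    exponents : a ℕ.* s ℕ.* b ≡ b ℕ.* s ℕ.* a
    exponents = trans (ℕP.*-comm (a ℕ.* s) b) (trans (cong (b ℕ.*_) (ℕP.*-comm a s)) (sym (ℕP.*-assoc b s a)))

  value-bound : ∀ e η B → ν Z ^ e * B ≤ ν 2 → η ≤ B + j ^ e → ν Z ^ e * η ≤ ν 3
  value-bound e η B hB hη = begin
    ν Z ^ e * η                    ≤⟨ *-monoˡ (ν Z ^ e) (0≤^ e (<⇒≤ 0<Z)) hη ⟩
    ν Z ^ e * (B + j ^ e)          ≡⟨ *-distribˡ-+ (ν Z ^ e) B (j ^ e) ⟩
    ν Z ^ e * B + ν Z ^ e * j ^ e  ≤⟨ +-mono-≤ hB (≤-reflexive (Z^j^ e)) ⟩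
    ν 2 + 1ℚ                       ≤⟨ ι+1≤ν (+ 2) ⟩
    ν 3 ∎
    where open ≤-Reasoning

ev-zero : ∀ {d} (c : Fin d → ℤ) x → (∀ j → c j ≡ 0ℤ) → ev c x ≡ 0ℚ
ev-zero {zero}  c x h = refl
ev-zero {suc d} c x h = trans (cong₂ _+_ (trans (cong ι (h zero)) ι-0) (trans (cong (x *_) (ev-zero (c ∘ suc) x (h ∘ suc))) (*-zeroʳ x)))
  (+-identityʳ 0ℚ)

nonzero-coefficient : ∀ {k} (x : Fin (suc k) → ℤ) ξ → 0ℝ Re.< Re.∣ eval x ξ ∣ → ∃[ j ] x j ≢ 0ℤ
nonzero-coefficient x ξ (ε , ε>0 , N , h) = FinP.¬∀⟶∃¬ _ (λ j → x j ≡ 0ℤ) (λ j → x j ℤ.≟ 0ℤ) λ all →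
  <-irrefl refl (<-≤-trans ε>0 (subst₂ _≤_ (+-identityˡ ε) (cong ∣_∣ (trans (seq-eval x ξ N) (ev-zero x (seq ξ N) all))) (h N ℕP.≤-refl)))

neg-< : ∀ w r → fromℚ r Re.< w → Re.- w Re.< fromℚ (- r)
neg-< w r (δ , δ>0 , N , r<w) = δ , δ>0 , N , λ i N≤i → subst₂ _≤_
  (solve 3 (λ w r d → :- w :- r :+ (r :+ d) := :- w :+ d) refl (seq w i) r δ)
  (solve 2 (λ w r → :- w :- r :+ w := :- r) refl (seq w i) r)
  (+-monoʳ-≤ (- seq w i - r) (r<w i N≤i))

-- The exponent p/q in integral form: height of order Z^q and value at most 3·Z^(-p).
SmallPolynomial : ℕ → ℝ → (c₁ p q Z : ℕ) → Set
SmallPolynomial k ξ c₁ p q Z = Σ[ x ∈ (Fin (suc k) → ℤ) ] (∃[ j ] x j ≢ 0ℤ) × (∀ j → ℤ.∣ x j ∣ ℕ.≤ c₁ ℕ.* Z ℕ.^ q) ×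
  ∃[ N ] (∀ i → N ℕ.≤ i → ν Z ^ p * ∣ ev x (seq ξ i) ∣ ≤ ν 3)

-- The height is at most (Z + 1)^q + 3, where 3 is rounding loss; with Z + 1 ≤ 2Z and 3 ≤ 3·(2Z)^q
-- this gives 4·2^q.
coefficient-constant : ℕ → ℕ
coefficient-constant q = 4 ℕ.* 2 ℕ.^ q

coefficient-bound : ∀ q Z → 1 ℕ.≤ Z → suc Z ℕ.^ q ℕ.+ 3 ℕ.≤ coefficient-constant q ℕ.* Z ℕ.^ q
coefficient-bound q Z 1≤Z = begin
  suc Z ℕ.^ q ℕ.+ 3          ≤⟨ ℕP.+-mono-≤ (ℕP.^-monoˡ-≤ q sZ≤2Z) (ℕP.*-monoʳ-≤ 3 1≤P) ⟩
  P ℕ.+ 3 ℕ.* P              ≡⟨ cong (4 ℕ.*_) (^-distribʳ 2 Z q) ⟩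
  4 ℕ.* (2 ℕ.^ q ℕ.* Z ℕ.^ q)  ≡⟨ sym (ℕP.*-assoc 4 (2 ℕ.^ q) (Z ℕ.^ q)) ⟩
  4 ℕ.* 2 ℕ.^ q ℕ.* Z ℕ.^ q ∎
  where
  open ℕP.≤-Reasoning
  P = (2 ℕ.* Z) ℕ.^ q
  sZ≤2Z : suc Z ℕ.≤ 2 ℕ.* Z
  sZ≤2Z = ℕP.+-mono-≤ 1≤Z (ℕP.≤-reflexive (sym (ℕP.+-identityʳ Z)))
  1≤P : 1 ℕ.≤ P
  1≤P = ℕP.m^n>0 (2 ℕ.* Z) {{ℕ.>-nonZero (ℕP.≤-trans (ℕ.s≤s ℕ.z≤n) sZ≤2Z)}} q

-- Up to rounding X lies between Z^q and (Z + 1)^q. Since q is a multiple of b, the power X^(-a/b)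
-- can be compared with the integral power Z^(-as); the free factor s allows the exponents to be
-- adjusted later.
solution-polynomial : ∀ k ξ X (X>0 : 0ℝ Re.< X) B x a b′ s Z₀ W → 1 ℕ.≤ s → let q = suc b′ ℕ.* s in
  suc ((2 ℕ.+ Z₀) ℕ.^ q) ℕ.≤ W → fromℕ′ W Re.< X → B Re.^ suc b′ Re.≤ recip X X>0 Re.^ a →
  0ℝ Re.< Re.∣ eval x ξ ∣ → Re.∣ eval x ξ ∣ Re.≤ B → (∀ (j : Fin (suc k)) → fromℕ′ ℤ.∣ x j ∣ Re.≤ X) →
  ∃[ Z ] (Z₀ ℕ.≤ Z) × SmallPolynomial k ξ (coefficient-constant q) (a ℕ.* s) q Z
solution-polynomial k ξ X X>0 B x a b′ s Z₀ W 1≤s W≥ (δ₁ , δ₁>0 , N₁ , W<X) power nonzero small bounded-by =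
  with-root (integer-root q p 1≤q 0≤p)
  where
  b = suc b′
  q = b ℕ.* s
  1≤q : 1 ℕ.≤ q
  1≤q = ℕP.*-mono-≤ {1} {b} (ℕ.s≤s ℕ.z≤n) 1≤s
  Goal = ∃[ Z ] (Z₀ ℕ.≤ Z) × SmallPolynomial k ξ (coefficient-constant q) (a ℕ.* s) q Z
  modulus = cauchy X 1ℚ 0<1
  N₂ = N₁ ℕ.⊔ proj₁ modulus
  N₁≤ : ∀ {n} → N₂ ℕ.≤ n → N₁ ℕ.≤ n
  N₁≤ = ≤⊔ˡ {N₁} {proj₁ modulus}
  N₂≤ : ∀ {n} → N₂ ℕ.≤ n → proj₁ modulus ℕ.≤ n
  N₂≤ = ≤⊔ʳ {N₁} {proj₁ modulus}
  -- A rational that stays below X and within 2 of it from N₂ on; its root defines Z.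
  p : ℚ
  p = seq X N₂ - 1ℚ
  ≤p : ν ((2 ℕ.+ Z₀) ℕ.^ q) ≤ p
  ≤p = subst₂ _≤_ (trans (cong (_- 1ℚ) (trans (ν-+ 1 ((2 ℕ.+ Z₀) ℕ.^ q)) (cong (_+ ν ((2 ℕ.+ Z₀) ℕ.^ q)) ι-1)))
      (solve 1 (λ z → con 1ℚ :+ z :- con 1ℚ := z) refl (ν ((2 ℕ.+ Z₀) ℕ.^ q)))) refl
    (+-monoˡ-≤ (- 1ℚ) (≤-trans (≤-ε δ₁>0 (ν-mono W≥)) (subst (λ z → z + δ₁ ≤ seq X N₂) (seq-fromℕ W N₂) (W<X N₂ (N₁≤ ℕP.≤-refl)))))
  0≤p : 0ℚ ≤ p
  0≤p = ≤-trans (0≤ν ((2 ℕ.+ Z₀) ℕ.^ q)) ≤p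
  p≤X : ∀ i → N₂ ℕ.≤ i → p ≤ seq X i
  p≤X i N≤i = subst (p ≤_) (solve 1 (λ x → x :+ con 1ℚ :- con 1ℚ := x) refl (seq X i))
    (+-monoˡ-≤ (- 1ℚ) (near⇒≤ (seq X N₂) (seq X i) (proj₂ modulus N₂ i (N₂≤ ℕP.≤-refl) (N₂≤ N≤i))))
  X≤p+2 : ∀ i → N₂ ℕ.≤ i → seq X i ≤ p + ν 2
  X≤p+2 i N≤i = ≤-trans (near⇒≤ (seq X i) (seq X N₂) (proj₂ modulus i N₂ (N₂≤ N≤i) (N₂≤ ℕP.≤-refl)))
    (≤-reflexive (trans (solve 1 (λ x → x :+ con 1ℚ := x :- con 1ℚ :+ (con 1ℚ :+ con 1ℚ)) refl (seq X N₂))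
      (cong (_+_ p) (sym (trans (ν-+ 1 1) (cong₂ _+_ ι-1 ι-1))))))
  with-root : ∃[ Z ] (ν (Z ℕ.^ q) ≤ p) × (p < ν (suc Z ℕ.^ q)) → Goal
  with-root (Z , Z^q≤p , p<) = Z , ℕP.≤-trans (ℕP.m≤n+m Z₀ 2) 2+Z₀≤Z , x , nonzero-coefficient x ξ nonzero , coefficients , N₅ , values
    where
    2+Z₀≤Z : 2 ℕ.+ Z₀ ℕ.≤ Z
    2+Z₀≤Z = ℕP.≮⇒≥ λ Z< → <-irrefl refl (<-≤-trans p< (≤-trans (ν-mono (ℕP.^-monoˡ-≤ q Z<)) ≤p))
    2≤Z : 2 ℕ.≤ Z
    2≤Z = ℕP.≤-trans (ℕP.m≤m+n 2 Z₀) 2+Z₀≤Z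
    open ZPow Z 2≤Z using (j; 0<j)
    coefficients : ∀ i → ℤ.∣ x i ∣ ℕ.≤ coefficient-constant q ℕ.* Z ℕ.^ q
    coefficients i = ℕP.≤-trans (ν-cancel (begin
      ν ℤ.∣ x i ∣                        ≡⟨ sym (seq-fromℕ ℤ.∣ x i ∣ n) ⟩
      seq (fromℕ′ ℤ.∣ x i ∣) n           ≤⟨ proj₂ at-i n (ℕP.m≤n⊔m N₂ (proj₁ at-i)) ⟩
      seq X n + 1ℚ                       ≤⟨ +-monoˡ-≤ 1ℚ (X≤p+2 n (ℕP.m≤m⊔n N₂ (proj₁ at-i))) ⟩
      p + ν 2 + 1ℚ                       ≡⟨ +-assoc p (ν 2) 1ℚ ⟩
      p + (ν 2 + 1ℚ)                     ≤⟨ +-mono-≤ (<⇒≤ p<) (ι+1≤ν (+ 2)) ⟩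
      ν (suc Z ℕ.^ q) + ν 3              ≡⟨ sym (ν-+ (suc Z ℕ.^ q) 3) ⟩
      ν (suc Z ℕ.^ q ℕ.+ 3) ∎)) (coefficient-bound q Z (ℕP.<⇒≤ 2≤Z))
      where
      open ≤-Reasoning
      at-i = bounded-by i 1ℚ 0<1
      n = N₂ ℕ.⊔ proj₁ at-i
    e = a ℕ.* s
    h₃ = power (j ^ (e ℕ.* b)) (0<^ (e ℕ.* b) 0<j)
    h₄ = small (j ^ e) (0<^ e 0<j)
    N₃ = N₂ ℕ.⊔ proj₁ h₃
    N₅ = N₃ ℕ.⊔ proj₁ h₄
    values : ∀ i → N₅ ℕ.≤ i → ν Z ^ e * ∣ ev x (seq ξ i) ∣ ≤ ν 3
    values i N≤i = value-bound Z 2≤Z e ∣ ev x (seq ξ i) ∣ (seq B i)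
      (power-bound Z 2≤Z a b′ s (seq (recip X X>0) i) (seq B i) (0≤recip X X>0 i)
        (subst (λ z → z * seq (recip X X>0) i ≤ 1ℚ) (ν-^ Z q) (recip-bound X X>0 i (≤-trans Z^q≤p (p≤X i (≤⊔ˡ {N₂} {proj₁ h₃} N₃≤i)))))
        (subst₂ _≤_ (seq-^ B b i) (cong (_+ j ^ (e ℕ.* b)) (seq-^ (recip X X>0) a i)) (proj₂ h₃ i (≤⊔ʳ {N₂} {proj₁ h₃} N₃≤i))))
      (subst (λ z → ∣ z ∣ ≤ seq B i + j ^ e) (seq-eval x ξ i) (proj₂ h₄ i (≤⊔ʳ {N₃} {proj₁ h₄} N≤i)))
      where
      N₃≤i : N₃ ℕ.≤ i
      N₃≤i = ≤⊔ˡ {N₃} {proj₁ h₄} N≤i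

small-polynomials : ∀ k ξ w → w-Admissible k ξ w → ∀ a b′ .(c : Coprime (suc a) (suc b′)) → fromℚ (mkℚ (+ suc a) b′ c) Re.< w →
  ∀ s → 1 ℕ.≤ s → let q = suc b′ ℕ.* s in
  ∀ Z₀ → ∃[ Z ] (Z₀ ℕ.≤ Z) × SmallPolynomial k ξ (coefficient-constant q) (suc a ℕ.* s) q Z
small-polynomials k ξ w admissible a b′ c r<w s 1≤s Z₀ =
  -- X > W forces X - 1, up to rounding, above (2 + Z₀)^q, so that the integral root is at least 2 +
  -- Z₀.
  let W = suc ((2 ℕ.+ Z₀) ℕ.^ (suc b′ ℕ.* s))
      X , W<X , x , B , isPower , nonzero , small , bounded-by = admissible (fromℕ′ W)
  in solution-polynomial k ξ X (1<⇒0< {X} (IsPower.base>1 isPower)) B x (suc a) b′ s Z₀ W 1≤s ℕP.≤-refl W<X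
       -- The defining cut at the negative of the fraction, which lies above -w, bounds a power of B
       -- by a power of 1/X.
       (IsPower.above isPower (- mkℚ (+ suc a) b′ c) (neg-< w (mkℚ (+ suc a) b′ c) r<w)) nonzero small bounded-by

-- Half of the error budget is the approximation at t, the other half the change from t to s.
perturb : ∀ x₀ s t y {Zv Zu δ} → 0ℚ ≤ Zv → 0ℚ ≤ δ → ∣ x₀ ∣ ≤ Zu → ∣ s - t ∣ ≤ δ →
  ν 2 * (Zv * (Zu * δ)) ≤ 1ℚ → ν 2 * (Zv * ∣ x₀ * t - y ∣) ≤ 1ℚ → Zv * ∣ x₀ * s - y ∣ ≤ 1ℚ
perturb x₀ s t y {Zv} {Zu} {δ} 0≤Zv 0≤δ x₀≤ st≤ h₁ h₂ = *-cancelˡ-≤ (ν 2) (0<ν (ℕ.s≤s ℕ.z≤n)) (begin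
  ν 2 * (Zv * ∣ x₀ * s - y ∣)
    ≤⟨ *-monoˡ (ν 2) (0≤ν 2) (*-monoˡ Zv 0≤Zv (∣∣-triangle (x₀ * s) (x₀ * t) y)) ⟩
  ν 2 * (Zv * (∣ x₀ * s - x₀ * t ∣ + ∣ x₀ * t - y ∣))
    ≡⟨ solve 4 (λ a z p q → a :* (z :* (p :+ q)) := a :* (z :* p) :+ a :* (z :* q)) refl (ν 2) Zv ∣ x₀ * s - x₀ * t ∣ ∣ x₀ * t - y ∣ ⟩
  ν 2 * (Zv * ∣ x₀ * s - x₀ * t ∣) + ν 2 * (Zv * ∣ x₀ * t - y ∣)
    ≤⟨ +-mono-≤ (≤-trans (*-monoˡ (ν 2) (0≤ν 2) (*-monoˡ Zv 0≤Zv step)) h₁) h₂ ⟩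
  1ℚ + 1ℚ   ≡⟨ sym (trans (ν-+ 1 1) (cong₂ _+_ ι-1 ι-1)) ⟩
  ν 2       ≡⟨ sym (*-identityʳ (ν 2)) ⟩
  ν 2 * 1ℚ ∎)
  where
  open ≤-Reasoning
  step : ∣ x₀ * s - x₀ * t ∣ ≤ Zu * δ
  step = subst (_≤ Zu * δ) (trans (sym (∣p*q∣≡∣p∣*∣q∣ x₀ (s - t))) (cong ∣_∣ (solve 3 (λ x s t → x :* (s :- t) := x :* s :- x :* t) refl x₀ s t)))
    (*-mono-≤ (0≤∣p∣ x₀) 0≤δ x₀≤ st≤)

-- The approximation is constructed for the single rational `seq ξ N`. It persists at all later
-- indices, because |x₀| ≤ Z^u is known beforehand and N can be chosen after Z.
integer-solutions : ∀ k′ d ξ v p q c₁ → suc (suc v ℕ.* suc k′ ℕ.+ q ℕ.* d) ℕ.≤ p →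
  (∀ Z₀ → ∃[ Z ] (Z₀ ℕ.≤ Z) × SmallPolynomial (suc k′) ξ c₁ p q Z) →
  ∀ Z₀ → ∃[ Z ] (Z₀ ℕ.≤ Z) × IntegerSolution (suc k′ ℕ.+ d) ξ (suc (suc v ℕ.* k′ ℕ.+ q ℕ.* suc d)) v Z
integer-solutions k′ d ξ v p q c₁ p≥ polynomials Z₀ =
  let R , 1≤R , N₀ , ξ≤R = bounded ξ
      Z₁ , approximate = large-approximation k′ d R c₁ v q 1≤R
      Z , Z≥ , a , a≢0 , a≤ , N₁ , small = polynomials (2 ℕ.+ (Z₀ ℕ.+ Z₁))
  in Z , ℕP.≤-trans (ℕP.≤-trans (ℕP.m≤m+n Z₀ Z₁) (ℕP.m≤n+m (Z₀ ℕ.+ Z₁) 2)) Z≥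
   , solution R N₀ ξ≤R Z (ℕP.≤-trans (ℕP.m≤m+n 2 (Z₀ ℕ.+ Z₁)) Z≥) a
       (approximate Z (ℕP.≤-trans (ℕP.≤-trans (ℕP.m≤n+m Z₁ Z₀) (ℕP.m≤n+m (Z₀ ℕ.+ Z₁) 2)) Z≥) a a≢0 a≤) N₁ small
  where
  n = suc k′ ℕ.+ d
  u = suc (suc v ℕ.* k′ ℕ.+ q ℕ.* suc d)
  e = suc (suc v ℕ.* suc k′ ℕ.+ q ℕ.* d)
  solution : ∀ R N₀ → (∀ i → N₀ ℕ.≤ i → ∣ seq ξ i ∣ ≤ ν R) → ∀ Z → 2 ℕ.≤ Z → ∀ (a : Fin (suc (suc k′)) → ℤ) →
    (∀ ζ → ∣ ζ ∣ ≤ ν R → ν Z ^ e * ∣ ev a ζ ∣ ≤ ν 3 → Σ[ x ∈ (ℕ → ℤ) ] (x 0 ≢ 0ℤ) × (ℤ.∣ x 0 ∣ ℕ.≤ Z ℕ.^ u) ×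
      (∀ m → m ℕ.≤ n → ν 2 * (ν Z ^ v * ∣ ι (x 0) * ζ ^ m - ι (x m) ∣) ≤ 1ℚ)) →
    ∀ N₁ → (∀ i → N₁ ℕ.≤ i → ν Z ^ p * ∣ ev a (seq ξ i) ∣ ≤ ν 3) → IntegerSolution n ξ u v Z
  solution R N₀ ξ≤R Z 2≤Z a approximate N₁ small = finish (common-modulus ξ n δ 0<δ)
    where
    open ZPow Z 2≤Z
    -- The variation of x₀ξᵐ must stay below Z^(-v)/2; u accounts for |x₀|, v for the target, and
    -- the extra factor 1/Z for the 2.
    δ = j ^ suc (v ℕ.+ u)
    0<δ : 0ℚ < δ
    0<δ = 0<^ (suc (v ℕ.+ u)) 0<j
    δ-small : ν 2 * (ν Z ^ v * (ν Z ^ u * δ)) ≤ 1ℚ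
    δ-small = begin
      ν 2 * (ν Z ^ v * (ν Z ^ u * δ))   ≤⟨ *-monoʳ (ν Z ^ v * (ν Z ^ u * δ)) (*-nonNeg (0≤^ v (<⇒≤ 0<Z)) (*-nonNeg (0≤^ u (<⇒≤ 0<Z)) (<⇒≤ 0<δ))) (ν-mono 2≤Z) ⟩
      ν Z * (ν Z ^ v * (ν Z ^ u * δ))   ≡⟨ solve 4 (λ z p q d → z :* (p :* (q :* d)) := z :* (p :* q) :* d) refl (ν Z) (ν Z ^ v) (ν Z ^ u) δ ⟩
      ν Z * (ν Z ^ v * ν Z ^ u) * δ     ≡⟨ cong (λ s → ν Z * s * δ) (sym (^-homo-* (ν Z) v u)) ⟩
      ν Z ^ suc (v ℕ.+ u) * δ           ≡⟨ Z^j^ (suc (v ℕ.+ u)) ⟩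
      1ℚ ∎
      where open ≤-Reasoning
    finish : ∃[ N₂ ] (∀ m → m ℕ.≤ n → ∀ i j → N₂ ℕ.≤ i → N₂ ℕ.≤ j → ∣ seq ξ i ^ m - seq ξ j ^ m ∣ ≤ δ) → IntegerSolution n ξ u v Z
    finish (N₂ , modulus) = output (approximate (seq ξ N) (ξ≤R N (ℕP.≤-trans (ℕP.m≤m⊔n N₀ N₁) (ℕP.m≤m⊔n (N₀ ℕ.⊔ N₁) N₂)))
        (≤-trans (*-monoʳ ∣ ev a (seq ξ N) ∣ (0≤∣p∣ (ev a (seq ξ N))) (^-monoʳ-≤ 1≤Z p≥))
          (small N (ℕP.≤-trans (ℕP.m≤n⊔m N₀ N₁) (ℕP.m≤m⊔n (N₀ ℕ.⊔ N₁) N₂)))))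
      where
      N = N₀ ℕ.⊔ N₁ ℕ.⊔ N₂
      N₂≤ : N₂ ℕ.≤ N
      N₂≤ = ℕP.m≤n⊔m (N₀ ℕ.⊔ N₁) N₂
      output : Σ[ x ∈ (ℕ → ℤ) ] (x 0 ≢ 0ℤ) × (ℤ.∣ x 0 ∣ ℕ.≤ Z ℕ.^ u) ×
        (∀ m → m ℕ.≤ n → ν 2 * (ν Z ^ v * ∣ ι (x 0) * seq ξ N ^ m - ι (x m) ∣) ≤ 1ℚ) → IntegerSolution n ξ u v Z
      output (x , x₀≢0 , x₀≤ , close) = x , x₀≢0 , x₀≤ , N , λ m m≤n i N≤i →
        perturb (ι (x 0)) (seq ξ i ^ m) (seq ξ N ^ m) (ι (x m)) (0≤^ v (<⇒≤ 0<Z)) (<⇒≤ 0<δ)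
          (subst₂ _≤_ (sym (ι-∣∣ (x 0))) (ν-^ Z u) (ν-mono x₀≤))
          (modulus m m≤n i N (ℕP.≤-trans N₂≤ N≤i) N₂≤) δ-small (close m m≤n)

-- With g = A − bd and N = 2β, the exponents p = kNA, q = kNb, t = v + 1 = Ng − 1
-- satisfy tk + qd + k = p, and the slack αD + 1 ≤ βg in the hypothesis pays for
-- the difference between Ng and v.
exponents : ∀ k′ d A b α β → 1 ℕ.≤ k′ → 1 ℕ.≤ β →
  suc (α ℕ.* (k′ ℕ.* A ℕ.+ b ℕ.* (suc k′ ℕ.+ d)) ℕ.+ β ℕ.* (b ℕ.* d)) ℕ.≤ β ℕ.* A →
  ∃[ s ] ∃[ v ] (1 ℕ.≤ s) × (suc (suc v ℕ.* suc k′ ℕ.+ (b ℕ.* s) ℕ.* d) ℕ.≤ A ℕ.* s) ×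
    (α ℕ.* suc (suc v ℕ.* k′ ℕ.+ (b ℕ.* s) ℕ.* suc d) ℕ.≤ β ℕ.* v)
exponents k′ d A b α β 1≤k′ 1≤β h = k ℕ.* N , v , ℕP.*-mono-≤ {1} {k} {1} (ℕ.s≤s ℕ.z≤n) (ℕP.≤-trans (ℕ.s≤s ℕ.z≤n) 2≤N) , p≥ , αu≤βv
  where
  module S = ℕS.+-*-Solver
  k = suc k′
  N = 2 ℕ.* β
  2≤N : 2 ℕ.≤ N
  2≤N = ℕP.*-monoʳ-≤ 2 1≤β
  bd<A : b ℕ.* d ℕ.< A
  bd<A = ℕP.*-cancelˡ-< β (b ℕ.* d) A (ℕP.≤-trans (ℕ.s≤s (ℕP.m≤n+m (β ℕ.* (b ℕ.* d)) _)) h)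
  g = A ℕ.∸ b ℕ.* d
  A≡ : A ≡ b ℕ.* d ℕ.+ g
  A≡ = sym (ℕP.m+[n∸m]≡n (ℕP.<⇒≤ bd<A))
  1≤g : 1 ℕ.≤ g
  1≤g = ℕP.m<n⇒0<n∸m bd<A
  v = N ℕ.* g ℕ.∸ 2
  Ng≡ : N ℕ.* g ≡ 2 ℕ.+ v
  Ng≡ = sym (ℕP.m+[n∸m]≡n (ℕP.*-mono-≤ {2} {N} {1} 2≤N 1≤g))
  D = k′ ℕ.* g ℕ.+ b ℕ.* (k ℕ.* suc d)
  p≥ : suc (suc v ℕ.* k ℕ.+ (b ℕ.* (k ℕ.* N)) ℕ.* d) ℕ.≤ A ℕ.* (k ℕ.* N)
  p≥ = begin
    suc (suc v ℕ.* k ℕ.+ (b ℕ.* (k ℕ.* N)) ℕ.* d)   ≤⟨ ℕP.+-monoˡ-≤ (suc v ℕ.* k ℕ.+ (b ℕ.* (k ℕ.* N)) ℕ.* d) (ℕ.s≤s (ℕ.z≤n {k′})) ⟩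
    k ℕ.+ (suc v ℕ.* k ℕ.+ (b ℕ.* (k ℕ.* N)) ℕ.* d) ≡⟨ S.solve 5 (λ v k b N d → k S.:+ ((S.con 1 S.:+ v) S.:* k S.:+ (b S.:* (k S.:* N)) S.:* d)
                                                          S.:= k S.:* (S.con 2 S.:+ v) S.:+ b S.:* d S.:* (k S.:* N)) refl v k b N d ⟩
    k ℕ.* (2 ℕ.+ v) ℕ.+ b ℕ.* d ℕ.* (k ℕ.* N)       ≡⟨ cong (λ m → k ℕ.* m ℕ.+ b ℕ.* d ℕ.* (k ℕ.* N)) (sym Ng≡) ⟩
    k ℕ.* (N ℕ.* g) ℕ.+ b ℕ.* d ℕ.* (k ℕ.* N)       ≡⟨ S.solve 4 (λ k N g x → k S.:* (N S.:* g) S.:+ x S.:* (k S.:* N) S.:= (x S.:+ g) S.:* (k S.:* N)) refl k N g (b ℕ.* d) ⟩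
    (b ℕ.* d ℕ.+ g) ℕ.* (k ℕ.* N)                   ≡⟨ cong (ℕ._* (k ℕ.* N)) (sym A≡) ⟩
    A ℕ.* (k ℕ.* N) ∎
    where open ℕP.≤-Reasoning
  D≡ : k′ ℕ.* A ℕ.+ b ℕ.* (k ℕ.+ d) ≡ D
  D≡ = trans (cong (λ m → k′ ℕ.* m ℕ.+ b ℕ.* (k ℕ.+ d)) A≡)
    (S.solve 4 (λ k′ b d g → k′ S.:* (b S.:* d S.:+ g) S.:+ b S.:* ((S.con 1 S.:+ k′) S.:+ d)
      S.:= k′ S.:* g S.:+ b S.:* ((S.con 1 S.:+ k′) S.:* (S.con 1 S.:+ d))) refl k′ b d g)
  αD<βg : suc (α ℕ.* D) ℕ.≤ β ℕ.* g
  αD<βg = ℕP.+-cancelʳ-≤ (β ℕ.* (b ℕ.* d)) (suc (α ℕ.* D)) (β ℕ.* g)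
    (subst₂ (λ x y → suc (α ℕ.* x ℕ.+ β ℕ.* (b ℕ.* d)) ℕ.≤ y) D≡
      (trans (cong (β ℕ.*_) (trans A≡ (ℕP.+-comm (b ℕ.* d) g))) (ℕP.*-distribˡ-+ β g (b ℕ.* d))) h)
  u≤ND : suc (suc v ℕ.* k′ ℕ.+ (b ℕ.* (k ℕ.* N)) ℕ.* suc d) ℕ.≤ N ℕ.* D
  u≤ND = begin
    suc (suc v ℕ.* k′ ℕ.+ (b ℕ.* (k ℕ.* N)) ℕ.* suc d)   ≤⟨ ℕP.+-monoˡ-≤ (suc v ℕ.* k′ ℕ.+ (b ℕ.* (k ℕ.* N)) ℕ.* suc d) 1≤k′ ⟩
    k′ ℕ.+ (suc v ℕ.* k′ ℕ.+ (b ℕ.* (k ℕ.* N)) ℕ.* suc d) ≡⟨ S.solve 6 (λ v k′ b k N e → k′ S.:+ ((S.con 1 S.:+ v) S.:* k′ S.:+ (b S.:* (k S.:* N)) S.:* e)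
                                                          S.:= (S.con 2 S.:+ v) S.:* k′ S.:+ N S.:* (b S.:* (k S.:* e))) refl v k′ b k N (suc d) ⟩
    (2 ℕ.+ v) ℕ.* k′ ℕ.+ N ℕ.* (b ℕ.* (k ℕ.* suc d))     ≡⟨ cong (λ m → m ℕ.* k′ ℕ.+ N ℕ.* (b ℕ.* (k ℕ.* suc d))) (sym Ng≡) ⟩
    N ℕ.* g ℕ.* k′ ℕ.+ N ℕ.* (b ℕ.* (k ℕ.* suc d))       ≡⟨ S.solve 4 (λ N g k′ x → N S.:* g S.:* k′ S.:+ N S.:* x S.:= N S.:* (k′ S.:* g S.:+ x)) refl N g k′ (b ℕ.* (k ℕ.* suc d)) ⟩
    N ℕ.* D ∎
    where open ℕP.≤-Reasoning
  αu≤βv : α ℕ.* suc (suc v ℕ.* k′ ℕ.+ (b ℕ.* (k ℕ.* N)) ℕ.* suc d) ℕ.≤ β ℕ.* v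
  αu≤βv = ℕP.+-cancelʳ-≤ N (α ℕ.* suc (suc v ℕ.* k′ ℕ.+ (b ℕ.* (k ℕ.* N)) ℕ.* suc d)) (β ℕ.* v) (begin
    α ℕ.* suc (suc v ℕ.* k′ ℕ.+ (b ℕ.* (k ℕ.* N)) ℕ.* suc d) ℕ.+ N  ≤⟨ ℕP.+-monoˡ-≤ N (ℕP.*-monoʳ-≤ α u≤ND) ⟩
    α ℕ.* (N ℕ.* D) ℕ.+ N        ≡⟨ S.solve 3 (λ α N D → α S.:* (N S.:* D) S.:+ N S.:= N S.:* (S.con 1 S.:+ α S.:* D)) refl α N D ⟩
    N ℕ.* suc (α ℕ.* D)          ≤⟨ ℕP.*-monoʳ-≤ N αD<βg ⟩
    N ℕ.* (β ℕ.* g)              ≡⟨ S.solve 3 (λ N β g → N S.:* (β S.:* g) S.:= β S.:* (N S.:* g)) refl N β g ⟩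
    β ℕ.* (N ℕ.* g)              ≡⟨ cong (β ℕ.*_) Ng≡ ⟩
    β ℕ.* (2 ℕ.+ v)              ≡⟨ S.solve 2 (λ β v → β S.:* (S.con 2 S.:+ v) S.:= β S.:* v S.:+ S.con 2 S.:* β) refl β v ⟩
    β ℕ.* v ℕ.+ N ∎)
    where open ℕP.≤-Reasoning

-- With r the fraction below w, the last hypothesis is (α/β)·((k-1)r + n) + d < r with denominators
-- cleared, that is, α/β lies strictly below the claimed quotient at r. The exponent found is l =
-- v/u.
admissible-transfer : ∀ k′ d ξ w → 1 ℕ.≤ k′ → w-Admissible (suc k′) ξ w →
  ∀ a b′ .(c : Coprime (suc a) (suc b′)) → fromℚ (mkℚ (+ suc a) b′ c) Re.< w → ∀ α β → 1 ℕ.≤ β →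
  suc (α ℕ.* (k′ ℕ.* suc a ℕ.+ suc b′ ℕ.* (suc k′ ℕ.+ d)) ℕ.+ β ℕ.* (suc b′ ℕ.* d)) ℕ.≤ β ℕ.* suc a →
  ∃[ l ] λ-Admissible (suc k′ ℕ.+ d) ξ (fromℚ l) × (ν α ≤ ν β * l)
admissible-transfer k′ d ξ w 1≤k′ adm a b′ c r<w α β 1≤β h = construct (exponents k′ d (suc a) (suc b′) α β 1≤k′ 1≤β h)
  where
  construct : ∃[ s ] ∃[ v ] (1 ℕ.≤ s) × (suc (suc v ℕ.* suc k′ ℕ.+ (suc b′ ℕ.* s) ℕ.* d) ℕ.≤ suc a ℕ.* s) ×
    (α ℕ.* suc (suc v ℕ.* k′ ℕ.+ (suc b′ ℕ.* s) ℕ.* suc d) ℕ.≤ β ℕ.* v) →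
    ∃[ l ] λ-Admissible (suc k′ ℕ.+ d) ξ (fromℚ l) × (ν α ≤ ν β * l)
  construct (s , v , 1≤s , p≥ , αu≤βv) = l
    , λ-admissible (suc k′ ℕ.+ d) ξ u v (ℕ.s≤s ℕ.z≤n) l lu≡v
        (integer-solutions k′ d ξ v (suc a ℕ.* s) q (coefficient-constant q) p≥ (small-polynomials (suc k′) ξ w adm a b′ c r<w s 1≤s))
    , subst₂ _≤_ (trans (*-assoc (ν α) (ν u) i) (trans (cong (ν α *_) (inv-posʳ (ν u) 0<u)) (*-identityʳ (ν α))))
        (*-assoc (ν β) (ν v) i) (*-monoʳ i (<⇒≤ (inv-pos>0 (ν u) 0<u)) (subst₂ _≤_ (ν-* α u) (ν-* β v) (ν-mono αu≤βv)))
    where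
    q = suc b′ ℕ.* s
    u = suc (suc v ℕ.* k′ ℕ.+ q ℕ.* suc d)
    0<u : 0ℚ < ν u
    0<u = 0<ν (ℕ.s≤s ℕ.z≤n)
    i = inv-pos (ν u) 0<u
    l = ν v * i
    lu≡v : l * ν u ≡ ν v
    lu≡v = trans (*-assoc (ν v) i (ν u)) (trans (cong (ν v *_) (trans (*-comm i (ν u)) (inv-posʳ (ν u) 0<u))) (*-identityʳ (ν v)))

-- Passage to the suprema

half-absurd : ∀ {ε} → 0ℚ < ε → ¬ (ε ≤ ½ * ε)
half-absurd {ε} ε>0 h = <-irrefl refl (<-≤-trans (half-pos ε>0)
  (subst₂ _≤_ (trans (cong (_- ½ * ε) (sym (halves ε))) (solve 1 (λ s → s :+ s :- s := s) refl (½ * ε))) (+-inverseʳ (½ * ε))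
    (+-monoˡ-≤ (- (½ * ε)) h)))

clear-denominators : ∀ r L α β A b k′ n d → 1 ℕ.≤ β → 1 ℕ.≤ b → L * ν β ≡ ν α → r * ν b ≡ ν A →
  L * (ν k′ * r + ν n) + ν d < r → suc (α ℕ.* (k′ ℕ.* A ℕ.+ b ℕ.* n) ℕ.+ β ℕ.* (b ℕ.* d)) ℕ.≤ β ℕ.* A
clear-denominators r L α β A b k′ n d 1≤β 1≤b Lβ rb h = ℤP.drop‿+<+ (ι-cancel-< (subst₂ _<_ left right
  (*-monoˡ-<-pos (ν β * ν b) {{positive (*-pos (0<ν 1≤β) (0<ν 1≤b))}} h)))
  where
  open ≡-Reasoning
  left : (L * (ν k′ * r + ν n) + ν d) * (ν β * ν b) ≡ ν (α ℕ.* (k′ ℕ.* A ℕ.+ b ℕ.* n) ℕ.+ β ℕ.* (b ℕ.* d))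
  left = begin
    (L * (ν k′ * r + ν n) + ν d) * (ν β * ν b)
      ≡⟨ solve 7 (λ L k r n d β b → (L :* (k :* r :+ n) :+ d) :* (β :* b) := (L :* β) :* (k :* (r :* b) :+ b :* n) :+ β :* (b :* d)) refl
           L (ν k′) r (ν n) (ν d) (ν β) (ν b) ⟩
    (L * ν β) * (ν k′ * (r * ν b) + ν b * ν n) + ν β * (ν b * ν d)
      ≡⟨ cong₂ (λ x y → x * (ν k′ * y + ν b * ν n) + ν β * (ν b * ν d)) Lβ rb ⟩
    ν α * (ν k′ * ν A + ν b * ν n) + ν β * (ν b * ν d)
      ≡⟨ cong₂ (λ x y → ν α * x + ν β * y) (sym (trans (ν-+ (k′ ℕ.* A) (b ℕ.* n)) (cong₂ _+_ (ν-* k′ A) (ν-* b n)))) (sym (ν-* b d)) ⟩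
    ν α * ν (k′ ℕ.* A ℕ.+ b ℕ.* n) + ν β * ν (b ℕ.* d)
      ≡⟨ sym (trans (ν-+ (α ℕ.* (k′ ℕ.* A ℕ.+ b ℕ.* n)) (β ℕ.* (b ℕ.* d))) (cong₂ _+_ (ν-* α (k′ ℕ.* A ℕ.+ b ℕ.* n)) (ν-* β (b ℕ.* d)))) ⟩
    ν (α ℕ.* (k′ ℕ.* A ℕ.+ b ℕ.* n) ℕ.+ β ℕ.* (b ℕ.* d)) ∎
  right : r * (ν β * ν b) ≡ ν (β ℕ.* A)
  right = begin
    r * (ν β * ν b)   ≡⟨ solve 3 (λ r β b → r :* (β :* b) := β :* (r :* b)) refl r (ν β) (ν b) ⟩
    ν β * (r * ν b)   ≡⟨ cong (ν β *_) rb ⟩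
    ν β * ν A         ≡⟨ sym (ν-* β A) ⟩
    ν (β ℕ.* A) ∎

nonNeg-numerator : ∀ L → 0ℚ ≤ L → L * ν (↧ₙ L) ≡ ν ℤ.∣ ↥ L ∣
nonNeg-numerator L 0≤L = begin
  L * ν (↧ₙ L)          ≡⟨ sym (0≤p⇒∣p∣≡p (*-nonNeg 0≤L (0≤ν (↧ₙ L)))) ⟩
  ∣ L * ν (↧ₙ L) ∣      ≡⟨ cong ∣_∣ (*-↧ L) ⟩
  ∣ ι (↥ L) ∣           ≡⟨ ι-∣∣ (↥ L) ⟩
  ν ℤ.∣ ↥ L ∣ ∎
  where open ≡-Reasoning

module _ (k′ d : ℕ) (1≤k′ : 1 ℕ.≤ k′) (ξ : ℝ) where

  private
    k = suc k′
    n = k ℕ.+ d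

  transfer-positive : ∀ w → w-Admissible k ξ w → ∀ r → 0ℚ < r → fromℚ r Re.< w → ∀ α β → 1 ℕ.≤ β →
    suc (α ℕ.* (k′ ℕ.* ℤ.∣ ↥ r ∣ ℕ.+ ↧ₙ r ℕ.* n) ℕ.+ β ℕ.* (↧ₙ r ℕ.* d)) ℕ.≤ β ℕ.* ℤ.∣ ↥ r ∣ →
    ∃[ l ] λ-Admissible n ξ (fromℚ l) × (ν α ≤ ν β * l)
  transfer-positive w adm (mkℚ (+ zero) b′ c)    (*<* (ℤ.+<+ ()))
  transfer-positive w adm (mkℚ -[1+ a ] b′ c)    (*<* ())
  transfer-positive w adm (mkℚ (+ suc a) b′ c) _ = admissible-transfer k′ d ξ w 1≤k′ adm a b′ c

  module _ (L : ℝ) (isUpper : IsUpperBound (λ-Admissible n ξ) (fin L)) (L′ : ℚ) (0≤L′ : 0ℚ ≤ L′) (L<L′ : L Re.< fromℚ L′) where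

    -- Otherwise some admissible l ≥ L′ > L would exceed the upper bound L.
    no-large-exponent : ∀ w → w-Admissible k ξ w → ∀ r → 0ℚ < r → fromℚ r Re.< w → ¬ (L′ * (ν k′ * r + ν n) + ν d < r)
    no-large-exponent w adm r 0<r r<w h =
      refute (transfer-positive w adm r 0<r r<w ℤ.∣ ↥ L′ ∣ (↧ₙ L′) (ℕ.s≤s ℕ.z≤n)
        (clear-denominators r L′ ℤ.∣ ↥ L′ ∣ (↧ₙ L′) ℤ.∣ ↥ r ∣ (↧ₙ r) k′ n d (ℕ.s≤s ℕ.z≤n) (ℕ.s≤s ℕ.z≤n)
          (nonNeg-numerator L′ 0≤L′) (nonNeg-numerator r (<⇒≤ 0<r)) h)) L<L′
      where
      refute : ∃[ l ] λ-Admissible n ξ (fromℚ l) × (ν ℤ.∣ ↥ L′ ∣ ≤ ν (↧ₙ L′) * l) → L Re.< fromℚ L′ → ⊥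
      refute (l , l-adm , α≤βl) (ε , ε>0 , N , L+ε≤L′) = below (isUpper (fromℚ l) l-adm (½ * ε) (half-pos ε>0))
        where
        L′≤l : L′ ≤ l
        L′≤l = *-cancelˡ-≤ (ν (↧ₙ L′)) (0<ν (ℕ.s≤s ℕ.z≤n))
          (subst (_≤ ν (↧ₙ L′) * l) (trans (sym (nonNeg-numerator L′ 0≤L′)) (*-comm L′ (ν (↧ₙ L′)))) α≤βl)
        below : ∃[ M ] (∀ i → M ℕ.≤ i → l ≤ seq L i + ½ * ε) → ⊥
        below (M , l≤) = half-absurd ε>0 (subst₂ _≤_ (cancel ε) (cancel (½ * ε)) (+-monoʳ-≤ (- seq L i)
          (≤-trans (L+ε≤L′ i (ℕP.m≤m⊔n N M)) (≤-trans L′≤l (l≤ i (ℕP.m≤n⊔m N M))))))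
          where
          i = N ℕ.⊔ M
          cancel : ∀ e → - seq L i + (seq L i + e) ≡ e
          cancel = solve 2 (λ x e → :- x :+ (x :+ e) := e) refl (seq L i)

    -- G is the fixed point of r ↦ L′((k-1)r + n) + d, the argument at which the quotient equals L′.
    -- As the slope of this map is below 1, every r > G satisfies the inequality excluded by
    -- `no-large-exponent`.
    admissible-bound : ∀ G → 0ℚ ≤ G → G * (1ℚ - ν k′ * L′) ≡ L′ * ν n + ν d → 0ℚ < 1ℚ - ν k′ * L′ →
      ∀ w → w-Admissible k ξ w → w Re.≤ fromℚ G
    admissible-bound G 0≤G Gκ 0<κ w adm = ≮⇒≥ᵣ {w} {fromℚ G} refute
      where
      refute : ¬ (fromℚ G Re.< w)
      refute (ε , ε>0 , N , G+ε≤w) = no-large-exponent w adm r (≤-<-trans 0≤G G<r)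
        (½ * ε , half-pos ε>0 , N , λ i N≤i → subst (_≤ seq w i)
          (trans (cong (_+_ G) (sym (halves ε))) (sym (+-assoc G (½ * ε) (½ * ε)))) (G+ε≤w i N≤i))
        (subst₂ _<_
          (trans (cong (_+ ν k′ * L′ * r) Gκ)
            (solve 5 (λ L k n d r → L :* n :+ d :+ k :* L :* r := L :* (k :* r :+ n) :+ d) refl L′ (ν k′) (ν n) (ν d) r))
          (solve 3 (λ L k r → r :* (con 1ℚ :- k :* L) :+ k :* L :* r := r) refl L′ (ν k′) r)
          (+-monoˡ-< (ν k′ * L′ * r) (*-monoˡ-<-pos (1ℚ - ν k′ * L′) {{positive 0<κ}} G<r)))
        where
        -- Halfway into the gap, so that both G < r and r < w are strict.
        r = G + ½ * ε
        G<r : G < r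
        G<r = subst (_< r) (+-identityʳ G) (+-monoʳ-< G (half-pos ε>0))

-- Of the gap ε, one half places L′ above a late term of L; the quarter e covers the oscillation of
-- L, and another quarter is the margin left below q.
separate : ∀ L q → fromℚ 0ℚ Re.≤ L → L Re.< q →
  ∃[ L′ ] ∃[ e ] (0ℚ ≤ L′) × (0ℚ < e) × (L Re.< fromℚ L′) × ∃[ N ] (∀ i → N ℕ.≤ i → L′ + e ≤ seq q i)
separate L q 0≤L (ε , ε>0 , N , L<q) = choose (½ * ε) (½ * (½ * ε)) (half-pos (half-pos ε>0)) (halves ε) (halves (½ * ε))
  where
  choose : ∀ h e → 0ℚ < e → h + h ≡ ε → e + e ≡ h →
    ∃[ L′ ] ∃[ e ] (0ℚ ≤ L′) × (0ℚ < e) × (L Re.< fromℚ L′) × ∃[ N ] (∀ i → N ℕ.≤ i → L′ + e ≤ seq q i)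
  choose h e e>0 hh ee = L′ , e , 0≤L′ , e>0
    , (e , e>0 , M , λ i M≤i → ≤-trans (+-monoˡ-≤ e (near⇒≤ (seq L i) (seq L i₀) (proj₂ modulus i i₀ M≤i M≤i₀)))
        (≤-reflexive (trans (+-assoc (seq L i₀) e e) (cong (_+_ (seq L i₀)) ee))))
    , i₀ , λ i i₀≤i → ≤-trans (≤-trans
        (+-monoˡ-≤ e (+-monoˡ-≤ h (near⇒≤ (seq L i₀) (seq L i) (proj₂ modulus i₀ i M≤i₀ (ℕP.≤-trans M≤i₀ i₀≤i)))))
        (≤-reflexive (trans (solve 3 (λ x e h → x :+ e :+ h :+ e := x :+ ((e :+ e) :+ h)) refl (seq L i) e h)
          (cong (_+_ (seq L i)) (trans (cong (_+ h) ee) hh)))))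
        (L<q i (ℕP.≤-trans N≤i₀ i₀≤i))
    where
    modulus = cauchy L e e>0
    M = proj₁ modulus
    low = 0≤L e e>0
    P = proj₁ low
    i₀ = N ℕ.⊔ M ℕ.⊔ P
    N≤i₀ : N ℕ.≤ i₀
    N≤i₀ = ℕP.≤-trans (ℕP.m≤m⊔n N M) (ℕP.m≤m⊔n (N ℕ.⊔ M) P)
    M≤i₀ : M ℕ.≤ i₀
    M≤i₀ = ℕP.≤-trans (ℕP.m≤n⊔m N M) (ℕP.m≤m⊔n (N ℕ.⊔ M) P)
    L′ = seq L i₀ + h
    0≤L′ : 0ℚ ≤ L′
    0≤L′ = ≤-trans (proj₂ low i₀ (ℕP.m≤n⊔m (N ℕ.⊔ M) P))
      (+-monoʳ-≤ (seq L i₀) (subst (e ≤_) ee (subst (_≤ e + e) (+-identityˡ e) (+-monoˡ-≤ e (<⇒≤ e>0)))))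

recip-inverse : ∀ b (b>0 : 0ℝ Re.< b) i → proj₁ b>0 ≤ seq b i → seq (recip b b>0) i * seq b i ≡ 1ℚ
recip-inverse b (δ , δ>0 , _) i δ≤b = trans (*-comm (inv-pos (seq b i ⊔ δ) r>0) (seq b i))
  (trans (cong (_* inv-pos (seq b i ⊔ δ) r>0) (sym (p≥q⇒p⊔q≡p δ≤b))) (inv-posʳ (seq b i ⊔ δ) r>0))
  where
  r>0 : 0ℚ < seq b i ⊔ δ
  r>0 = <-≤-trans δ>0 (p≤q⊔p (seq b i) δ)

quotient-bound : ∀ a b (b>0 : 0ℝ Re.< b) i {c} → proj₁ b>0 ≤ seq b i → c ≤ seq (a / b ⟨ b>0 ⟩) i → c * seq b i ≤ seq a i
quotient-bound a b b>0 i {c} δ≤b h = subst (c * seq b i ≤_)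
  (trans (*-assoc (seq a i) (seq (recip b b>0) i) (seq b i)) (trans (cong (seq a i *_) (recip-inverse b b>0 i δ≤b)) (*-identityʳ (seq a i))))
  (*-monoʳ (seq b i) (≤-trans (<⇒≤ (proj₁ (proj₂ b>0))) δ≤b) h)

positive-factor : ∀ {p q} → 0ℚ < q → 0ℚ < p * q → 0ℚ < p
positive-factor {p} {q} 0<q 0<pq = ≰⇒> λ p≤0 → <-irrefl refl (<-≤-trans 0<pq
  (subst (p * q ≤_) (*-zeroˡ q) (*-monoʳ q (<⇒≤ 0<q) p≤0)))

-- (w − d) / (k w + n) stays below its limit 1 / k.
slope-positive : ∀ L e k n d w → 0ℚ ≤ e → 0ℚ ≤ k → 0ℚ ≤ d → 0ℚ < n → 0ℚ < k * w + n →
  (L + e) * (k * w + n) ≤ w - d → 0ℚ < 1ℚ - k * L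
slope-positive L e k n d w 0≤e 0≤k 0≤d 0<n 0<b h = positive-factor 0<b (<-≤-trans 0<n (begin
  n                                                            ≤⟨ ≤-by refl (+-nonNeg (+-nonNeg (*-nonNeg 0≤k 0≤d) (*-nonNeg 0≤k (*-nonNeg 0≤e (<⇒≤ 0<b)))) (*-nonNeg 0≤k (0≤⇒0≤- h))) ⟩
  n + (k * d + k * (e * (k * w + n)) + k * (w - d - (L + e) * (k * w + n)))
    ≡⟨ solve 6 (λ L e k n d w → n :+ (k :* d :+ k :* (e :* (k :* w :+ n)) :+ k :* (w :- d :- (L :+ e) :* (k :* w :+ n)))
         := (con 1ℚ :- k :* L) :* (k :* w :+ n)) refl L e k n d w ⟩
  (1ℚ - k * L) * (k * w + n) ∎))
  where open ≤-Reasoning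

-- The excess w - d - L(kw + n) equals (w - G)(1 - kL). It is at least e·δ by the margin e, but at
-- most half of that if w ≤ G + ε.
bound-contradiction : ∀ L e k n d w G δ ε → G * (1ℚ - k * L) ≡ L * n + d → 0ℚ < 1ℚ - k * L → 0ℚ < e → 0ℚ < δ →
  δ ≤ k * w + n → (L + e) * (k * w + n) ≤ w - d → ε * (1ℚ - k * L) ≡ ½ * (e * δ) → ¬ (w ≤ G + ε)
bound-contradiction L e k n d w G δ ε Gκ 0<κ 0<e 0<δ δ≤b h εκ w≤ = half-absurd (*-pos 0<e 0<δ) (begin
  e * δ                                              ≤⟨ *-monoˡ e (<⇒≤ 0<e) δ≤b ⟩
  e * (k * w + n)                                    ≡⟨ solve 6 (λ L e k n d w → e :* (k :* w :+ n) := (L :+ e) :* (k :* w :+ n) :+ (:- (L :* (k :* w :+ n)))) refl L e k n d w ⟩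
  (L + e) * (k * w + n) + (- (L * (k * w + n)))      ≤⟨ +-monoˡ-≤ (- (L * (k * w + n))) h ⟩
  w - d + (- (L * (k * w + n)))                      ≡⟨ solve 5 (λ L k n d w → w :- d :+ (:- (L :* (k :* w :+ n))) := w :* (con 1ℚ :- k :* L) :- (L :* n :+ d)) refl L k n d w ⟩
  w * (1ℚ - k * L) - (L * n + d)                     ≤⟨ +-monoˡ-≤ (- (L * n + d)) (*-monoʳ (1ℚ - k * L) (<⇒≤ 0<κ) w≤) ⟩
  (G + ε) * (1ℚ - k * L) - (L * n + d)               ≡⟨ cong (_- (L * n + d)) (*-distribʳ-+ (1ℚ - k * L) G ε) ⟩
  G * (1ℚ - k * L) + ε * (1ℚ - k * L) - (L * n + d)  ≡⟨ cong₂ (λ x y → x + y - (L * n + d)) Gκ εκ ⟩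
  L * n + d + ½ * (e * δ) - (L * n + d)              ≡⟨ solve 2 (λ x y → x :+ y :- x := y) refl (L * n + d) (½ * (e * δ)) ⟩
  ½ * (e * δ) ∎)
  where open ≤-Reasoning

-- S is the set of exponents whose supremum is considered. Its inclusion in the admissible set
-- transfers the upper bound, and its member -1 keeps the denominator of the quotient positive at
-- the supremum.
module Bound (k′ d : ℕ) (1≤k′ : 1 ℕ.≤ k′) (ξ : ℝ) (S : ℝ → Set)
  (S⊆ : ∀ w → S w → w-Admissible (suc k′) ξ w) (S∋-1 : S (fromℚ (- 1ℚ))) where

  private
    k = suc k′
    n = k ℕ.+ d
    numerator : ℝ → ℝ
    numerator w = w Re.- fromℕ′ n Re.+ fromℕ′ k
    denominator : ℝ → ℝ
    denominator w = (fromℕ′ k Re.- 1ℝ) Re.* w Re.+ fromℕ′ n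

  seq-k-1 : ∀ i → seq (fromℕ′ k Re.- 1ℝ) i ≡ ν k′
  seq-k-1 i = trans (cong₂ _-_ (seq-fromℕ k i) (trans (seq-fromℕ 1 i) ι-1))
    (trans (cong (_- 1ℚ) (trans (ν-+ 1 k′) (cong (_+ ν k′) ι-1))) (solve 1 (λ x → con 1ℚ :+ x :- con 1ℚ := x) refl (ν k′)))

  seq-numerator : ∀ w i → seq (numerator w) i ≡ seq w i - ν d
  seq-numerator w i = trans (cong₂ (λ x y → seq w i - x + y) (trans (seq-fromℕ n i) (ν-+ k d)) (seq-fromℕ k i))
    (solve 3 (λ w k d → w :- (k :+ d) :+ k := w :- d) refl (seq w i) (ν k) (ν d))

  seq-denominator : ∀ w i → seq (denominator w) i ≡ ν k′ * seq w i + ν n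
  seq-denominator w i = cong₂ (λ x y → x * seq w i + y) (seq-k-1 i) (seq-fromℕ n i)

  -- At w ≥ -1 the denominator is at least n - (k - 1) ≥ 1. The tolerance ½/(k - 1) on w costs one
  -- half of this.
  denominator>0 : ∀ w → fromℚ (- 1ℚ) Re.≤ w → 0ℝ Re.< denominator w
  denominator>0 w -1≤w = ½ , positive⁻¹ ½ , proj₁ low , λ i N≤i →
    subst₂ _≤_ (sym (+-identityˡ ½)) (sym (seq-denominator w i)) (estimate (seq w i) (proj₂ low i N≤i))
    where
    0<k′ : 0ℚ < ν k′
    0<k′ = 0<ν 1≤k′
    ε = ½ * inv-pos (ν k′) 0<k′
    low = -1≤w ε (half-pos (inv-pos>0 (ν k′) 0<k′))
    k′ε : ν k′ * ε ≡ ½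
    k′ε = trans (solve 3 (λ k h i → k :* (h :* i) := h :* (k :* i)) refl (ν k′) ½ (inv-pos (ν k′) 0<k′))
      (trans (cong (½ *_) (inv-posʳ (ν k′) 0<k′)) (*-identityʳ ½))
    estimate : ∀ x → - 1ℚ ≤ x + ε → ½ ≤ ν k′ * x + ν n
    estimate x h = begin
      ½                                              ≡⟨ solve 1 (λ k → con ½ := k :* con (- 1ℚ) :- con ½ :+ (con 1ℚ :+ k)) refl (ν k′) ⟩
      ν k′ * - 1ℚ - ½ + (1ℚ + ν k′)                  ≤⟨ +-mono-≤ (+-monoˡ-≤ (- ½) (*-monoˡ (ν k′) (<⇒≤ 0<k′) h)) 1+k′≤n ⟩
      ν k′ * (x + ε) - ½ + ν n                       ≡⟨ cong (λ s → s - ½ + ν n) (trans (*-distribˡ-+ (ν k′) x ε) (cong (_+_ (ν k′ * x)) k′ε)) ⟩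
      ν k′ * x + ½ - ½ + ν n                         ≡⟨ solve 2 (λ p n → p :+ con ½ :- con ½ :+ n := p :+ n) refl (ν k′ * x) (ν n) ⟩
      ν k′ * x + ν n ∎
      where
      open ≤-Reasoning
      1+k′≤n : 1ℚ + ν k′ ≤ ν n
      1+k′≤n = subst (_≤ ν n) (trans (ν-+ 1 k′) (cong (_+ ν k′) ι-1)) (ν-mono (ℕP.m≤m+n k d))

  module _ (L : ℝ) (isUpper : IsUpperBound (λ-Admissible n ξ) (fin L)) where

    0≤L : fromℚ 0ℚ Re.≤ L
    0≤L = isUpper (fromℚ 0ℚ) (0-λ-admissible n ξ)

    S-bound : ∀ L′ → 0ℚ ≤ L′ → L Re.< fromℚ L′ → 0ℚ < 1ℚ - ν k′ * L′ →
      ∃[ G ] (G * (1ℚ - ν k′ * L′) ≡ L′ * ν n + ν d) × IsUpperBound S (fin (fromℚ G))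
    S-bound L′ 0≤L′ L<L′ 0<κ = G , Gκ , λ w w∈S → admissible-bound k′ d 1≤k′ ξ L isUpper L′ 0≤L′ L<L′ G 0≤G Gκ 0<κ w (S⊆ w w∈S)
      where
      κ = 1ℚ - ν k′ * L′
      i = inv-pos κ 0<κ
      G = (L′ * ν n + ν d) * i
      0≤G : 0ℚ ≤ G
      0≤G = *-nonNeg (+-nonNeg (*-nonNeg 0≤L′ (0≤ν n)) (0≤ν d)) (<⇒≤ (inv-pos>0 κ 0<κ))
      Gκ : G * κ ≡ L′ * ν n + ν d
      Gκ = trans (*-assoc (L′ * ν n + ν d) i κ) (trans (cong ((L′ * ν n + ν d) *_) (trans (*-comm i κ) (inv-posʳ κ 0<κ))) (*-identityʳ (L′ * ν n + ν d)))

    -- A rational L′ between L and the quotient at w bounds S by the corresponding G, so w ≤ G by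
    -- leastness; yet the quotient at w exceeds L′ by a definite e.
    finite : ∀ w → IsSup S (fin w) → (b>0 : 0ℝ Re.< denominator w) → ¬ (L Re.< numerator w / denominator w ⟨ b>0 ⟩)
    finite w (_ , least) b>0@(δ , δ>0 , M , δ≤b) L<f = contradict (separate L (numerator w / denominator w ⟨ b>0 ⟩) 0≤L L<f)
      where
      δ≤ : ∀ i → M ℕ.≤ i → δ ≤ seq (denominator w) i
      δ≤ i M≤i = subst (_≤ seq (denominator w) i) (+-identityˡ δ) (δ≤b i M≤i)
      contradict : ∃[ L′ ] ∃[ e ] (0ℚ ≤ L′) × (0ℚ < e) × (L Re.< fromℚ L′) ×
        ∃[ N ] (∀ i → N ℕ.≤ i → L′ + e ≤ seq (numerator w / denominator w ⟨ b>0 ⟩) i) → ⊥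
      contradict (L′ , e , 0≤L′ , 0<e , L<L′ , N , q≥) = from-bound (S-bound L′ 0≤L′ L<L′ 0<κ)
        where
        δ≤′ : ∀ i → M ℕ.≤ i → δ ≤ ν k′ * seq w i + ν n
        δ≤′ i M≤i = subst (δ ≤_) (seq-denominator w i) (δ≤ i M≤i)
        key : ∀ i → M ℕ.≤ i → N ℕ.≤ i → (L′ + e) * (ν k′ * seq w i + ν n) ≤ seq w i - ν d
        key i M≤i N≤i = subst₂ (λ x y → (L′ + e) * x ≤ y) (seq-denominator w i) (seq-numerator w i)
          (quotient-bound (numerator w) (denominator w) b>0 i (δ≤ i M≤i) (q≥ i N≤i))
        0<κ : 0ℚ < 1ℚ - ν k′ * L′
        0<κ = slope-positive L′ e (ν k′) (ν n) (ν d) (seq w (M ℕ.⊔ N)) (<⇒≤ 0<e) (0≤ν k′) (0≤ν d) (0<ν {n} (ℕ.s≤s ℕ.z≤n))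
          (<-≤-trans δ>0 (δ≤′ (M ℕ.⊔ N) (ℕP.m≤m⊔n M N))) (key (M ℕ.⊔ N) (ℕP.m≤m⊔n M N) (ℕP.m≤n⊔m M N))
        from-bound : ∃[ G ] (G * (1ℚ - ν k′ * L′) ≡ L′ * ν n + ν d) × IsUpperBound S (fin (fromℚ G)) → ⊥
        from-bound (G , Gκ , upper) = bound-contradiction L′ e (ν k′) (ν n) (ν d) (seq w i) G δ ε Gκ 0<κ 0<e δ>0
          (δ≤′ i M≤i) (key i M≤i N≤i) εκ (proj₂ eventually i (ℕP.m≤n⊔m (M ℕ.⊔ N) (proj₁ eventually)))
          where
          κ = 1ℚ - ν k′ * L′
          -- Chosen so that ε·κ is half of e·δ, a lower bound for the excess at w.
          ε = ½ * (e * δ) * inv-pos κ 0<κ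
          ε>0 : 0ℚ < ε
          ε>0 = *-pos (half-pos (*-pos 0<e δ>0)) (inv-pos>0 κ 0<κ)
          εκ : ε * κ ≡ ½ * (e * δ)
          εκ = trans (*-assoc (½ * (e * δ)) (inv-pos κ 0<κ) κ) (trans (cong ((½ * (e * δ)) *_) (trans (*-comm (inv-pos κ 0<κ) κ) (inv-posʳ κ 0<κ))) (*-identityʳ (½ * (e * δ))))
          eventually = least (fin (fromℚ G)) upper ε ε>0
          i = M ℕ.⊔ N ℕ.⊔ proj₁ eventually
          M≤i : M ℕ.≤ i
          M≤i = ℕP.≤-trans (ℕP.m≤m⊔n M N) (ℕP.m≤m⊔n (M ℕ.⊔ N) (proj₁ eventually))
          N≤i : N ℕ.≤ i
          N≤i = ℕP.≤-trans (ℕP.m≤n⊔m M N) (ℕP.m≤m⊔n (M ℕ.⊔ N) (proj₁ eventually))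

    -- An L′ below 1/(k - 1) makes κ positive and hence bounds S by a finite G, against the supremum
    -- +∞.
    infinite : IsSup S +∞ → (b>0 : 0ℝ Re.< (fromℕ′ k Re.- 1ℝ)) → ¬ (L Re.< 1ℝ / (fromℕ′ k Re.- 1ℝ) ⟨ b>0 ⟩)
    infinite (_ , least) b>0@(δ , δ>0 , M , δ≤b) L<f = contradict (separate L (1ℝ / (fromℕ′ k Re.- 1ℝ) ⟨ b>0 ⟩) 0≤L L<f)
      where
      contradict : ∃[ L′ ] ∃[ e ] (0ℚ ≤ L′) × (0ℚ < e) × (L Re.< fromℚ L′) ×
        ∃[ N ] (∀ i → N ℕ.≤ i → L′ + e ≤ seq (1ℝ / (fromℕ′ k Re.- 1ℝ) ⟨ b>0 ⟩) i) → ⊥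
      contradict (L′ , e , 0≤L′ , 0<e , L<L′ , N , q≥) =
        let G , _ , upper = S-bound L′ 0≤L′ L<L′ 0<κ in least (fin (fromℚ G)) upper
        where
        i = M ℕ.⊔ N
        key : (L′ + e) * ν k′ ≤ 1ℚ
        key = subst₂ (λ x y → (L′ + e) * x ≤ y) (seq-k-1 i) (trans (seq-fromℕ 1 i) ι-1)
          (quotient-bound 1ℝ (fromℕ′ k Re.- 1ℝ) b>0 i
            (subst (_≤ seq (fromℕ′ k Re.- 1ℝ) i) (+-identityˡ δ) (δ≤b i (ℕP.m≤m⊔n M N))) (q≥ i (ℕP.m≤n⊔m M N)))
        0<κ : 0ℚ < 1ℚ - ν k′ * L′
        0<κ = <-≤-trans (*-pos 0<e (0<ν 1≤k′)) (subst₂ _≤_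
          (solve 3 (λ L e k → (L :+ e) :* k :- k :* L := e :* k) refl L′ e (ν k′)) refl (+-monoˡ-≤ (- (ν k′ * L′)) key))

  k-1>0 : 0ℝ Re.< (fromℕ′ k Re.- 1ℝ)
  k-1>0 = 1ℚ , 0<1 , 0 , λ i _ → subst₂ _≤_ (sym (+-identityˡ 1ℚ)) (sym (seq-k-1 i)) (1≤ν 1≤k′)

  lower-bound : ∀ l → λ[ n , ξ ]≡ l → ∀ w → IsSup S w → LowerBound k n w l
  lower-bound +∞      _             +∞      _    = k-1>0 , tt
  lower-bound (fin L) (isUpper , _) +∞      supS = k-1>0 , ≮⇒≥ᵣ {1ℝ / (fromℕ′ k Re.- 1ℝ) ⟨ k-1>0 ⟩} {L} (infinite L isUpper supS k-1>0)
  lower-bound +∞      _             (fin w) supS = denominator>0 w (proj₁ supS (fromℚ (- 1ℚ)) S∋-1) , tt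
  lower-bound (fin L) (isUpper , _) (fin w) supS = b>0 , ≮⇒≥ᵣ {numerator w / denominator w ⟨ b>0 ⟩} {L} (finite L isUpper w supS b>0)
    where
    b>0 : 0ℝ Re.< denominator w
    b>0 = denominator>0 w (proj₁ supS (fromℚ (- 1ℚ)) S∋-1)

-- Application to the leading-coefficient exponent and to the unrestricted exponent.

wˡᵉᵃᵈ⇒w-admissible : ∀ k ξ w → wˡᵉᵃᵈ-Admissible k ξ w → w-Admissible k ξ w
wˡᵉᵃᵈ⇒w-admissible k ξ w adm Y = let X , Y<X , x , solution , _ = adm Y in X , Y<X , x , solution

-1-w-admissible : ∀ k′ ξ → w-Admissible (suc k′) ξ (fromℚ (- 1ℚ))
-1-w-admissible k′ ξ = wˡᵉᵃᵈ⇒w-admissible (suc k′) ξ (fromℚ (- 1ℚ)) (-1-wˡᵉᵃᵈ-admissible k′ ξ)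

wˡᵉᵃᵈ-bound : ∀ k′ d ξ → 1 ℕ.≤ k′ → ∀ l → λ[ suc k′ ℕ.+ d , ξ ]≡ l →
  ∀ w → wˡᵉᵃᵈ[ suc k′ , ξ ]≡ w → LowerBound (suc k′) (suc k′ ℕ.+ d) w l
wˡᵉᵃᵈ-bound k′ d ξ 1≤k′ = Bound.lower-bound k′ d 1≤k′ ξ (wˡᵉᵃᵈ-Admissible (suc k′) ξ)
  (wˡᵉᵃᵈ⇒w-admissible (suc k′) ξ) (-1-wˡᵉᵃᵈ-admissible k′ ξ)

w-bound : ∀ k′ d ξ → 1 ℕ.≤ k′ → ∀ l → λ[ suc k′ ℕ.+ d , ξ ]≡ l →
  ∀ w → w[ suc k′ , ξ ]≡ w → LowerBound (suc k′) (suc k′ ℕ.+ d) w l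
w-bound k′ d ξ 1≤k′ = Bound.lower-bound k′ d 1≤k′ ξ (w-Admissible (suc k′) ξ) (λ _ adm → adm) (-1-w-admissible k′ ξ)

theorem3p1 : ∀ (k n : ℕ) → 2 ≤ℕ k → k ≤ℕ n →
    ∀ (ξ : ℝ) → Transcendental ξ →
    ∀ (l : ℝ∞) → λ[ n , ξ ]≡ l →
    (∀ (w : ℝ∞) → wˡᵉᵃᵈ[ k , ξ ]≡ w → LowerBound k n w l)
    × ((k ≡ 2 ⊎ n ≡ suc k) → ∀ (w : ℝ∞) → w[ k , ξ ]≡ w → LowerBound k n w l)
theorem3p1 (suc k′) n (ℕ.s≤s 1≤k′) k≤n ξ _ l isλ =
    (λ w isw → subst (λ m → LowerBound (suc k′) m w l) k+d≡n (wˡᵉᵃᵈ-bound k′ d ξ 1≤k′ l isλ′ w isw))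
  , λ _ w isw → subst (λ m → LowerBound (suc k′) m w l) k+d≡n (w-bound k′ d ξ 1≤k′ l isλ′ w isw)
  where
  d = n ℕ.∸ suc k′
  k+d≡n : suc k′ ℕ.+ d ≡ n
  k+d≡n = ℕP.m+[n∸m]≡n k≤n
  isλ′ : λ[ suc k′ ℕ.+ d , ξ ]≡ l
  isλ′ = subst (λ m → λ[ m , ξ ]≡ l) (sym k+d≡n) isλ
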